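{- Let $q=2^{2e+1}$ with $e\ge 1$. All Buekenhout-Tits unitals in $\mathrm{PG}(2,q^2)$ are $\mathrm{PGL}$-equivalent; that is, for any two Buekenhout-Tits unitals $U_1,U_2$ in $\mathrm{PG}(2,q^2)$ there is an element of $\mathrm{PGL}(3,q^2)$ mapping $U_1$ onto $U_2$.
   Context: A unital in $\mathrm{PG}(2,q^2)$ is a set of $q^3+1$ points such that every line meets it in $1$ or $q+1$ points. André/Bruck-Bose (ABB) construction: fix a hyperplane $\Sigma$ of $\mathrm{PG}(4,q)$ and a Desarguesian line spread $\mathcal{S}$ of $\Sigma\cong\mathrm{PG}(3,q)$. The plane $\mathrm{PG}(2,q^2)$ is modelled as follows: the points are the points of $\mathrm{PG}(4,q)\setminus\Sigma$ together with the lines of $\mathcal{S}$ (the latter being the points of a line $\ell_\infty$); the lines are $\ell_\infty$ and the planes of $\mathrm{PG}(4,q)$ not contained in $\Sigma$ that meet $\Sigma$ in a line of $\mathcal{S}$; incidence is natural. Let $\sigma=2^{e+1}$. A Tits ovoid of $\mathrm{PG}(3,q)$ is a point set projectively equivalent to $\{(0,0,0,1)\}\cup\{(1,s,t,s^{\sigma+2}+t^\sigma+st) : s,t\in\mathbb{F}_q\}$. An ovoidal cone in $\mathrm{PG}(4,q)$ with vertex a point $V$ and base an ovoid $\mathcal{O}$ (contained in a hyperplane not through $V$) is the union of the lines joining $V$ to the points of $\mathcal{O}$. A Buekenhout-Tits unital in $\mathrm{PG}(2,q^2)$ is a unital arising, via the ABB construction, from an ovoidal cone $\mathcal{C}$ with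 base a Tits ovoid such that $\mathcal{C}\cap\Sigma$ is a line of the spread $\mathcal{S}$: it consists of the points of $\mathcal{C}\setminus\Sigma$ together with the point of $\ell_\infty$ corresponding to the spread line $\mathcal{C}\cap\Sigma$. -}

module Defs where

open import Level using (0ℓ)
open import Algebra.Bundles using (CommutativeRing)
import Algebra.Definitions as AlgebraDefinitions
open import Algebra.Morphism.Structures using (module RingMorphisms)
import Algebra.Properties.Semiring.Exp as Exp
import Algebra.Properties.Semiring.Sum as Sum
open import Data.Empty using (⊥)
open import Data.Fin.Base using (Fin)
open import Data.Nat.Base as ℕ using (ℕ)
open import Data.Product.Base using (∃; ∃-syntax; Σ-syntax; _×_; _,_; proj₁; proj₂)
open import Data.Sum.Base using (_⊎_; inj₁; inj₂)
open import Data.Sum.Relation.Binary.Pointwise using (_⊎ₛ_)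
open import Data.Unit.Base using (⊤)
open import Data.Vec.Functional using (Vector; []; _∷_; map; replicate; zipWith)
import Data.Vec.Functional.Relation.Binary.Equality.Setoid as VecEquality
open import Function.Bundles using (Inverse; _⇔_)
open import Relation.Binary.Bundles using (Setoid)
import Relation.Binary.Construct.On as On
open import Relation.Binary.Definitions using (_Respects_)
open import Relation.Binary.PropositionalEquality.Properties as ≡ using ()
open import Relation.Nullary.Negation using (¬_)
open import Relation.Unary using (Pred; _∈_; _∉_; _⊆_; _⊈_; _∩_; _≐_)
open import Relation.Unary.Relation.Binary.Equality using (≐-setoid)

subsetoid : (S : Setoid 0ℓ 0ℓ) → Pred (Setoid.Carrier S) 0ℓ → Setoid 0ℓ 0ℓ
subsetoid S U = On.setoid S (proj₁ {B = U})

HasSize : (S : Setoid 0ℓ 0ℓ) → Pred (Setoid.Carrier S) 0ℓ → ℕ → Set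
HasSize S U n = Inverse (≡.setoid (Fin n)) (subsetoid S U)

-- A finite field has decidable equality, so the inequation x ≉ 0# already
-- plays the role of the apartness of a Heyting field.
record FiniteField (q : ℕ) : Set₁ where
  field
    commutativeRing : CommutativeRing 0ℓ 0ℓ
  open CommutativeRing commutativeRing public
  open AlgebraDefinitions _≈_ using (Invertible)
  field
    0≉1        : ¬ (0# ≈ 1#)
    invertible : ∀ {x} → ¬ (x ≈ 0#) → Invertible 1# _*_ x
    order      : Inverse (≡.setoid (Fin q)) setoid

record FieldEmbedding {q r : ℕ} (K : FiniteField q) (L : FiniteField r) : Set where
  private
    module K = FiniteField K
    module L = FiniteField L
  open RingMorphisms K.rawRing L.rawRing using (IsRingMonomorphism)
  field
    ⟦_⟧                : K.Carrier → L.Carrier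
    isRingMonomorphism : IsRingMonomorphism ⟦_⟧

module Projective {q : ℕ} (K : FiniteField q) where

  open FiniteField K
  open VecEquality setoid public using (_≋_)
  open Sum semiring using (sum)
  open import Relation.Binary.Reasoning.Setoid setoid

  Vec : ℕ → Set
  Vec n = Vector Carrier n

  0ᵥ : ∀ {n} → Vec n
  0ᵥ {n} = replicate n 0#

  infixl 6 _+ᵥ_
  infixr 7 _·_

  _+ᵥ_ : ∀ {n} → Vec n → Vec n → Vec n
  _+ᵥ_ = zipWith _+_

  _·_ : ∀ {n} → Carrier → Vec n → Vec n
  c · v = map (c *_) v

  combination : ∀ {k n} → Vec k → Vector (Vec n) k → Vec n
  combination a b i = sum (λ j → a j * b j i)

  LinearlyIndependent : ∀ {k n} → Vector (Vec n) k → Set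
  LinearlyIndependent b = ∀ a → combination a b ≋ 0ᵥ → a ≋ 0ᵥ

  infix 4 _∝_

  _∝_ : ∀ {n} → Vec n → Vec n → Set
  v ∝ w = ∃[ c ] ¬ (c ≈ 0#) × v ≋ c · w

  ∝-setoid : ℕ → Setoid 0ℓ 0ℓ
  ∝-setoid n = record
    { Carrier       = Vec n
    ; _≈_           = _∝_
    ; isEquivalence = record
      { refl  = 1# , (λ 1≈0 → 0≉1 (sym 1≈0)) , λ i → sym (*-identityˡ _)
      ; sym   = ∝-sym
      ; trans = ∝-trans
      }
    }
    where
    ∝-sym : ∀ {v w : Vec n} → v ∝ w → w ∝ v
    ∝-sym {v} {w} (c , c≉0 , v≋cw) with invertible c≉0
    ... | d , dc≈1 , _ = d , d≉0 , λ i → begin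
        w i            ≈⟨ *-identityˡ _ ⟨
        1# * w i       ≈⟨ *-congʳ dc≈1 ⟨
        (d * c) * w i  ≈⟨ *-assoc _ _ _ ⟩
        d * (c * w i)  ≈⟨ *-congˡ (v≋cw i) ⟨
        d * v i        ∎
      where
      d≉0 : ¬ (d ≈ 0#)
      d≉0 d≈0 = 0≉1 (trans (sym (zeroˡ c)) (trans (*-congʳ (sym d≈0)) dc≈1))

    ∝-trans : ∀ {u v w : Vec n} → u ∝ v → v ∝ w → u ∝ w
    ∝-trans {u} {v} {w} (c , c≉0 , u≋cv) (d , d≉0 , v≋dw) =
      c * d , cd≉0 , λ i → begin
        u i            ≈⟨ u≋cv i ⟩
        c * v i        ≈⟨ *-congˡ (v≋dw i) ⟩
        c * (d * w i)  ≈⟨ *-assoc _ _ _ ⟨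
        (c * d) * w i  ∎
      where
      cd≉0 : ¬ (c * d ≈ 0#)
      cd≉0 cd≈0 with invertible c≉0
      ... | c′ , c′c≈1 , _ = d≉0 (begin
        d              ≈⟨ *-identityˡ _ ⟨
        1# * d         ≈⟨ *-congʳ c′c≈1 ⟨
        (c′ * c) * d   ≈⟨ *-assoc _ _ _ ⟩
        c′ * (c * d)   ≈⟨ *-congˡ cd≈0 ⟩
        c′ * 0#        ≈⟨ zeroʳ c′ ⟩
        0#             ∎)

  Point : ℕ → Set
  Point d = Σ[ v ∈ Vec (ℕ.suc d) ] ¬ (v ≋ 0ᵥ)

  pointSetoid : ℕ → Setoid 0ℓ 0ℓ
  pointSetoid d = subsetoid (∝-setoid (ℕ.suc d)) (λ v → ¬ (v ≋ 0ᵥ))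

  infix 4 _≈ₚ_

  _≈ₚ_ : ∀ {d} → Point d → Point d → Set
  _≈ₚ_ {d} = Setoid._≈_ (pointSetoid d)

  -- A k-dimensional subspace of PG(d,K) is given by k+1 linearly independent
  -- vectors spanning it; two of them are equal when they have the same points.
  Flat : ℕ → ℕ → Set
  Flat k d = Σ[ b ∈ Vector (Vec (ℕ.suc d)) (ℕ.suc k) ] LinearlyIndependent b

  infix 4 _∈span_

  _∈span_ : ∀ {k d} → Vec (ℕ.suc d) → Flat k d → Set
  v ∈span (b , _) = ∃[ a ] v ≋ combination a b

  ⟪_⟫ : ∀ {k d} → Flat k d → Pred (Point d) 0ℓ
  ⟪ F ⟫ (v , _) = v ∈span F

  flatSetoid : ℕ → ℕ → Setoid 0ℓ 0ℓ
  flatSetoid k d = On.setoid (≐-setoid (Point d) 0ℓ) (⟪_⟫ {k})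

  Line Plane : ℕ → Set
  Line  = Flat 1
  Plane = Flat 2

  -- Coordinates with respect to the basis of F identify PG(k,K) with F.
  embed : ∀ {k d} → Flat k d → Point k → Point d
  embed (b , independent) (a , a≉0) =
    combination a b , λ ab≋0 → a≉0 (independent a ab≋0)

  image : ∀ {k d} → (Point k → Point d) → Pred (Point k) 0ℓ → Pred (Point d) 0ℓ
  image f U Q = ∃[ P ] P ∈ U × Q ≈ₚ f P

  Matrix : ℕ → Set
  Matrix n = Vector (Vector Carrier n) n

  infixr 7 _*ᵥ_

  _*ᵥ_ : ∀ {n} → Matrix n → Vec n → Vec n
  (M *ᵥ v) i = sum (λ j → M i j * v j)

  record GL (n : ℕ) : Set where
    field
      matrix   : Matrix n
      inverse  : Matrix n
      inverseˡ : ∀ v → inverse *ᵥ matrix *ᵥ v ≋ v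
      inverseʳ : ∀ v → matrix *ᵥ inverse *ᵥ v ≋ v

  *ᵥ-zero : ∀ {n} (M : Matrix n) {v : Vec n} → v ≋ 0ᵥ → M *ᵥ v ≋ 0ᵥ
  *ᵥ-zero {n} M {v} v≋0 i = begin
    sum (λ j → M i j * v j)  ≈⟨ Sum.sum-cong-≋ semiring (λ j → trans (*-congˡ (v≋0 j)) (zeroʳ _)) ⟩
    sum (replicate n 0#)     ≈⟨ Sum.sum-replicate-zero semiring n ⟩
    0#                       ∎

  -- The action on points. Proportional matrices act equally, and the maps
  -- arising in this way are the elements of PGL(d+1,K).
  projectivity : ∀ {d} → GL (ℕ.suc d) → Point d → Point d
  projectivity g (v , v≉0) = matrix *ᵥ v , λ gv≋0 →
    v≉0 λ i → trans (sym (inverseˡ v i)) (*ᵥ-zero inverse gv≋0 i)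
    where open GL g

record IncidenceStructure : Set₁ where
  field
    points lines : Setoid 0ℓ 0ℓ
    _I_          : Setoid.Carrier points → Setoid.Carrier lines → Set

record _≅_ (A B : IncidenceStructure) : Set where
  private
    module A = IncidenceStructure A
    module B = IncidenceStructure B
  field
    onPoints  : Inverse A.points B.points
    onLines   : Inverse A.lines B.lines
    incidence : ∀ P ℓ → (P A.I ℓ) ⇔ (Inverse.to onPoints P B.I Inverse.to onLines ℓ)

PG2 : ∀ {q} → FiniteField q → IncidenceStructure
PG2 K = record
  { points = pointSetoid 2
  ; lines  = flatSetoid 1 2
  ; _I_    = λ P ℓ → P ∈ ⟪ ℓ ⟫
  }
  where open Projective K

record IsUnital (q : ℕ) (A : IncidenceStructure)
                (U : Pred (Setoid.Carrier (IncidenceStructure.points A)) 0ℓ) : Set where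
  open IncidenceStructure A
  field
    respects : U Respects (Setoid._≈_ points)
    size     : HasSize points U (q ℕ.^ 3 ℕ.+ 1)
    meets    : ∀ ℓ → HasSize points (U ∩ (_I ℓ)) 1
                   ⊎ HasSize points (U ∩ (_I ℓ)) (q ℕ.+ 1)

module _ {q : ℕ} (K : FiniteField q) where

  open FiniteField K using (_+_; _*_; 0#; 1#; semiring)
  open Exp semiring using (_^_)
  open Projective K

  standardTitsOvoid : ℕ → Pred (Point 3) 0ℓ
  standardTitsOvoid e (v , _) =
    v ∝ (0# ∷ 0# ∷ 0# ∷ 1# ∷ []) ⊎
    ∃[ s ] ∃[ t ] v ∝ (1# ∷ s ∷ t ∷ s ^ (σ ℕ.+ 2) + t ^ σ + s * t ∷ [])
    where
    σ : ℕ
    σ = 2 ℕ.^ (e ℕ.+ 1)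

  IsTitsOvoid : ℕ → Pred (Point 3) 0ℓ → Set
  IsTitsOvoid e O = ∃[ g ] O ≐ image (projectivity g) (standardTitsOvoid e)

  -- For V outside B, the union of the lines joining V to the points of B.
  cone : ∀ {d} → Point d → Pred (Point d) 0ℓ → Pred (Point d) 0ℓ
  cone {d} V B X =
    ∃[ P ] P ∈ B × Σ[ ℓ ∈ Line d ] V ∈ ⟪ ℓ ⟫ × P ∈ ⟪ ℓ ⟫ × X ∈ ⟪ ℓ ⟫

module _ {q : ℕ} (K : FiniteField q) where

  open Projective K

  record IsLineSpread (Σ∞ : Flat 3 4) (S : Pred (Line 4) 0ℓ) : Set where
    field
      respects : S Respects (Setoid._≈_ (flatSetoid 1 4))
      inside   : ∀ {m} → m ∈ S → ⟪ m ⟫ ⊆ ⟪ Σ∞ ⟫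
      covers   : ∀ {X} → X ∈ ⟪ Σ∞ ⟫ → ∃[ m ] m ∈ S × X ∈ ⟪ m ⟫
      disjoint : ∀ {X m n} → m ∈ S → n ∈ S → X ∈ ⟪ m ⟫ → X ∈ ⟪ n ⟫ → ⟪ m ⟫ ≐ ⟪ n ⟫

module _ {q r : ℕ} {K : FiniteField q} {L : FiniteField r} (ι : FieldEmbedding K L) where

  open FieldEmbedding ι
  private
    module K = Projective K
    module L = Projective L

  -- The points of PG(4,K) on the image of the 1-dimensional L-space of a point.
  reduce : (L.Vec 2 → K.Vec 5) → L.Point 1 → Pred (K.Point 4) 0ℓ
  reduce f (x , _) (v , _) = ∃[ c ] v K.≋ f (c L.· x)

  -- A spread is Desarguesian when it comes from field reduction: under some
  -- K-linear isomorphism f from L² onto the vector space of Σ∞, its lines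
  -- correspond to the points of PG(1,L).
  record IsDesarguesian (Σ∞ : K.Flat 3 4) (S : Pred (K.Line 4) 0ℓ) : Set where
    field
      f           : L.Vec 2 → K.Vec 5
      cong        : ∀ {x y} → x L.≋ y → f x K.≋ f y
      homo-+      : ∀ x y → f (x L.+ᵥ y) K.≋ f x K.+ᵥ f y
      homo-·      : ∀ c x → f (⟦ c ⟧ L.· x) K.≋ c K.· f x
      injective   : ∀ {x y} → f x K.≋ f y → x L.≋ y
      onto        : ∀ v → (v K.∈span Σ∞) ⇔ (∃[ x ] f x K.≋ v)
      lines       : ∀ m → (m ∈ S) ⇔ (∃[ Q ] K.⟪ m ⟫ ≐ reduce f Q)

module AndréBruckBose {q : ℕ} (K : FiniteField q)
  (Σ∞ : Projective.Flat K 3 4) (S : Pred (Projective.Line K 4) 0ℓ) where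

  open Projective K

  IsAffinePlane : Pred (Plane 4) 0ℓ
  IsAffinePlane π = ⟪ π ⟫ ⊈ ⟪ Σ∞ ⟫ × ∃[ m ] m ∈ S × ⟪ π ⟫ ∩ ⟪ Σ∞ ⟫ ≐ ⟪ m ⟫

  AffinePoint SpreadLine AffinePlane : Set
  AffinePoint = ∃ (_∉ ⟪ Σ∞ ⟫)
  SpreadLine  = ∃ S
  AffinePlane = ∃ IsAffinePlane

  plane : IncidenceStructure
  plane = record
    { points = subsetoid (pointSetoid 4) (_∉ ⟪ Σ∞ ⟫) ⊎ₛ subsetoid (flatSetoid 1 4) S
    ; lines  = ≡.setoid ⊤ ⊎ₛ subsetoid (flatSetoid 2 4) IsAffinePlane
    ; _I_    = incident
    }
    where
    -- inj₁ of the unit type is the line ℓ∞.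
    incident : AffinePoint ⊎ SpreadLine → ⊤ ⊎ AffinePlane → Set
    incident (inj₁ _)       (inj₁ _)       = ⊥
    incident (inj₂ _)       (inj₁ _)       = ⊤
    incident (inj₁ (X , _)) (inj₂ (π , _)) = X ∈ ⟪ π ⟫
    incident (inj₂ (m , _)) (inj₂ (π , _)) = ⟪ m ⟫ ⊆ ⟪ π ⟫

  -- C∖Σ∞ together with the point at infinity given by the line C ∩ Σ∞.
  fromCone : Pred (Point 4) 0ℓ → Pred (AffinePoint ⊎ SpreadLine) 0ℓ
  fromCone C (inj₁ (X , _)) = X ∈ C
  fromCone C (inj₂ (m , _)) = C ∩ ⟪ Σ∞ ⟫ ≐ ⟪ m ⟫

-- PG(2,L) is modelled by the André/Bruck-Bose plane through an arbitrary
-- isomorphism of incidence structures.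
record IsBuekenhoutTitsUnital
  (e : ℕ) {q r : ℕ} {K : FiniteField q} {L : FiniteField r} (ι : FieldEmbedding K L)
  (U : Pred (Projective.Point L 2) 0ℓ) : Set₁ where

  open Projective K

  field
    isUnital       : IsUnital q (PG2 L) U
    Σ∞             : Flat 3 4
    S              : Pred (Line 4) 0ℓ
    isLineSpread   : IsLineSpread K Σ∞ S
    isDesarguesian : IsDesarguesian ι Σ∞ S

  open AndréBruckBose K Σ∞ S

  field
    model       : plane ≅ PG2 L
    V           : Point 4
    H           : Flat 3 4
    V∉H         : V ∉ ⟪ H ⟫
    O           : Pred (Point 3) 0ℓ
    isTitsOvoid : IsTitsOvoid K e O

  C : Pred (Point 4) 0ℓ
  C = cone K V (image (embed H) O)

  field
    meetsInSpreadLine : ∃[ m ] m ∈ S × C ∩ ⟪ Σ∞ ⟫ ≐ ⟪ m ⟫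
    arises            : ∀ P → (P ∈ fromCone C) ⇔ (Inverse.to (_≅_.onPoints model) P ∈ U)

module Submission where

open import Defs
open import Level using (0ℓ)
open import Algebra.Bundles using (CommutativeMonoid; RawRing)
open import Algebra.Morphism.Structures using (module RingMorphisms)
import Algebra.Properties.CommutativeMonoid.Sum as MonoidSum
import Algebra.Properties.Monoid.Mult as Mult
import Algebra.Properties.Ring as RingProperties
import Algebra.Properties.Semiring.Exp as Exp
import Algebra.Properties.Semiring.Sum as Sum
import Algebra.Solver.Ring as RingSolver
open import Algebra.Solver.Ring.AlmostCommutativeRing
  using (_-Raw-AlmostCommutative⟶_; fromCommutativeSemiring)
open import Data.Bool.Base using (Bool; true; false; _∧_; _xor_)
import Data.Bool.Properties as Bool
open import Data.Empty using (⊥; ⊥-elim)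
open import Data.Fin.Base using (Fin; zero; suc; punchIn; punchOut; funToFin; finToFun; combine)
open import Data.Fin.Patterns using (0F; 1F; 2F; 3F)
import Data.Fin.Permutation as Perm
import Data.Fin.Properties as Fin
import Data.Maybe.Base as Maybe
open import Data.Nat.Base as ℕ using (ℕ)
import Data.Nat.Properties as ℕ
import Data.Nat.Solver as ℕSolver
open import Data.Product.Base using (∃; ∃-syntax; Σ-syntax; _×_; _,_; proj₁; proj₂)
open import Data.Sum.Base using (_⊎_; inj₁; inj₂)
open import Data.Sum.Relation.Binary.Pointwise using (inj₁; inj₂)
open import Data.Unit.Base using (tt)
open import Data.Vec.Functional using (Vector; []; _∷_)
import Data.Vec.Functional.Relation.Binary.Equality.Setoid as VecEquality
open import Function.Base using (_∘_; id)
open import Function.Bundles using (Inverse; _⇔_; mk⇔; Equivalence)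
open import Function.Definitions using (Congruent; Injective)
open import Relation.Binary.Bundles using (Setoid)
open import Relation.Binary.Definitions using (Decidable; WeaklyDecidable; _Respects_)
open import Relation.Binary.PropositionalEquality.Core as ≡ using (_≡_)
open import Relation.Binary.PropositionalEquality.Properties as ≡ using ()
open import Relation.Nullary.Decidable as Dec using (Dec; yes; no; map′; ¬?)
open import Relation.Nullary.Negation using (¬_; contradiction)
open import Relation.Unary using (Pred; _∈_; _∉_; _⊆_; _∩_; _≐_)
import Relation.Unary as Unary

-- A K-linear map π projecting the cone from its vertex onto K⁴ turns it into the
-- standard Tits ovoid. The spread line in the cone lies over a point of the
-- ovoid, which the Suzuki group moves to (0,0,0,1), and Σ∞ becomes the preimage
-- of the tangent plane there. With Σ∞ = L² as the spread prescribes, the choice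
-- of an L-basis of L² together with the stabiliser of (0,0,0,1) brings π into
-- the form (x , y) ↦ (0 , Im x , Re x , Im y), the coordinates being those with
-- respect to 1 , ω, where ω² + ω = 1. So the unital is, up to the isomorphism of
-- the two planes, the fixed set of all (x , y) with Im y = F (Im x) (Re x),
-- together with the point at infinity of the vertical lines.
--
-- In a frame of PG(2,L) that isomorphism maps (x , y) to (τ x , τ y), and since
-- the lines y = m x + b go to lines, τ (m x + b) = τ m τ x + τ b. The automorphism
-- τ preserves K, commutes with F and maps ω to ω or ω + 1; in the second case an
-- affine map with coefficients in L undoes its effect on the standard unital.

-- The isomorphism between the two planes is arbitrary, so coordinates determine a unital only up to
-- a semilinear map, and equivalence under collineations comes more easily than equivalence under
-- PGL. The field automorphism can be absorbed because the normal form is written over 𝔽₂. `F` has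
-- coefficients 0 and 1. As the degree 2e + 1 of `K` is odd, the absolute trace of 1 is 1, so w² + w
-- + 1 stays irreducible over `K` and `ω` can be taken in 𝔽₄, where an automorphism has only two
-- choices. The normal form is reachable for two reasons. Every `K`-linear form on `L` is z ↦ Im (d
-- z) for some d, so a coordinate of π along an `L`-direction becomes Im, or vanishes, after a
-- change of `L`-basis. The one coordinate out of reach of such a change keeps two parameters,
-- removed by a dilation and a translation of the ovoid, whose parameters exist because x ↦ x^σ is
-- bijective. Finiteness replaces elimination and choice: bases span by counting, and existence is
-- decided by search.

-- Finite setoids and counting.

Finite : ℕ → Setoid 0ℓ 0ℓ → Set
Finite n A = Inverse (≡.setoid (Fin n)) A

-- Punching a missed value `y` out of the codomain would inject `Fin (suc n)` into `Fin n`.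
Fin-injective⇒surjective : ∀ {n} (f : Fin n → Fin n) → Injective _≡_ _≡_ f →
                           ∀ y → ∃[ x ] f x ≡ y
Fin-injective⇒surjective {ℕ.suc n} f inj y with Fin.any? (λ x → f x Fin.≟ y)
... | yes found = found
... | no ¬found = contradiction
  (Fin.injective⇒≤ {f = λ x → punchOut (λ y≡fx → ¬found (x , ≡.sym y≡fx))}
    (λ eq → inj (Fin.punchOut-injective {i = y} _ _ eq)))
  ℕ.1+n≰n

module _ {n : ℕ} {A : Setoid 0ℓ 0ℓ} (finite : Finite n A) where
  open Setoid A
  open Inverse finite

  to-from : ∀ x → to (from x) ≈ x
  to-from x = inverseˡ ≡.refl

  from-injective : Injective _≈_ _≡_ from
  from-injective {x} {y} eq = trans (sym (to-from x)) (trans (to-cong eq) (to-from y))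

  to-injective : Injective _≡_ _≈_ to
  to-injective eq = ≡.trans (≡.sym (inverseʳ refl)) (≡.trans (from-cong eq) (inverseʳ refl))

  finite⇒decidable : Decidable _≈_
  finite⇒decidable x y = map′ from-injective from-cong (from x Fin.≟ from y)

  -- Exhaustive search makes the case distinctions on existence constructive, such as whether some
  -- vector lies outside a subspace.
  search : {P : Pred Carrier 0ℓ} → P Respects _≈_ → Unary.Decidable P → Dec (∃ P)
  search resp P? = map′ (λ (i , p) → to i , p)
                        (λ (x , p) → from x , resp (sym (to-from x)) p)
                        (Fin.any? (P? ∘ to))

module _ {A B : Setoid 0ℓ 0ℓ} where
  private
    module A = Setoid A
    module B = Setoid B

  injective⇒≤ : ∀ {m n} → Finite m A → Finite n B → (f : A.Carrier → B.Carrier) →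
                Injective A._≈_ B._≈_ f → m ℕ.≤ n
  injective⇒≤ a b f inj = Fin.injective⇒≤ {f = Inverse.from b ∘ f ∘ Inverse.to a}
    (to-injective a ∘ inj ∘ from-injective b)

  abstract
    -- The source of spanning statements and of inverses of field endomorphisms below: injectivity
    -- is checked by algebra, and preimages come from counting.
    injective⇒surjective : ∀ {n} → Finite n A → Finite n B → (f : A.Carrier → B.Carrier) →
                           Congruent A._≈_ B._≈_ f → Injective A._≈_ B._≈_ f →
                           ∀ y → ∃[ x ] f x B.≈ y
    injective⇒surjective a b f f-cong inj y
      with i , eq ← Fin-injective⇒surjective (Inverse.from b ∘ f ∘ Inverse.to a)
                      (to-injective a ∘ inj ∘ from-injective b) (Inverse.from b y)
      = Inverse.to a i , from-injective b eq

module _ {A : Setoid 0ℓ 0ℓ} where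
  open Setoid A
  open VecEquality A using (≋-setoid)

  funToFin-cong : ∀ {m n} {f g : Fin m → Fin n} → (∀ i → f i ≡ g i) → funToFin f ≡ funToFin g
  funToFin-cong {ℕ.zero}  f≗g = ≡.refl
  funToFin-cong {ℕ.suc m} f≗g = ≡.cong₂ combine (f≗g zero) (funToFin-cong (f≗g ∘ suc))

  vectors-finite : ∀ {n} → Finite n A → ∀ k → Finite (n ℕ.^ k) (≋-setoid k)
  vectors-finite {n} a k = record
    { to        = λ j i → to (finToFun {n} {k} j i)
    ; from      = λ v → funToFin (from ∘ v)
    ; to-cong   = λ { ≡.refl i → refl }
    ; from-cong = λ v≋w → funToFin-cong (from-cong ∘ v≋w)
    ; inverse   = (λ { {v} ≡.refl i → trans (to-cong (Fin.finToFun-funToFin (from ∘ v) i)) (to-from a (v i)) })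
                , (λ { {j} {v} v≋ → ≡.trans (funToFin-cong (λ i → inverseʳ (v≋ i))) (Fin.funToFin-finToFin {k} {n} j) })
    }
    where open Inverse a

module _ (M : CommutativeMonoid 0ℓ 0ℓ) where
  open CommutativeMonoid M
  open MonoidSum M
  open import Relation.Binary.Reasoning.Setoid setoid

  sum-single : ∀ {n} (i : Fin n) t → (∀ j → ¬ (j ≡ i) → t j ≈ ε) → sum t ≈ t i
  sum-single {ℕ.suc n} i t others = begin
    sum t                                  ≈⟨ sum-remove {i = i} t ⟩
    t i ∙ sum (λ j → t (punchIn i j))      ≈⟨ ∙-congˡ (sum-cong-≋ (λ j → others _ (Fin.punchInᵢ≢i i j))) ⟩
    t i ∙ sum {n} (λ _ → ε)                ≈⟨ ∙-congˡ (sum-replicate-zero n) ⟩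
    t i ∙ ε                                ≈⟨ identityʳ _ ⟩
    t i                                    ∎

-- Finite fields: inverses, and the identity a^q = a.

module FieldProperties {q : ℕ} (K : FiniteField q) where
  open FiniteField K
  open Exp semiring using (_^_; ^-congˡ)
  open import Relation.Binary.Reasoning.Setoid setoid
  open Inverse order using (to; from)

  infix 4 _≟_

  _≟_ : Decidable _≈_
  _≟_ = finite⇒decidable order

  1≉0 : 1# ≉ 0#
  1≉0 1≈0 = 0≉1 (sym 1≈0)

  module _ {x : Carrier} (x≉0 : x ≉ 0#) where

    inv : Carrier
    inv = proj₁ (invertible x≉0)

    inv-* : inv * x ≈ 1#
    inv-* = proj₁ (proj₂ (invertible x≉0))

    *-inv : x * inv ≈ 1#
    *-inv = proj₂ (proj₂ (invertible x≉0))

    *-zero⇒ : ∀ {y} → x * y ≈ 0# → y ≈ 0#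
    *-zero⇒ {y} xy≈0 = begin
      y              ≈⟨ *-identityˡ y ⟨
      1# * y         ≈⟨ *-congʳ inv-* ⟨
      (inv * x) * y  ≈⟨ *-assoc _ _ _ ⟩
      inv * (x * y)  ≈⟨ *-congˡ xy≈0 ⟩
      inv * 0#       ≈⟨ zeroʳ _ ⟩
      0#             ∎

    *-cancelˡ : ∀ {y z} → x * y ≈ x * z → y ≈ z
    *-cancelˡ {y} {z} xy≈xz = begin
      y              ≈⟨ *-identityˡ y ⟨
      1# * y         ≈⟨ *-congʳ inv-* ⟨
      (inv * x) * y  ≈⟨ *-assoc _ _ _ ⟩
      inv * (x * y)  ≈⟨ *-congˡ xy≈xz ⟩
      inv * (x * z)  ≈⟨ *-assoc _ _ _ ⟨
      (inv * x) * z  ≈⟨ *-congʳ inv-* ⟩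
      1# * z         ≈⟨ *-identityˡ z ⟩
      z              ∎

    inv-*∙ : ∀ y → inv * (x * y) ≈ y
    inv-*∙ y = trans (sym (*-assoc _ _ _)) (trans (*-congʳ inv-*) (*-identityˡ y))

    *-inv∙ : ∀ y → x * (inv * y) ≈ y
    *-inv∙ y = trans (sym (*-assoc _ _ _)) (trans (*-congʳ *-inv) (*-identityˡ y))

    inv≉0 : inv ≉ 0#
    inv≉0 eq = 1≉0 (trans (sym inv-*) (trans (*-congʳ eq) (zeroˡ x)))

  *-≉0 : ∀ {x y} → x ≉ 0# → y ≉ 0# → x * y ≉ 0#
  *-≉0 x≉0 y≉0 xy≈0 = y≉0 (*-zero⇒ x≉0 xy≈0)

  zero-product : ∀ {x y} → x * y ≈ 0# → x ≈ 0# ⊎ y ≈ 0#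
  zero-product {x} xy≈0 with x ≟ 0#
  ... | yes x≈0 = inj₁ x≈0
  ... | no  x≉0 = inj₂ (*-zero⇒ x≉0 xy≈0)

  module _ (f g : Carrier → Carrier) (f-cong : ∀ {x y} → x ≈ y → f x ≈ f y)
           (g-cong : ∀ {x y} → x ≈ y → g x ≈ g y)
           (fg : ∀ x → f (g x) ≈ x) (gf : ∀ x → g (f x) ≈ x) where

    -- Sums over the field are indexed by `Fin q`, so a bijection of the field must be moved to the
    -- indices before `sum-permute` applies.
    conjugate : Perm.Permutation q q
    conjugate = Perm.permutation (from ∘ f ∘ to) (from ∘ g ∘ to)
      (λ y → to-injective order (trans (to-from order _) (trans (f-cong (to-from order _)) (fg _))))
      (λ x → to-injective order (trans (to-from order _) (trans (g-cong (to-from order _)) (gf _))))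

  -- Translation by 1 permutes the field, so it leaves the sum of all elements unchanged while
  -- adding 1 to each of the `q` summands.
  order×1≈0 : Mult._×_ +-monoid q 1# ≈ 0#
  order×1≈0 = ∙-cancelˡ (sum to) _ _ (begin
    sum to + Mult._×_ +-monoid q 1#              ≈⟨ +-congˡ (sum-replicate q) ⟨
    sum to + sum {q} (λ _ → 1#)                  ≈⟨ ∑-distrib-+ to (λ _ → 1#) ⟨
    sum (λ i → to i + 1#)                        ≈⟨ sum-cong-≋ {q} (λ i → to-from order (to i + 1#)) ⟨
    sum (λ i → to (from (to i + 1#)))            ≈⟨ sum-permute to shift ⟨
    sum to                                       ≈⟨ +-identityʳ _ ⟨
    sum to + 0#                                  ∎)
    where
    open MonoidSum +-commutativeMonoid
    open import Algebra.Properties.Group +-group using (∙-cancelˡ)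
    shift : Perm.Permutation q q
    shift = conjugate (_+ 1#) (_+ (- 1#)) +-congʳ +-congʳ
      (λ x → trans (+-assoc _ _ _) (trans (+-congˡ (-‿inverseˡ 1#)) (+-identityʳ x)))
      (λ x → trans (+-assoc _ _ _) (trans (+-congˡ (-‿inverseʳ 1#)) (+-identityʳ x)))

  -- For nonzero `a` the dilation by `a` permutes the nonzero elements, whose product is `Π`. The
  -- product runs over all `q` indices, with 1 in place of the element 0, so one factor `a` is left
  -- over and the exponent is `q` instead of q - 1.
  ^order : ∀ a → a ^ q ≈ a
  ^order a with a ≟ 0#
  -- The index `from 0#` is an inhabitant of `Fin q`, which shows that the exponent is positive.
  ... | yes a≈0 = trans (^-congˡ q a≈0) (trans (0^ (from 0#)) (sym a≈0))
    where
    0^ : ∀ {n} → Fin n → 0# ^ n ≈ 0#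
    0^ {ℕ.suc n} _ = zeroˡ _
  ... | no a≉0 = *-cancelˡ Π≉0 (begin
    Π * a ^ q                         ≈⟨ *-comm _ _ ⟩
    a ^ q * Π                         ≈⟨ *-congʳ (sum-replicate q) ⟨
    sum {q} (λ _ → a) * Π             ≈⟨ ∑-distrib-+ (λ _ → a) (f ∘ to) ⟨
    sum (λ i → a * f (to i))          ≈⟨ sum-cong-≋ (λ i → scale (to i)) ⟨
    sum (λ i → f (a * to i) * e (to i))  ≈⟨ ∑-distrib-+ (λ i → f (a * to i)) (e ∘ to) ⟩
    sum (λ i → f (a * to i)) * sum (e ∘ to) ≈⟨ *-congʳ (sum-cong-≋ {q} (λ i → f-cong (to-from order (a * to i)))) ⟨
    sum (λ i → f (to (from (a * to i)))) * sum (e ∘ to) ≈⟨ *-congʳ (sum-permute (f ∘ to) dilate) ⟨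
    Π * sum (e ∘ to)                  ≈⟨ *-congˡ Πe ⟩
    Π * a                             ∎)
    where
    -- The monoid is multiplicative here, so `sum` denotes a product.
    open MonoidSum *-commutativeMonoid

    -- f drops the factor 0 from the product of all elements; e records the
    -- factor a which the dilation by a loses there.
    f e : Carrier → Carrier
    f x with x ≟ 0#
    ... | yes _ = 1#
    ... | no  _ = x
    e x with x ≟ 0#
    ... | yes _ = a
    ... | no  _ = 1#

    f-cong : ∀ {x y} → x ≈ y → f x ≈ f y
    f-cong {x} {y} x≈y with x ≟ 0# | y ≟ 0#
    ... | yes _   | yes _   = refl
    ... | yes x≈0 | no  y≉0 = ⊥-elim (y≉0 (trans (sym x≈y) x≈0))
    ... | no  x≉0 | yes y≈0 = ⊥-elim (x≉0 (trans x≈y y≈0))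
    ... | no  _   | no  _   = x≈y

    f≉0 : ∀ x → f x ≉ 0#
    f≉0 x with x ≟ 0#
    ... | yes _   = 1≉0
    ... | no  x≉0 = x≉0

    scale : ∀ x → f (a * x) * e x ≈ a * f x
    scale x with x ≟ 0# | a * x ≟ 0#
    ... | yes _   | yes _    = *-comm 1# a
    ... | yes x≈0 | no  ax≉0 = ⊥-elim (ax≉0 (trans (*-congˡ x≈0) (zeroʳ a)))
    ... | no  x≉0 | yes ax≈0 = ⊥-elim (*-≉0 a≉0 x≉0 ax≈0)
    ... | no  _   | no  _    = *-identityʳ _

    sum≉0 : ∀ {n} (t : Fin n → Carrier) → (∀ i → t i ≉ 0#) → sum t ≉ 0#
    sum≉0 {ℕ.zero}  t t≉0 = 1≉0
    sum≉0 {ℕ.suc n} t t≉0 = *-≉0 (t≉0 Fin.zero) (sum≉0 (t ∘ Fin.suc) (t≉0 ∘ Fin.suc))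

    Π : Carrier
    Π = sum (f ∘ to)

    Π≉0 : Π ≉ 0#
    Π≉0 = sum≉0 _ (λ i → f≉0 (to i))

    Πe : sum (e ∘ to) ≈ a
    Πe = trans (sum-single *-commutativeMonoid (from 0#) (e ∘ to) others) at-0
      where
      others : ∀ j → ¬ (j ≡ from 0#) → e (to j) ≈ 1#
      others j j≢ with to j ≟ 0#
      ... | yes eq = ⊥-elim (j≢ (≡.sym (Inverse.inverseʳ order (sym eq))))
      ... | no  _  = refl
      at-0 : e (to (from 0#)) ≈ a
      at-0 with to (from 0#) ≟ 0#
      ... | yes _  = refl
      ... | no neq = ⊥-elim (neq (to-from order 0#))

    dilate : Perm.Permutation q q
    dilate = conjugate (a *_) (inv a≉0 *_) *-congˡ *-congˡ (*-inv∙ a≉0) (inv-*∙ a≉0)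

-- Characteristic 2: solver, squaring, powers of Frobenius.

Characteristic2 : ∀ {q} → FiniteField q → Set
Characteristic2 K = 1# + 1# ≈ 0#
  where open FiniteField K

-- The sum of 2^n ones is the n-th power of 1 + 1, and it vanishes by `order×1≈0`.
order-2^n⇒1+1≈0 : ∀ n (K : FiniteField (2 ℕ.^ n)) → Characteristic2 K
order-2^n⇒1+1≈0 n K with FieldProperties._≟_ K (1# + 1#) 0#
  where open FiniteField K
... | yes eq = eq
... | no neq = ⊥-elim (powers n order×1≈0)
  where
  open FiniteField K
  open FieldProperties K
  open Mult +-monoid using () renaming (_×_ to _⊗_; ×-assocˡ to ⊗-assoc)
  powers : ∀ m → ¬ ((2 ℕ.^ m) ⊗ 1# ≈ 0#)
  powers ℕ.zero    eq = 1≉0 (trans (sym (+-identityʳ 1#)) eq)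
  powers (ℕ.suc m) eq = *-≉0 neq (powers m)
    (trans (distribʳ _ _ _) (trans (+-cong (*-identityˡ _) (trans (*-identityˡ _) (sym (+-identityʳ _))))
      (trans (⊗-assoc 1# 2 (2 ℕ.^ m)) eq)))

module Char2 {q : ℕ} (K : FiniteField q) (1+1≈0 : Characteristic2 K) where
  open FiniteField K
  open FieldProperties K
  open Exp semiring
  open import Relation.Binary.Reasoning.Setoid setoid

  private
    -- Coefficients modulo 2 let the ring solver prove identities that hold only in characteristic
    -- 2; negation is the identity.
    𝔽₂ : RawRing 0ℓ 0ℓ
    𝔽₂ = record { Carrier = Bool ; _≈_ = _≡_ ; _+_ = _xor_ ; _*_ = _∧_
                ; -_ = id ; 0# = false ; 1# = true }

    ⟦_⟧₂ : Bool → Carrier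
    ⟦ false ⟧₂ = 0#
    ⟦ true  ⟧₂ = 1#

    morphism : 𝔽₂ -Raw-AlmostCommutative⟶ fromCommutativeSemiring commutativeSemiring
    morphism = record
      { ⟦_⟧    = ⟦_⟧₂
      ; +-homo = λ { false _ → sym (+-identityˡ _) ; true false → sym (+-identityʳ _) ; true true → sym 1+1≈0 }
      ; *-homo = λ { false _ → sym (zeroˡ _) ; true _ → sym (*-identityˡ _) }
      ; -‿homo = λ _ → refl
      ; 0-homo = refl
      ; 1-homo = refl
      }

    _coeff≟_ : WeaklyDecidable (λ a b → ⟦ a ⟧₂ ≈ ⟦ b ⟧₂)
    a coeff≟ b = Maybe.map (λ { ≡.refl → refl }) (Dec.dec⇒maybe (a Bool.≟ b))

  module Solver = RingSolver 𝔽₂ (fromCommutativeSemiring commutativeSemiring) morphism _coeff≟_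

  open Solver using (solve; _:=_; _:+_; _:*_; con)

  x+x≈0 : ∀ x → x + x ≈ 0#
  x+x≈0 = solve 1 (λ x → x :+ x := con false) refl

  ≈⇒+≈0 : ∀ {x y} → x ≈ y → x + y ≈ 0#
  ≈⇒+≈0 {x} {y} x≈y = trans (+-congʳ x≈y) (x+x≈0 y)

  +≈0⇒≈ : ∀ {x y} → x + y ≈ 0# → x ≈ y
  +≈0⇒≈ {x} {y} eq = begin
    x            ≈⟨ solve 2 (λ x y → x := (x :+ y) :+ y) refl x y ⟩
    (x + y) + y  ≈⟨ +-congʳ eq ⟩
    0# + y       ≈⟨ +-identityˡ y ⟩
    y            ∎

  -- Equations are derived from others by exhibiting the difference of the two
  -- sides as a linear combination of differences.
  by₁ : ∀ {x y a b} k → x + y ≈ k * (a + b) → a ≈ b → x ≈ y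
  by₁ k eq a≈b = +≈0⇒≈ (trans eq (trans (*-congˡ (≈⇒+≈0 a≈b)) (zeroʳ k)))

  by₂ : ∀ {x y a b c d} k l → x + y ≈ k * (a + b) + l * (c + d) → a ≈ b → c ≈ d → x ≈ y
  by₂ k l eq a≈b c≈d = +≈0⇒≈ (trans eq (trans (+-cong
    (trans (*-congˡ (≈⇒+≈0 a≈b)) (zeroʳ k))
    (trans (*-congˡ (≈⇒+≈0 c≈d)) (zeroʳ l))) (+-identityˡ 0#)))

  by₃ : ∀ {x y a b c d e f} k l m → x + y ≈ k * (a + b) + l * (c + d) + m * (e + f) →
        a ≈ b → c ≈ d → e ≈ f → x ≈ y
  by₃ k l m eq a≈b c≈d e≈f = +≈0⇒≈ (trans eq (trans (+-cong (trans (+-cong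
    (trans (*-congˡ (≈⇒+≈0 a≈b)) (zeroʳ k))
    (trans (*-congˡ (≈⇒+≈0 c≈d)) (zeroʳ l))) (+-identityˡ 0#))
    (trans (*-congˡ (≈⇒+≈0 e≈f)) (zeroʳ m))) (+-identityˡ 0#)))

  square-zero : ∀ {x} → x * x ≈ 0# → x ≈ 0#
  square-zero xx≈0 with zero-product xx≈0
  ... | inj₁ eq = eq
  ... | inj₂ eq = eq

  square-injective : ∀ {x y} → x * x ≈ y * y → x ≈ y
  square-injective {x} {y} eq = +≈0⇒≈ (square-zero (trans
    (solve 2 (λ x y → (x :+ y) :* (x :+ y) := x :* x :+ y :* y) refl x y) (≈⇒+≈0 eq)))

  ^2^suc : ∀ x k → x ^ (2 ℕ.^ ℕ.suc k) ≈ x ^ (2 ℕ.^ k) * x ^ (2 ℕ.^ k)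
  ^2^suc x k = begin
    x ^ (2 ℕ.* 2 ℕ.^ k)            ≈⟨ ^-homo-* x (2 ℕ.^ k) (2 ℕ.^ k ℕ.+ 0) ⟩
    x ^ (2 ℕ.^ k) * x ^ (2 ℕ.^ k ℕ.+ 0)  ≈⟨ *-congˡ (^-congʳ x (ℕ.+-identityʳ (2 ℕ.^ k))) ⟩
    x ^ (2 ℕ.^ k) * x ^ (2 ℕ.^ k)  ∎

  ^2^-distrib-+ : ∀ k x y → (x + y) ^ (2 ℕ.^ k) ≈ x ^ (2 ℕ.^ k) + y ^ (2 ℕ.^ k)
  ^2^-distrib-+ ℕ.zero    x y = trans (*-identityʳ _) (sym (+-cong (*-identityʳ x) (*-identityʳ y)))
  ^2^-distrib-+ (ℕ.suc k) x y = begin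
    (x + y) ^ (2 ℕ.^ ℕ.suc k)          ≈⟨ ^2^suc (x + y) k ⟩
    (x + y) ^ (2 ℕ.^ k) * (x + y) ^ (2 ℕ.^ k)  ≈⟨ *-cong (^2^-distrib-+ k x y) (^2^-distrib-+ k x y) ⟩
    (x ^ (2 ℕ.^ k) + y ^ (2 ℕ.^ k)) * (x ^ (2 ℕ.^ k) + y ^ (2 ℕ.^ k))
      ≈⟨ solve 2 (λ x y → (x :+ y) :* (x :+ y) := x :* x :+ y :* y) refl _ _ ⟩
    x ^ (2 ℕ.^ k) * x ^ (2 ℕ.^ k) + y ^ (2 ℕ.^ k) * y ^ (2 ℕ.^ k)
      ≈⟨ +-cong (^2^suc x k) (^2^suc y k) ⟨
    x ^ (2 ℕ.^ ℕ.suc k) + y ^ (2 ℕ.^ ℕ.suc k)  ∎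

  ^-distrib-* : ∀ n x y → (x * y) ^ n ≈ x ^ n * y ^ n
  ^-distrib-* ℕ.zero    x y = sym (*-identityʳ 1#)
  ^-distrib-* (ℕ.suc n) x y = trans (*-congˡ (^-distrib-* n x y))
    (solve 4 (λ x y a b → (x :* y) :* (a :* b) := (x :* a) :* (y :* b)) refl x y (x ^ n) (y ^ n))

  ^2^-∘ : ∀ x j k → (x ^ (2 ℕ.^ j)) ^ (2 ℕ.^ k) ≈ x ^ (2 ℕ.^ (j ℕ.+ k))
  ^2^-∘ x j k = trans (^-assocʳ x (2 ℕ.^ j) (2 ℕ.^ k)) (^-congʳ x (≡.sym (ℕ.^-distribˡ-+-* 2 j k)))

  1^ : ∀ n → 1# ^ n ≈ 1#
  1^ ℕ.zero    = refl
  1^ (ℕ.suc n) = trans (*-identityˡ _) (1^ n)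

  0^2^ : ∀ k → 0# ^ (2 ℕ.^ k) ≈ 0#
  0^2^ k with 2 ℕ.^ k | ℕ.m^n≢0 2 k
  ... | ℕ.suc n | _ = zeroˡ _

  ^-≉0 : ∀ n {x} → x ≉ 0# → x ^ n ≉ 0#
  ^-≉0 ℕ.zero    x≉0 = 1≉0
  ^-≉0 (ℕ.suc n) x≉0 = *-≉0 x≉0 (^-≉0 n x≉0)

-- Linear algebra over a finite field.

module LinearAlgebra {q : ℕ} (K : FiniteField q) where
  open FiniteField K hiding (zero)
  open FieldProperties K
  open Projective K
  open Sum semiring using (sum; sum-cong-≋; sum-replicate-zero; ∑-distrib-+; *-distribˡ-sum)
  open VecEquality setoid public using (≋-refl; ≋-sym; ≋-trans; ≋-setoid)
  open RingProperties ring using (-1*x≈-x; -‿involutive)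
  open import Relation.Binary.Reasoning.Setoid setoid

  private variable k l m n : ℕ

  +ᵥ-cong : {u v u′ v′ : Vec n} → u ≋ u′ → v ≋ v′ → u +ᵥ v ≋ u′ +ᵥ v′
  +ᵥ-cong p r i = +-cong (p i) (r i)

  ·-cong : {c d : Carrier} {v w : Vec n} → c ≈ d → v ≋ w → c · v ≋ d · w
  ·-cong p r i = *-cong p (r i)

  combination-cong : {a a′ : Vec k} (b : Vector (Vec n) k) → a ≋ a′ → combination a b ≋ combination a′ b
  combination-cong {k} b a≋a′ i = sum-cong-≋ {k} (λ j → *-congʳ (a≋a′ j))

  combination-congʳ : (a : Vec k) {b b′ : Vector (Vec n) k} → (∀ j → b j ≋ b′ j) → combination a b ≋ combination a b′
  combination-congʳ {k} a b≋b′ i = sum-cong-≋ {k} (λ j → *-congˡ (b≋b′ j i))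

  combination-+ : ∀ (a a′ : Vec k) (b : Vector (Vec n) k) →
                  combination (a +ᵥ a′) b ≋ combination a b +ᵥ combination a′ b
  combination-+ {k} a a′ b i = trans (sum-cong-≋ {k} (λ j → distribʳ _ _ _))
    (∑-distrib-+ (λ j → a j * b j i) (λ j → a′ j * b j i))

  combination-· : ∀ c (a : Vec k) (b : Vector (Vec n) k) → combination (c · a) b ≋ c · combination a b
  combination-· {k} c a b i = trans (sum-cong-≋ {k} (λ j → *-assoc _ _ _))
    (sym (*-distribˡ-sum c (λ j → a j * b j i)))

  combination-0 : ∀ {a : Vec k} (b : Vector (Vec n) k) → a ≋ 0ᵥ → combination a b ≋ 0ᵥ
  combination-0 {k} b a≋0 i = trans (sum-cong-≋ {k} (λ j → trans (*-congʳ (a≋0 j)) (zeroˡ _))) (sum-replicate-zero k)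

  infixl 6 _-ᵥ_
  _-ᵥ_ : Vec n → Vec n → Vec n
  v -ᵥ w = v +ᵥ (- 1#) · w

  x-x≈0 : ∀ {x y} → x ≈ y → x + - 1# * y ≈ 0#
  x-x≈0 {x} {y} x≈y = trans (+-cong x≈y (-1*x≈-x y)) (-‿inverseʳ y)

  x-y≈0⇒x≈y : ∀ {x y} → x + - 1# * y ≈ 0# → x ≈ y
  x-y≈0⇒x≈y {x} {y} eq = begin
    x                     ≈⟨ +-identityʳ x ⟨
    x + 0#                ≈⟨ +-congˡ (-‿inverseˡ y) ⟨
    x + (- y + y)         ≈⟨ +-assoc _ _ _ ⟨
    (x + - y) + y         ≈⟨ +-congʳ (+-congˡ (-1*x≈-x y)) ⟨
    (x + - 1# * y) + y    ≈⟨ +-congʳ eq ⟩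
    0# + y                ≈⟨ +-identityˡ y ⟩
    y                     ∎

  combination-injective : ∀ {b : Vector (Vec n) k} → LinearlyIndependent b →
                          ∀ {a a′} → combination a b ≋ combination a′ b → a ≋ a′
  combination-injective {b = b} independent {a} {a′} eq i =
    x-y≈0⇒x≈y (independent (a -ᵥ a′) (λ j → trans (combination-+ a (- 1# · a′) b j)
      (trans (+-congˡ (combination-· (- 1#) a′ b j)) (x-x≈0 (eq j)))) i)

  abstract
    -- Taking combinations is an injective self-map of the finite set `Vec n`, hence surjective.
    basis-spans : {b : Vector (Vec n) n} → LinearlyIndependent b → ∀ v → ∃[ a ] combination a b ≋ v
    basis-spans {n} {b} independent = injective⇒surjective (vectors-finite order n) (vectors-finite order n)
      (λ a → combination a b) (combination-cong b) (combination-injective independent)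

  independent-∷ : {b : Vector (Vec n) k} {v : Vec n} → LinearlyIndependent b →
                  ¬ (∃[ a ] v ≋ combination a b) → LinearlyIndependent (v ∷ b)
  independent-∷ {b = b} {v} independent v∉ a eq = λ { zero → a₀≈0 ; (suc i) → rest i }
    where
    a₀≈0 : a zero ≈ 0#
    a₀≈0 with a zero ≟ 0#
    ... | yes a₀≈0 = a₀≈0
    ... | no  a₀≉0 = ⊥-elim (v∉ ((- inv a₀≉0) · (a ∘ suc) , λ i → x-y≈0⇒x≈y (*-zero⇒ a₀≉0 (begin
      a zero * (v i + - 1# * combination (- inv a₀≉0 · (a ∘ suc)) b i)
        ≈⟨ *-congˡ (+-congˡ (*-congˡ (combination-· _ (a ∘ suc) b i))) ⟩
      a zero * (v i + - 1# * (- inv a₀≉0 * combination (a ∘ suc) b i))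
        ≈⟨ *-congˡ (+-congˡ (trans (sym (*-assoc _ _ _)) (*-congʳ (trans (-1*x≈-x _) (-‿involutive _))))) ⟩
      a zero * (v i + inv a₀≉0 * combination (a ∘ suc) b i)
        ≈⟨ distribˡ _ _ _ ⟩
      a zero * v i + a zero * (inv a₀≉0 * combination (a ∘ suc) b i)
        ≈⟨ +-congˡ (*-inv∙ a₀≉0 _) ⟩
      a zero * v i + combination (a ∘ suc) b i
        ≈⟨ eq i ⟩
      0# ∎))))
    rest : a ∘ suc ≋ 0ᵥ
    rest = independent (a ∘ suc) λ i → trans (sym (trans (+-congʳ (trans (*-congʳ a₀≈0) (zeroˡ _))) (+-identityˡ _))) (eq i)

  record IsLinear (g : Vec m → Vec n) : Set where
    field
      ≋-cong : ∀ {v w} → v ≋ w → g v ≋ g w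
      +-homo : ∀ v w → g (v +ᵥ w) ≋ g v +ᵥ g w
      ·-homo : ∀ c v → g (c · v) ≋ c · g v

    0-homo : ∀ {v} → v ≋ 0ᵥ → g v ≋ 0ᵥ
    0-homo {v} v≋0 i = trans (≋-cong (λ j → trans (v≋0 j) (sym (zeroˡ 0#))) i) (trans (·-homo 0# 0ᵥ i) (zeroˡ _))

    combination-homo : ∀ (a : Vec k) b → g (combination a b) ≋ combination a (g ∘ b)
    combination-homo {ℕ.zero}  a b = 0-homo (λ _ → refl)
    combination-homo {ℕ.suc k} a b i = trans (+-homo (a zero · b zero) (combination (a ∘ suc) (b ∘ suc)) i)
      (+-cong (·-homo (a zero) (b zero) i) (combination-homo (a ∘ suc) (b ∘ suc) i))

  ∘-isLinear : {g : Vec m → Vec n} {h : Vec l → Vec m} → IsLinear g → IsLinear h → IsLinear (g ∘ h)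
  ∘-isLinear G H = record
    { ≋-cong = G.≋-cong ∘ H.≋-cong
    ; +-homo = λ v w → ≋-trans (G.≋-cong (H.+-homo v w)) (G.+-homo _ _)
    ; ·-homo = λ c v → ≋-trans (G.≋-cong (H.·-homo c v)) (G.·-homo _ _)
    }
    where
    module G = IsLinear G
    module H = IsLinear H

  combination-isLinear : (b : Vector (Vec n) k) → IsLinear (λ a → combination a b)
  combination-isLinear b = record
    { ≋-cong = combination-cong b
    ; +-homo = λ a a′ → combination-+ a a′ b
    ; ·-homo = λ c a → combination-· c a b
    }

  *ᵥ≋combination : ∀ (M : Matrix n) v → M *ᵥ v ≋ combination v (λ j i → M i j)
  *ᵥ≋combination {n} M v i = sum-cong-≋ {n} (λ j → *-comm _ _)

  *ᵥ-isLinear : (M : Matrix n) → IsLinear (M *ᵥ_)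
  *ᵥ-isLinear M = record
    { ≋-cong = λ {v} {w} v≋w → via v w (C.≋-cong v≋w)
    ; +-homo = λ v w i → trans (*ᵥ≋combination M _ i) (trans (C.+-homo v w i)
        (sym (+-cong (*ᵥ≋combination M v i) (*ᵥ≋combination M w i))))
    ; ·-homo = λ c v i → trans (*ᵥ≋combination M _ i) (trans (C.·-homo c v i)
        (sym (*-congˡ (*ᵥ≋combination M v i))))
    }
    where
    module C = IsLinear (combination-isLinear (λ j i → M i j))
    via : ∀ v w → combination v (λ j i → M i j) ≋ combination w (λ j i → M i j) → M *ᵥ v ≋ M *ᵥ w
    via v w eq = ≋-trans (*ᵥ≋combination M v) (≋-trans eq (≋-sym (*ᵥ≋combination M w)))

  module Coordinates {b : Vector (Vec n) n} (independent : LinearlyIndependent b) where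

    coords : Vec n → Vec n
    coords v = proj₁ (basis-spans independent v)

    combination-coords : ∀ v → combination (coords v) b ≋ v
    combination-coords v = proj₂ (basis-spans independent v)

    coords-unique : ∀ {a v} → combination a b ≋ v → coords v ≋ a
    coords-unique eq = combination-injective independent (≋-trans (combination-coords _) (≋-sym eq))

    coords-isLinear : IsLinear coords
    coords-isLinear = record
      { ≋-cong = λ v≋w → coords-unique (≋-trans (combination-coords _) (≋-sym v≋w))
      ; +-homo = λ v w → coords-unique (≋-trans (combination-+ (coords v) (coords w) b)
                                         (+ᵥ-cong (combination-coords v) (combination-coords w)))
      ; ·-homo = λ c v → coords-unique (≋-trans (combination-· c (coords v) b) (·-cong refl (combination-coords v)))
      }

  unit : Vector (Vec n) n
  unit j i with i Fin.≟ j
  ... | yes _ = 1#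
  ... | no  _ = 0#

  combination-unit : (v : Vec n) → combination v unit ≋ v
  combination-unit v i = trans (sum-single +-commutativeMonoid i (λ j → v j * unit j i) others) diagonal
    where
    others : ∀ j → ¬ (j ≡ i) → v j * unit j i ≈ 0#
    others j j≢i with i Fin.≟ j
    ... | yes i≡j = ⊥-elim (j≢i (≡.sym i≡j))
    ... | no  _   = zeroʳ _
    diagonal : v i * unit i i ≈ v i
    diagonal with i Fin.≟ i
    ... | yes _  = *-identityʳ _
    ... | no i≢i = ⊥-elim (i≢i ≡.refl)

  matrixOf : (Vec n → Vec n) → Matrix n
  matrixOf g i j = g (unit j) i

  matrixOf-*ᵥ : {g : Vec n → Vec n} → IsLinear g → ∀ v → matrixOf g *ᵥ v ≋ g v
  matrixOf-*ᵥ {g = g} linear v = ≋-trans (*ᵥ≋combination (matrixOf g) v)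
    (≋-trans (≋-sym (combination-homo v unit)) (≋-cong (combination-unit v)))
    where
    open IsLinear linear

  -- Invertible maps are composed as functions; matrices appear only when a `GL` is taken from the
  -- definitions or handed back.
  record LinearIso (n : ℕ) : Set where
    field
      to from       : Vec n → Vec n
      to-isLinear   : IsLinear to
      from-isLinear : IsLinear from
      from∘to       : ∀ v → from (to v) ≋ v
      to∘from       : ∀ v → to (from v) ≋ v

  fromLinearIso : LinearIso n → GL n
  fromLinearIso I = record
    { matrix   = matrixOf to
    ; inverse  = matrixOf from
    ; inverseˡ = λ v → ≋-trans (matrixOf-*ᵥ from-isLinear _)
                   (≋-trans (≋-cong from-isLinear (matrixOf-*ᵥ to-isLinear v)) (from∘to v))
    ; inverseʳ = λ v → ≋-trans (matrixOf-*ᵥ to-isLinear _)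
                   (≋-trans (≋-cong to-isLinear (matrixOf-*ᵥ from-isLinear v)) (to∘from v))
    }
    where
    open LinearIso I
    open IsLinear

  toLinearIso : GL n → LinearIso n
  toLinearIso g = record
    { to = matrix *ᵥ_ ; from = inverse *ᵥ_
    ; to-isLinear = *ᵥ-isLinear matrix ; from-isLinear = *ᵥ-isLinear inverse
    ; from∘to = inverseˡ ; to∘from = inverseʳ
    }
    where
    open GL g

  infixr 9 _∘ₗ_
  _∘ₗ_ : LinearIso n → LinearIso n → LinearIso n
  I ∘ₗ J = record
    { to = I.to ∘ J.to ; from = J.from ∘ I.from
    ; to-isLinear = ∘-isLinear I.to-isLinear J.to-isLinear
    ; from-isLinear = ∘-isLinear J.from-isLinear I.from-isLinear
    ; from∘to = λ v → ≋-trans (IsLinear.≋-cong J.from-isLinear (I.from∘to _)) (J.from∘to v)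
    ; to∘from = λ v → ≋-trans (IsLinear.≋-cong I.to-isLinear (J.to∘from _)) (I.to∘from v)
    }
    where
    module I = LinearIso I
    module J = LinearIso J

  _⁻¹ₗ : LinearIso n → LinearIso n
  I ⁻¹ₗ = record
    { to = from ; from = to ; to-isLinear = from-isLinear ; from-isLinear = to-isLinear
    ; from∘to = to∘from ; to∘from = from∘to }
    where
    open LinearIso I

  identityₗ : LinearIso n
  identityₗ = record
    { to = λ v → v ; from = λ v → v ; to-isLinear = id-isLinear ; from-isLinear = id-isLinear
    ; from∘to = λ _ → ≋-refl ; to∘from = λ _ → ≋-refl }
    where
    id-isLinear : IsLinear {n} (λ v → v)
    id-isLinear = record { ≋-cong = λ p → p ; +-homo = λ _ _ → ≋-refl ; ·-homo = λ _ _ → ≋-refl }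

  basisIso : {b : Vector (Vec n) n} → LinearlyIndependent b → LinearIso n
  basisIso {b = b} independent = record
    { to = λ a → combination a b ; from = coords
    ; to-isLinear = combination-isLinear b ; from-isLinear = coords-isLinear
    ; from∘to = λ a → coords-unique ≋-refl
    ; to∘from = combination-coords
    }
    where
    open Coordinates independent

  module ∝ {n} = Setoid (∝-setoid n)

  ∝-resp : ∀ {u v w : Vec n} → u ∝ v → v ≋ w → u ∝ w
  ∝-resp (c , c≉0 , eq) v≋w = c , c≉0 , λ i → trans (eq i) (*-congˡ (v≋w i))

  ∝-refl : ∀ {v w : Vec n} → v ≋ w → v ∝ w
  ∝-refl v≋w = 1# , 1≉0 , λ i → trans (v≋w i) (sym (*-identityˡ _))

  linear-∝ : {g : Vec m → Vec n} → IsLinear g → ∀ {v w} → v ∝ w → g v ∝ g w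
  linear-∝ G {w = w} (c , c≉0 , eq) = c , c≉0 , ≋-trans (≋-cong eq) (·-homo c w)
    where
    open IsLinear G

  independent-pair : {v w : Vec n} → ¬ (v ≋ 0ᵥ) → ¬ (w ≋ 0ᵥ) → ¬ (v ∝ w) → LinearlyIndependent (v ∷ w ∷ [])
  independent-pair {n} {v} {w} v≉0 w≉0 v∝̸w = independent-∷ {b = w ∷ []} single λ { (a , eq) → off a eq (a zero ≟ 0#) }
    where
    single : LinearlyIndependent (w ∷ [])
    single a eq zero with a zero ≟ 0#
    ... | yes a≈0 = a≈0
    ... | no  a≉0 = ⊥-elim (w≉0 λ i → *-zero⇒ a≉0 (trans (sym (+-identityʳ _)) (eq i)))
    off : ∀ a → v ≋ combination a (w ∷ []) → Dec (a zero ≈ 0#) → _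
    off a eq (yes a≈0) = v≉0 (λ i → trans (eq i) (trans (+-identityʳ _) (trans (*-congʳ a≈0) (zeroˡ _))))
    off a eq (no a≉0) = v∝̸w (a zero , a≉0 , λ i → trans (eq i) (+-identityʳ _))

-- Traces and half-traces over a field of odd degree.

-- Over a field of odd degree over 𝔽₂ the equation u² + u = c can be solved up
-- to adding the absolute trace of c, which lies in 𝔽₂.
module HalfTrace (e : ℕ) (K : FiniteField (2 ℕ.^ (2 ℕ.* e ℕ.+ 1))) where
  open FiniteField K
  open FieldProperties K
  open Char2 K (order-2^n⇒1+1≈0 (2 ℕ.* e ℕ.+ 1) K)
  open Exp semiring
  open Solver using (solve; _:=_; _:+_; _:*_; con)
  open import Relation.Binary.Reasoning.Setoid setoid

  module _ (c : Carrier) where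

    -- This is c + c² + c⁴ + ... with `m` terms, in Horner form; `trace-suc` gives the additive
    -- recursion.
    trace : ℕ → Carrier
    trace ℕ.zero    = 0#
    trace (ℕ.suc m) = c + trace m * trace m

    trace-suc : ∀ m → trace (ℕ.suc m) ≈ trace m + c ^ (2 ℕ.^ m)
    trace-suc ℕ.zero    = begin
      c + 0# * 0#     ≈⟨ +-congˡ (zeroˡ 0#) ⟩
      c + 0#          ≈⟨ +-comm c 0# ⟩
      0# + c          ≈⟨ +-congˡ (*-identityʳ c) ⟨
      0# + c * 1#     ∎
    trace-suc (ℕ.suc m) = begin
      c + trace (ℕ.suc m) * trace (ℕ.suc m)
        ≈⟨ +-congˡ (*-cong (trace-suc m) (trace-suc m)) ⟩
      c + (trace m + c ^ (2 ℕ.^ m)) * (trace m + c ^ (2 ℕ.^ m))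
        ≈⟨ solve 3 (λ c t p → c :+ (t :+ p) :* (t :+ p) := (c :+ t :* t) :+ p :* p) refl c (trace m) _ ⟩
      trace (ℕ.suc m) + c ^ (2 ℕ.^ m) * c ^ (2 ℕ.^ m)
        ≈⟨ +-congˡ (^2^suc c m) ⟨
      trace (ℕ.suc m) + c ^ (2 ℕ.^ ℕ.suc m) ∎

    Tr : Carrier
    Tr = trace (2 ℕ.* e ℕ.+ 1)

    -- The two recursions for one further term give c + Tr² = Tr + c^q, and c^q = c.
    Tr∈𝔽₂ : Tr ≈ 0# ⊎ Tr ≈ 1#
    Tr∈𝔽₂ with zero-product {Tr} {Tr + 1#} (begin
        Tr * (Tr + 1#)      ≈⟨ solve 2 (λ c t → t :* (t :+ con true) := (c :+ t :* t) :+ (t :+ c)) refl c Tr ⟩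
        (c + Tr * Tr) + (Tr + c)  ≈⟨ +-congˡ (+-congˡ (^order c)) ⟨
        (c + Tr * Tr) + (Tr + c ^ (2 ℕ.^ (2 ℕ.* e ℕ.+ 1)))  ≈⟨ ≈⇒+≈0 (trace-suc (2 ℕ.* e ℕ.+ 1)) ⟩
        0#                  ∎)
    ... | inj₁ eq = inj₁ eq
    ... | inj₂ eq = inj₂ (+≈0⇒≈ eq)

    -- This is c + c⁴ + c¹⁶ + ... with k + 1 terms: every second term of the trace. Its square
    -- supplies the terms in between.
    halfTrace : ℕ → Carrier
    halfTrace ℕ.zero    = c
    halfTrace (ℕ.suc k) = c + (halfTrace k * halfTrace k) * (halfTrace k * halfTrace k)

    halfTrace-equation : ∀ k → halfTrace k * halfTrace k + halfTrace k ≈ trace (2 ℕ.+ 2 ℕ.* k)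
    halfTrace-equation ℕ.zero    = solve 1 (λ c → c :* c :+ c :=
      c :+ (c :+ con false :* con false) :* (c :+ con false :* con false)) refl c
    halfTrace-equation (ℕ.suc k) = begin
      halfTrace (ℕ.suc k) * halfTrace (ℕ.suc k) + halfTrace (ℕ.suc k)
        ≈⟨ solve 2 (λ c h → (c :+ (h :* h) :* (h :* h)) :* (c :+ (h :* h) :* (h :* h)) :+ (c :+ (h :* h) :* (h :* h))
             := c :+ (c :+ (h :* h :+ h) :* (h :* h :+ h)) :* (c :+ (h :* h :+ h) :* (h :* h :+ h))) refl c (halfTrace k) ⟩
      c + (c + (halfTrace k * halfTrace k + halfTrace k) * (halfTrace k * halfTrace k + halfTrace k))
        * (c + (halfTrace k * halfTrace k + halfTrace k) * (halfTrace k * halfTrace k + halfTrace k))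
        ≈⟨ +-congˡ (*-cong (+-congˡ (*-cong (halfTrace-equation k) (halfTrace-equation k)))
                           (+-congˡ (*-cong (halfTrace-equation k) (halfTrace-equation k)))) ⟩
      trace (2 ℕ.+ (2 ℕ.+ 2 ℕ.* k))
        ≡⟨ ≡.cong (λ j → trace (2 ℕ.+ j)) (ℕ.*-suc 2 k) ⟨
      trace (2 ℕ.+ 2 ℕ.* ℕ.suc k) ∎

    half : Carrier
    half = halfTrace e

    -- Pairing covers 2e + 2 terms, one more than the trace has in odd degree 2e + 1; the extra term
    -- is c^q = c.
    half-equation : half * half + half ≈ c + Tr
    half-equation = begin
      half * half + half       ≈⟨ halfTrace-equation e ⟩
      trace (2 ℕ.+ 2 ℕ.* e)    ≡⟨ ≡.cong (λ j → trace (ℕ.suc j)) (ℕ.+-comm 1 (2 ℕ.* e)) ⟩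
      trace (ℕ.suc (2 ℕ.* e ℕ.+ 1))  ≈⟨ trace-suc (2 ℕ.* e ℕ.+ 1) ⟩
      Tr + c ^ (2 ℕ.^ (2 ℕ.* e ℕ.+ 1)) ≈⟨ +-congˡ (^order c) ⟩
      Tr + c                   ≈⟨ +-comm Tr c ⟩
      c + Tr                   ∎

  -- Squaring has order dividing 2e + 1 on `K`, so its inverse is its 2e-th iterate.
  sqrt : Carrier → Carrier
  sqrt r = r ^ (2 ℕ.^ (2 ℕ.* e))

  sqrt-square : ∀ r → sqrt r * sqrt r ≈ r
  sqrt-square r = begin
    sqrt r * sqrt r                ≈⟨ ^2^suc r (2 ℕ.* e) ⟨
    r ^ (2 ℕ.^ ℕ.suc (2 ℕ.* e))    ≈⟨ ^-congʳ r (≡.cong (2 ℕ.^_) (ℕ.+-comm 1 (2 ℕ.* e))) ⟩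
    r ^ (2 ℕ.^ (2 ℕ.* e ℕ.+ 1))    ≈⟨ ^order r ⟩
    r                              ∎

-- The quadratic extension `L` of `K` and its endomorphisms.

-- Bijectivity is no field of the record: it follows from injectivity and finiteness.
record IsEndomorphism {q : ℕ} (L : FiniteField q) (τ : FiniteField.Carrier L → FiniteField.Carrier L) : Set where
  open FiniteField L
  field
    τ-cong : ∀ {x y} → x ≈ y → τ x ≈ τ y
    τ-+    : ∀ x y → τ (x + y) ≈ τ x + τ y
    τ-*    : ∀ x y → τ (x * y) ≈ τ x * τ y
    τ-1    : τ 1# ≈ 1#

module QuadraticExtension (e : ℕ) (K : FiniteField (2 ℕ.^ (2 ℕ.* e ℕ.+ 1)))
  (L : FiniteField ((2 ℕ.^ (2 ℕ.* e ℕ.+ 1)) ℕ.^ 2)) (ι : FieldEmbedding K L) where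

  private
    module K where
      open FiniteField K public
      open FieldProperties K public
      open Char2 K (order-2^n⇒1+1≈0 (2 ℕ.* e ℕ.+ 1) K) public
      open HalfTrace e K public
      open Exp semiring public using (_^_)

  open FieldEmbedding ι public
  open RingMorphisms (FiniteField.rawRing K) (FiniteField.rawRing L) using (module IsRingMonomorphism)
  open IsRingMonomorphism isRingMonomorphism public
    using (⟦⟧-cong) renaming (+-homo to ⟦⟧-+; *-homo to ⟦⟧-*; 0#-homo to ⟦⟧-0; 1#-homo to ⟦⟧-1; injective to ⟦⟧-injective)
  open FiniteField L hiding (zero)
  open FieldProperties L
  open Exp semiring using (_^_; ^-congʳ; ^-congˡ)

  L-1+1≈0 : Characteristic2 L
  L-1+1≈0 = trans (+-cong (sym ⟦⟧-1) (sym ⟦⟧-1)) (trans (sym (⟦⟧-+ _ _)) (trans (⟦⟧-cong (order-2^n⇒1+1≈0 (2 ℕ.* e ℕ.+ 1) K)) ⟦⟧-0))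

  open Char2 L L-1+1≈0
  open Solver using (solve; _:=_; _:+_; _:*_; con)
  open import Relation.Binary.Reasoning.Setoid setoid

  ⟦⟧-^ : ∀ x n → ⟦ x K.^ n ⟧ ≈ ⟦ x ⟧ ^ n
  ⟦⟧-^ x ℕ.zero    = ⟦⟧-1
  ⟦⟧-^ x (ℕ.suc n) = trans (⟦⟧-* _ _) (*-congˡ (⟦⟧-^ x n))

  private
    q : ℕ
    q = 2 ℕ.^ (2 ℕ.* e ℕ.+ 1)

    1<q : 1 ℕ.< q
    1<q = ℕ.^-monoʳ-< 2 ℕ.≤-refl (ℕ.≤-trans ℕ.≤-refl (ℕ.m≤n+m 1 (2 ℕ.* e)))

    q<q² : q ℕ.< q ℕ.^ 2
    q<q² = ≡.subst (q ℕ.<_) (≡.cong (q ℕ.*_) (≡.sym (ℕ.*-identityʳ q)))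
      (ℕ.m<m*n q q {{ℕ.m^n≢0 2 (2 ℕ.* e ℕ.+ 1)}} 1<q)

    InK : Carrier → Set
    InK z = ∃[ k ] ⟦ k ⟧ ≈ z

    InK? : ∀ z → Dec (InK z)
    InK? z = search K.order (λ k≈l k≈z → trans (⟦⟧-cong (K.sym k≈l)) k≈z) (λ k → ⟦ k ⟧ ≟ z)

  -- Otherwise the q² elements of `L` would inject into the q elements of `K`.
  ∃∉K : ∃[ ε ] ¬ InK ε
  ∃∉K with search order (λ { z≈w z∉K (k , k≈w) → z∉K (k , trans k≈w (sym z≈w)) }) (λ z → ¬? (InK? z))
  ... | yes found = found
  ... | no ¬found = contradiction
    (injective⇒≤ {A = setoid} {B = K.setoid} order K.order (λ z → proj₁ (all∈K z))
      (λ {z} {w} k≈l → trans (sym (proj₂ (all∈K z))) (trans (⟦⟧-cong k≈l) (proj₂ (all∈K w)))))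
    (ℕ.<⇒≱ q<q²)
    where
    all∈K : ∀ z → InK z
    all∈K z with InK? z
    ... | yes z∈K = z∈K
    ... | no  z∉K = ⊥-elim (¬found (z , z∉K))

  module _ {ε : Carrier} (ε∉K : ¬ InK ε) where

    ∉K-coefficient : ∀ {a b} → ⟦ a ⟧ + ⟦ b ⟧ * ε ≈ 0# → b K.≈ K.0#
    ∉K-coefficient {a} {b} eq with b K.≟ K.0#
    ... | yes b≈0 = b≈0
    ... | no  b≉0 = ⊥-elim (ε∉K (K.inv b≉0 K.* a , (begin
      ⟦ K.inv b≉0 K.* a ⟧             ≈⟨ ⟦⟧-* _ _ ⟩
      ⟦ K.inv b≉0 ⟧ * ⟦ a ⟧           ≈⟨ *-congˡ (+≈0⇒≈ eq) ⟩
      ⟦ K.inv b≉0 ⟧ * (⟦ b ⟧ * ε)     ≈⟨ *-assoc _ _ _ ⟨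
      (⟦ K.inv b≉0 ⟧ * ⟦ b ⟧) * ε     ≈⟨ *-congʳ (trans (sym (⟦⟧-* _ _)) (trans (⟦⟧-cong (K.inv-* b≉0)) ⟦⟧-1)) ⟩
      1# * ε                          ≈⟨ *-identityˡ ε ⟩
      ε                               ∎)))

    ∉K-independent : ∀ {a b c d} → ⟦ a ⟧ + ⟦ b ⟧ * ε ≈ ⟦ c ⟧ + ⟦ d ⟧ * ε → a K.≈ c × b K.≈ d
    ∉K-independent {a} {b} {c} {d} eq = a≈c , b≈d
      where
      b≈d : b K.≈ d
      b≈d = K.+≈0⇒≈ (∉K-coefficient {a K.+ c} (begin
        ⟦ a K.+ c ⟧ + ⟦ b K.+ d ⟧ * ε        ≈⟨ +-cong (⟦⟧-+ a c) (*-congʳ (⟦⟧-+ b d)) ⟩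
        (⟦ a ⟧ + ⟦ c ⟧) + (⟦ b ⟧ + ⟦ d ⟧) * ε
          ≈⟨ solve 5 (λ a b c d ε → (a :+ c) :+ (b :+ d) :* ε := (a :+ b :* ε) :+ (c :+ d :* ε)) refl ⟦ a ⟧ ⟦ b ⟧ ⟦ c ⟧ ⟦ d ⟧ ε ⟩
        (⟦ a ⟧ + ⟦ b ⟧ * ε) + (⟦ c ⟧ + ⟦ d ⟧ * ε)  ≈⟨ ≈⇒+≈0 eq ⟩
        0#                                    ∎))
      a≈c : a K.≈ c
      a≈c = ⟦⟧-injective (by₂ 1# ε
        (solve 5 (λ a b c d ε → a :+ c := con true :* ((a :+ b :* ε) :+ (c :+ d :* ε)) :+ ε :* (b :+ d)) refl ⟦ a ⟧ ⟦ b ⟧ ⟦ c ⟧ ⟦ d ⟧ ε)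
        eq (⟦⟧-cong b≈d))

    -- By counting: K² and L have the same number of elements.
    ∉K-spans : ∀ z → ∃[ a ] ∃[ b ] ⟦ a ⟧ + ⟦ b ⟧ * ε ≈ z
    ∉K-spans z = proj₁ preimage zero , proj₁ preimage (suc zero) , proj₂ preimage
      where
      injective : ∀ {v w : Vector K.Carrier 2} →
                  ⟦ v zero ⟧ + ⟦ v (suc zero) ⟧ * ε ≈ ⟦ w zero ⟧ + ⟦ w (suc zero) ⟧ * ε → ∀ i → v i K.≈ w i
      injective eq zero       = proj₁ (∉K-independent eq)
      injective eq (suc zero) = proj₂ (∉K-independent eq)
      preimage : ∃[ v ] ⟦ v zero ⟧ + ⟦ v (suc zero) ⟧ * ε ≈ z
      preimage = injective⇒surjective {A = VecEquality.≋-setoid K.setoid 2} {B = setoid}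
        (vectors-finite K.order 2) order
        (λ v → ⟦ v zero ⟧ + ⟦ v (suc zero) ⟧ * ε)
        (λ v≋w → +-cong (⟦⟧-cong (v≋w zero)) (*-congʳ (⟦⟧-cong (v≋w (suc zero)))))
        injective z

  private
    ∉K-resp : ∀ {y z} → ¬ InK y → (∀ {k} → ⟦ k ⟧ ≈ z → InK y) → ¬ InK z
    ∉K-resp y∉K f (k , k≈z) = y∉K (f k≈z)

  -- Completing the square in the equation of an element outside K gives y² + y ∈ K,
  -- and y + u then satisfies ω² + ω = 1 for the half-trace u of y² + y.
  ∉K⇒∃ω : ∀ {ε r p} → ¬ InK ε → ⟦ r ⟧ + ⟦ p ⟧ * ε ≈ ε * ε → Dec (p K.≈ K.0#) →
          ∃[ ω ] ω * ω ≈ ω + 1# × ¬ InK ω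
  -- Without a linear term ε² lies in `K`. Square roots exist in `K` and are unique in
  -- characteristic 2, so ε would lie in `K`.
  ∉K⇒∃ω {ε} {r} {p} ε∉K ε²≈ (yes p≈0) = ⊥-elim (ε∉K (K.sqrt r , square-injective (begin
    ⟦ K.sqrt r ⟧ * ⟦ K.sqrt r ⟧   ≈⟨ ⟦⟧-* _ _ ⟨
    ⟦ K.sqrt r K.* K.sqrt r ⟧     ≈⟨ ⟦⟧-cong (K.sqrt-square r) ⟩
    ⟦ r ⟧                         ≈⟨ +-identityʳ _ ⟨
    ⟦ r ⟧ + 0#                    ≈⟨ +-congˡ (zeroˡ ε) ⟨
    ⟦ r ⟧ + 0# * ε                ≈⟨ +-congˡ (*-congʳ (trans (⟦⟧-cong p≈0) ⟦⟧-0)) ⟨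
    ⟦ r ⟧ + ⟦ p ⟧ * ε             ≈⟨ ε²≈ ⟩
    ε * ε                         ∎)))
  ∉K⇒∃ω {ε} {r} {p} ε∉K ε²≈ (no p≉0) = result (K.Tr∈𝔽₂ c)
    where
    p⁻¹ : K.Carrier
    p⁻¹ = K.inv p≉0
    pp⁻¹≈1 : ⟦ p ⟧ * ⟦ p⁻¹ ⟧ ≈ 1#
    pp⁻¹≈1 = trans (sym (⟦⟧-* _ _)) (trans (⟦⟧-cong (K.*-inv p≉0)) ⟦⟧-1)
    y : Carrier
    y = ⟦ p⁻¹ ⟧ * ε
    c : K.Carrier
    c = r K.* (p⁻¹ K.* p⁻¹)
    ⟦c⟧ : ⟦ c ⟧ ≈ ⟦ r ⟧ * (⟦ p⁻¹ ⟧ * ⟦ p⁻¹ ⟧)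
    ⟦c⟧ = trans (⟦⟧-* _ _) (*-congˡ (⟦⟧-* _ _))
    y-equation : y * y + y ≈ ⟦ c ⟧
    y-equation = by₃ (⟦ p⁻¹ ⟧ * ⟦ p⁻¹ ⟧) (⟦ p⁻¹ ⟧ * ε) 1#
      (solve 5 (λ i ε r p c → ((i :* ε) :* (i :* ε) :+ i :* ε) :+ c :=
         (i :* i) :* ((r :+ p :* ε) :+ ε :* ε) :+ (i :* ε) :* (p :* i :+ con true) :+ con true :* (c :+ r :* (i :* i)))
        refl ⟦ p⁻¹ ⟧ ε ⟦ r ⟧ ⟦ p ⟧ ⟦ c ⟧)
      ε²≈ pp⁻¹≈1 ⟦c⟧
    y∉K : ¬ InK y
    y∉K = ∉K-resp ε∉K λ {k} k≈y → p K.* k , (begin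
      ⟦ p K.* k ⟧            ≈⟨ ⟦⟧-* _ _ ⟩
      ⟦ p ⟧ * ⟦ k ⟧          ≈⟨ *-congˡ k≈y ⟩
      ⟦ p ⟧ * (⟦ p⁻¹ ⟧ * ε)  ≈⟨ *-assoc _ _ _ ⟨
      (⟦ p ⟧ * ⟦ p⁻¹ ⟧) * ε  ≈⟨ *-congʳ pp⁻¹≈1 ⟩
      1# * ε                 ≈⟨ *-identityˡ ε ⟩
      ε                      ∎)
    u t ω : Carrier
    u = ⟦ K.half c ⟧
    t = ⟦ K.Tr c ⟧
    ω = y + u
    ω∉K : ¬ InK ω
    ω∉K = ∉K-resp y∉K λ {k} k≈ω → k K.+ K.half c ,
      trans (⟦⟧-+ _ _) (by₁ 1# (solve 3 (λ k u y → (k :+ u) :+ y := con true :* (k :+ (y :+ u))) refl ⟦ k ⟧ u y) k≈ω)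
    ω-equation : ω * ω + ω ≈ t
    ω-equation = by₂ 1# 1#
      (solve 4 (λ y u c t → ((y :+ u) :* (y :+ u) :+ (y :+ u)) :+ t :=
         con true :* ((y :* y :+ y) :+ c) :+ con true :* ((u :* u :+ u) :+ (c :+ t))) refl y u ⟦ c ⟧ t)
      y-equation
      (trans (+-congʳ (sym (⟦⟧-* _ _))) (trans (sym (⟦⟧-+ _ _)) (trans (⟦⟧-cong (K.half-equation c)) (⟦⟧-+ _ _))))
    result : K.Tr c K.≈ K.0# ⊎ K.Tr c K.≈ K.1# → ∃[ ω ] ω * ω ≈ ω + 1# × ¬ InK ω
    -- With trace 0 the element ω would be a root of w (w + 1), hence 0 or 1.
    result (inj₁ t≈0) = ⊥-elim (absurd (zero-product (trans
        (solve 1 (λ w → w :* (w :+ con true) := w :* w :+ w) refl ω)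
        (trans ω-equation (trans (⟦⟧-cong t≈0) ⟦⟧-0)))))
      where
      absurd : ¬ (ω ≈ 0# ⊎ ω + 1# ≈ 0#)
      absurd (inj₁ ω≈0)   = ω∉K (K.0# , trans ⟦⟧-0 (sym ω≈0))
      absurd (inj₂ ω+1≈0) = ω∉K (K.1# , trans ⟦⟧-1 (sym (+≈0⇒≈ ω+1≈0)))
    result (inj₂ t≈1) = ω ,
      by₁ 1# (solve 1 (λ w → (w :* w) :+ (w :+ con true) := con true :* ((w :* w :+ w) :+ con true)) refl ω)
        (trans ω-equation (trans (⟦⟧-cong t≈1) ⟦⟧-1)) ,
      ω∉K

  ∃ω : ∃[ ω ] ω * ω ≈ ω + 1# × ¬ InK ω
  ∃ω = ∉K⇒∃ω (proj₂ ∃∉K) (proj₂ (proj₂ (∉K-spans (proj₂ ∃∉K) _))) (_ K.≟ K.0#)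

  abstract
    ω : Carrier
    ω = proj₁ ∃ω

    ω²≈ω+1 : ω * ω ≈ ω + 1#
    ω²≈ω+1 = proj₁ (proj₂ ∃ω)

    ω∉K : ¬ InK ω
    ω∉K = proj₂ (proj₂ ∃ω)

    Re Im : Carrier → K.Carrier
    Re z = proj₁ (∉K-spans ω∉K z)
    Im z = proj₁ (proj₂ (∉K-spans ω∉K z))

    Re+Imω : ∀ z → ⟦ Re z ⟧ + ⟦ Im z ⟧ * ω ≈ z
    Re+Imω z = proj₂ (proj₂ (∉K-spans ω∉K z))

  components : ∀ {z a b} → z ≈ ⟦ a ⟧ + ⟦ b ⟧ * ω → Re z K.≈ a × Im z K.≈ b
  components eq = ∉K-independent ω∉K (trans (Re+Imω _) eq)

  Re-cong : ∀ {z w} → z ≈ w → Re z K.≈ Re w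
  Re-cong z≈w = proj₁ (components (trans z≈w (sym (Re+Imω _))))

  Im-cong : ∀ {z w} → z ≈ w → Im z K.≈ Im w
  Im-cong z≈w = proj₂ (components (trans z≈w (sym (Re+Imω _))))

  Re-Im-+ : ∀ z w → Re (z + w) K.≈ Re z K.+ Re w × Im (z + w) K.≈ Im z K.+ Im w
  Re-Im-+ z w = components (begin
    z + w  ≈⟨ +-cong (Re+Imω z) (Re+Imω w) ⟨
    (⟦ Re z ⟧ + ⟦ Im z ⟧ * ω) + (⟦ Re w ⟧ + ⟦ Im w ⟧ * ω)
      ≈⟨ solve 5 (λ a b c d ω → (a :+ b :* ω) :+ (c :+ d :* ω) := (a :+ c) :+ (b :+ d) :* ω) refl ⟦ Re z ⟧ ⟦ Im z ⟧ ⟦ Re w ⟧ ⟦ Im w ⟧ ω ⟩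
    (⟦ Re z ⟧ + ⟦ Re w ⟧) + (⟦ Im z ⟧ + ⟦ Im w ⟧) * ω
      ≈⟨ +-cong (⟦⟧-+ _ _) (*-congʳ (⟦⟧-+ _ _)) ⟨
    ⟦ Re z K.+ Re w ⟧ + ⟦ Im z K.+ Im w ⟧ * ω  ∎)

  Re-+ : ∀ z w → Re (z + w) K.≈ Re z K.+ Re w
  Re-+ z w = proj₁ (Re-Im-+ z w)

  Im-+ : ∀ z w → Im (z + w) K.≈ Im z K.+ Im w
  Im-+ z w = proj₂ (Re-Im-+ z w)

  Re-Im-* : ∀ z w → Re (z * w) K.≈ Re z K.* Re w K.+ Im z K.* Im w
                  × Im (z * w) K.≈ Re z K.* Im w K.+ Im z K.* Re w K.+ Im z K.* Im w
  Re-Im-* z w = components (begin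
    z * w  ≈⟨ *-cong (Re+Imω z) (Re+Imω w) ⟨
    (⟦ Re z ⟧ + ⟦ Im z ⟧ * ω) * (⟦ Re w ⟧ + ⟦ Im w ⟧ * ω)
      ≈⟨ by₁ (⟦ Im z ⟧ * ⟦ Im w ⟧) (solve 5 (λ a b c d ω →
          (a :+ b :* ω) :* (c :+ d :* ω) :+ ((a :* c :+ b :* d) :+ (a :* d :+ b :* c :+ b :* d) :* ω)
            := (b :* d) :* (ω :* ω :+ (ω :+ con true))) refl ⟦ Re z ⟧ ⟦ Im z ⟧ ⟦ Re w ⟧ ⟦ Im w ⟧ ω) ω²≈ω+1 ⟩
    (⟦ Re z ⟧ * ⟦ Re w ⟧ + ⟦ Im z ⟧ * ⟦ Im w ⟧) + (⟦ Re z ⟧ * ⟦ Im w ⟧ + ⟦ Im z ⟧ * ⟦ Re w ⟧ + ⟦ Im z ⟧ * ⟦ Im w ⟧) * ω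
      ≈⟨ +-cong (trans (⟦⟧-+ _ _) (+-cong (⟦⟧-* _ _) (⟦⟧-* _ _)))
          (*-congʳ (trans (⟦⟧-+ _ _) (+-cong (trans (⟦⟧-+ _ _) (+-cong (⟦⟧-* _ _) (⟦⟧-* _ _))) (⟦⟧-* _ _)))) ⟨
    ⟦ Re z K.* Re w K.+ Im z K.* Im w ⟧ + ⟦ Re z K.* Im w K.+ Im z K.* Re w K.+ Im z K.* Im w ⟧ * ω  ∎)

  Re-Im-⟦⟧ : ∀ k → Re ⟦ k ⟧ K.≈ k × Im ⟦ k ⟧ K.≈ K.0#
  Re-Im-⟦⟧ k = components (sym (trans (+-congˡ (trans (*-congʳ ⟦⟧-0) (zeroˡ ω))) (+-identityʳ _)))

  Re-Im-ω : Re ω K.≈ K.0# × Im ω K.≈ K.1#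
  Re-Im-ω = components (sym (trans (+-cong ⟦⟧-0 (trans (*-congʳ ⟦⟧-1) (*-identityˡ ω))) (+-identityˡ _)))

  Re-⟦⟧ : ∀ k → Re ⟦ k ⟧ K.≈ k
  Re-⟦⟧ k = proj₁ (Re-Im-⟦⟧ k)

  Im-⟦⟧ : ∀ k → Im ⟦ k ⟧ K.≈ K.0#
  Im-⟦⟧ k = proj₂ (Re-Im-⟦⟧ k)

  Im-· : ∀ k z → Im (⟦ k ⟧ * z) K.≈ k K.* Im z
  Im-· k z = K.trans (proj₂ (Re-Im-* ⟦ k ⟧ z))
    (K.trans (K.+-cong (K.+-cong (K.*-congʳ (Re-⟦⟧ k)) (K.trans (K.*-congʳ (Im-⟦⟧ k)) (K.zeroˡ _)))
                       (K.trans (K.*-congʳ (Im-⟦⟧ k)) (K.zeroˡ _)))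
      (K.trans (K.+-identityʳ _) (K.+-identityʳ _)))

  record IsFunctional (h : Carrier → K.Carrier) : Set where
    field
      h-cong : ∀ {z w} → z ≈ w → h z K.≈ h w
      h-+    : ∀ z w → h (z + w) K.≈ h z K.+ h w
      h-·    : ∀ k z → h (⟦ k ⟧ * z) K.≈ k K.* h z

    expand : ∀ z → h z K.≈ Re z K.* h 1# K.+ Im z K.* h ω
    expand z = K.trans (h-cong (sym (trans (+-congʳ (*-identityʳ _)) (Re+Imω z)))) (K.trans (h-+ _ _) (K.+-cong (h-· _ _) (h-· _ _)))

  -- The form (d , z) ↦ Im (d z) is nondegenerate. The element `d` is read off from Im d = h 1 and
  -- Im (d ω) = Re d + Im d = h ω.
  functional≈Im : ∀ {h} → IsFunctional h → ∃[ d ] ∀ z → h z K.≈ Im (d * z)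
  functional≈Im {h} functional = d , λ z → K.trans (expand z) (K.sym (K.trans (proj₂ (Re-Im-* d z))
      (K.trans (K.+-cong (K.+-cong (K.*-congʳ Re-d) (K.*-congʳ Im-d)) (K.*-congʳ Im-d))
        (K.Solver.solve 4 (λ p r x y → (r K.Solver.:+ p) K.Solver.:* y K.Solver.:+ p K.Solver.:* x K.Solver.:+ p K.Solver.:* y
           K.Solver.:= x K.Solver.:* p K.Solver.:+ y K.Solver.:* r) K.refl (h 1#) (h ω) (Re z) (Im z)))))
    where
    open IsFunctional functional
    d : Carrier
    d = ⟦ h ω K.+ h 1# ⟧ + ⟦ h 1# ⟧ * ω
    Re-d : Re d K.≈ h ω K.+ h 1#
    Re-d = proj₁ (components refl)
    Im-d : Im d K.≈ h 1#
    Im-d = proj₂ (components refl)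

  ω^2^2k : ∀ k → ω ^ (2 ℕ.^ (2 ℕ.* k)) ≈ ω
  ω^2^2k ℕ.zero    = *-identityʳ ω
  ω^2^2k (ℕ.suc k) = begin
    ω ^ (2 ℕ.^ (2 ℕ.* ℕ.suc k))            ≈⟨ ^-congʳ ω (≡.cong (2 ℕ.^_) (ℕ.*-suc 2 k)) ⟩
    ω ^ (2 ℕ.^ (2 ℕ.+ 2 ℕ.* k))            ≈⟨ ^2^-∘ ω 2 (2 ℕ.* k) ⟨
    (ω ^ 4) ^ (2 ℕ.^ (2 ℕ.* k))            ≈⟨ ^-congˡ (2 ℕ.^ (2 ℕ.* k)) ω⁴≈ω ⟩
    ω ^ (2 ℕ.^ (2 ℕ.* k))                  ≈⟨ ω^2^2k k ⟩
    ω                                      ∎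
    where
    ω⁴≈ω : ω ^ 4 ≈ ω
    ω⁴≈ω = by₁ (ω * ω + ω) (solve 1 (λ w → w :* (w :* (w :* (w :* con true))) :+ w :=
      (w :* w :+ w) :* (w :* w :+ (w :+ con true))) refl ω) ω²≈ω+1

  -- Since ω⁴ = ω, an even number of squarings fixes ω; the `q`-th power consists of an odd number
  -- and acts like one squaring.
  ω^q : ω ^ q ≈ ω + 1#
  ω^q = begin
    ω ^ (2 ℕ.^ (2 ℕ.* e ℕ.+ 1))        ≈⟨ ^2^-∘ ω (2 ℕ.* e) 1 ⟨
    (ω ^ (2 ℕ.^ (2 ℕ.* e))) ^ 2        ≈⟨ ^-congˡ 2 (ω^2^2k e) ⟩
    ω * (ω * 1#)                       ≈⟨ *-congˡ (*-identityʳ ω) ⟩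
    ω * ω                              ≈⟨ ω²≈ω+1 ⟩
    ω + 1#                             ∎

  -- The `q`-th power fixes a and b in a + b ω and sends ω to ω + 1, so it adds b. This identifies
  -- `K` as the fixed field.
  ^q-fixed⇒Im≈0 : ∀ {z} → z ^ q ≈ z → Im z K.≈ K.0#
  ^q-fixed⇒Im≈0 {z} fixed = ⟦⟧-injective (trans (by₂ 1# ⟦ Im z ⟧
      (solve 4 (λ a b w p → b :+ con false := con true :* ((a :+ b :* p) :+ (a :+ b :* w)) :+ b :* (p :+ (w :+ con true))) refl ⟦ Re z ⟧ ⟦ Im z ⟧ ω (ω ^ q))
      (begin
        ⟦ Re z ⟧ + ⟦ Im z ⟧ * ω ^ q       ≈⟨ +-cong (^q-⟦⟧ (Re z)) (*-congʳ (^q-⟦⟧ (Im z))) ⟨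
        ⟦ Re z ⟧ ^ q + ⟦ Im z ⟧ ^ q * ω ^ q  ≈⟨ +-congˡ (^-distrib-* q _ _) ⟨
        ⟦ Re z ⟧ ^ q + (⟦ Im z ⟧ * ω) ^ q ≈⟨ ^2^-distrib-+ (2 ℕ.* e ℕ.+ 1) _ _ ⟨
        (⟦ Re z ⟧ + ⟦ Im z ⟧ * ω) ^ q     ≈⟨ ^-congˡ q (Re+Imω z) ⟩
        z ^ q                             ≈⟨ fixed ⟩
        z                                 ≈⟨ Re+Imω z ⟨
        ⟦ Re z ⟧ + ⟦ Im z ⟧ * ω           ∎)
      ω^q) (sym ⟦⟧-0))
    where
    ^q-⟦⟧ : ∀ k → ⟦ k ⟧ ^ q ≈ ⟦ k ⟧
    ^q-⟦⟧ k = trans (sym (⟦⟧-^ k q)) (⟦⟧-cong (K.^order k))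

  module Endomorphism {τ : Carrier → Carrier} (isEndomorphism : IsEndomorphism L τ) where
    open IsEndomorphism isEndomorphism

    τ-0 : τ 0# ≈ 0#
    τ-0 = by₁ 1# (solve 1 (λ t → t :+ con false := con true :* (t :+ (t :+ t))) refl (τ 0#))
      (trans (τ-cong (sym (+-identityʳ 0#))) (τ-+ 0# 0#))

    τ-≉0 : ∀ {x} → x ≉ 0# → τ x ≉ 0#
    τ-≉0 {x} x≉0 τx≈0 = 1≉0 (begin
      1#                    ≈⟨ τ-1 ⟨
      τ 1#                  ≈⟨ τ-cong (*-inv x≉0) ⟨
      τ (x * inv x≉0)       ≈⟨ τ-* _ _ ⟩
      τ x * τ (inv x≉0)     ≈⟨ *-congʳ τx≈0 ⟩
      0# * τ (inv x≉0)      ≈⟨ zeroˡ _ ⟩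
      0#                    ∎)

    τ-injective : ∀ {x y} → τ x ≈ τ y → x ≈ y
    τ-injective {x} {y} eq = cases (x + y ≟ 0#)
      where
      cases : Dec (x + y ≈ 0#) → x ≈ y
      cases (yes x+y≈0) = +≈0⇒≈ x+y≈0
      cases (no  x+y≉0) = ⊥-elim (τ-≉0 x+y≉0 (trans (τ-+ x y) (≈⇒+≈0 eq)))

    τ-surjective : ∀ y → ∃[ x ] τ x ≈ y
    τ-surjective = injective⇒surjective {A = setoid} {B = setoid} order order τ τ-cong τ-injective

    τ-^ : ∀ x n → τ (x ^ n) ≈ τ x ^ n
    τ-^ x ℕ.zero    = τ-1
    τ-^ x (ℕ.suc n) = trans (τ-* _ _) (*-congˡ (τ-^ x n))

    κ : K.Carrier → K.Carrier
    κ k = Re (τ ⟦ k ⟧)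

    -- Elements of `K` satisfy x^q = x, an equation that endomorphisms preserve and whose solutions
    -- in `L` lie in `K`. So `κ` is the restriction of τ to `K`.
    τ⟦⟧ : ∀ k → τ ⟦ k ⟧ ≈ ⟦ κ k ⟧
    τ⟦⟧ k = begin
      τ ⟦ k ⟧                                 ≈⟨ Re+Imω _ ⟨
      ⟦ κ k ⟧ + ⟦ Im (τ ⟦ k ⟧) ⟧ * ω          ≈⟨ +-congˡ (*-congʳ (trans (⟦⟧-cong (^q-fixed⇒Im≈0 fixed)) ⟦⟧-0)) ⟩
      ⟦ κ k ⟧ + 0# * ω                        ≈⟨ +-congˡ (zeroˡ ω) ⟩
      ⟦ κ k ⟧ + 0#                            ≈⟨ +-identityʳ _ ⟩
      ⟦ κ k ⟧                                 ∎
      where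
      fixed : τ ⟦ k ⟧ ^ q ≈ τ ⟦ k ⟧
      fixed = trans (sym (τ-^ ⟦ k ⟧ q)) (τ-cong (trans (sym (⟦⟧-^ k q)) (⟦⟧-cong (K.^order k))))

    κ-cong : ∀ {k l} → k K.≈ l → κ k K.≈ κ l
    κ-cong k≈l = Re-cong (τ-cong (⟦⟧-cong k≈l))

    κ-+ : ∀ k l → κ (k K.+ l) K.≈ κ k K.+ κ l
    κ-+ k l = ⟦⟧-injective (trans (sym (τ⟦⟧ _)) (trans (τ-cong (⟦⟧-+ k l)) (trans (τ-+ _ _)
      (trans (+-cong (τ⟦⟧ k) (τ⟦⟧ l)) (sym (⟦⟧-+ _ _))))))

    κ-* : ∀ k l → κ (k K.* l) K.≈ κ k K.* κ l
    κ-* k l = ⟦⟧-injective (trans (sym (τ⟦⟧ _)) (trans (τ-cong (⟦⟧-* k l)) (trans (τ-* _ _)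
      (trans (*-cong (τ⟦⟧ k) (τ⟦⟧ l)) (sym (⟦⟧-* _ _))))))

    κ-1 : κ K.1# K.≈ K.1#
    κ-1 = ⟦⟧-injective (trans (sym (τ⟦⟧ _)) (trans (τ-cong ⟦⟧-1) (trans τ-1 (sym ⟦⟧-1))))

    κ-injective : ∀ {k l} → κ k K.≈ κ l → k K.≈ l
    κ-injective eq = ⟦⟧-injective (τ-injective (trans (τ⟦⟧ _) (trans (⟦⟧-cong eq) (sym (τ⟦⟧ _)))))

    κ-^ : ∀ x n → κ (x K.^ n) K.≈ κ x K.^ n
    κ-^ x ℕ.zero    = κ-1
    κ-^ x (ℕ.suc n) = K.trans (κ-* _ _) (K.*-congˡ (κ-^ x n))

    -- The equation of ω has coefficients in 𝔽₂, so τ ω is again one of its two roots.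
    τω : τ ω ≈ ω ⊎ τ ω ≈ ω + 1#
    τω = cases (zero-product (by₂ 1# 1#
        (solve 2 (λ t w → (t :+ w) :* (t :+ (w :+ con true)) :+ con false :=
           con true :* (t :* t :+ (t :+ con true)) :+ con true :* (w :* w :+ (w :+ con true))) refl (τ ω) ω)
        (trans (sym (τ-* ω ω)) (trans (τ-cong ω²≈ω+1) (trans (τ-+ _ _) (+-congˡ τ-1)))) ω²≈ω+1))
      where
      cases : τ ω + ω ≈ 0# ⊎ τ ω + (ω + 1#) ≈ 0# → τ ω ≈ ω ⊎ τ ω ≈ ω + 1#
      cases (inj₁ eq) = inj₁ (+≈0⇒≈ eq)
      cases (inj₂ eq) = inj₂ (+≈0⇒≈ eq)

    τ-expand : ∀ z → τ z ≈ ⟦ κ (Re z) ⟧ + ⟦ κ (Im z) ⟧ * τ ω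
    τ-expand z = trans (τ-cong (sym (Re+Imω z))) (trans (τ-+ _ _) (+-cong (τ⟦⟧ _) (trans (τ-* _ _) (*-congʳ (τ⟦⟧ _)))))

-- The Tits ovoid and its symmetries in the Suzuki group.

module TitsOvoid (e : ℕ) (K : FiniteField (2 ℕ.^ (2 ℕ.* e ℕ.+ 1))) where
  open FiniteField K hiding (zero)
  open FieldProperties K
  open Char2 K (order-2^n⇒1+1≈0 (2 ℕ.* e ℕ.+ 1) K)
  open HalfTrace e K using (sqrt; sqrt-square)
  open Exp semiring
  open Solver using (solve; _:=_; _:+_; _:*_; con)
  open Projective K
  open LinearAlgebra K
  open import Relation.Binary.Reasoning.Setoid setoid

  σ : ℕ
  σ = 2 ℕ.^ (e ℕ.+ 1)

  φ : Carrier → Carrier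
  φ x = x ^ σ

  φ-cong : ∀ {x y} → x ≈ y → φ x ≈ φ y
  φ-cong = ^-congˡ σ

  φ-+ : ∀ x y → φ (x + y) ≈ φ x + φ y
  φ-+ = ^2^-distrib-+ (e ℕ.+ 1)

  φ-* : ∀ x y → φ (x * y) ≈ φ x * φ y
  φ-* = ^-distrib-* σ

  φ-0 : φ 0# ≈ 0#
  φ-0 = 0^2^ (e ℕ.+ 1)

  φ-1 : φ 1# ≈ 1#
  φ-1 = 1^ σ

  φ-≉0 : ∀ {x} → x ≉ 0# → φ x ≉ 0#
  φ-≉0 = ^-≉0 σ

  -- The map φ is the Tits endomorphism: σ² = 2q, so its square is Frobenius.
  φφ : ∀ x → φ (φ x) ≈ x * x
  φφ x = begin
    φ (φ x)                                    ≈⟨ ^2^-∘ x (e ℕ.+ 1) (e ℕ.+ 1) ⟩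
    x ^ (2 ℕ.^ (e ℕ.+ 1 ℕ.+ (e ℕ.+ 1)))        ≈⟨ ^-congʳ x (≡.cong (2 ℕ.^_) (exponent e)) ⟩
    x ^ (2 ℕ.^ ℕ.suc (2 ℕ.* e ℕ.+ 1))          ≈⟨ ^2^suc x (2 ℕ.* e ℕ.+ 1) ⟩
    x ^ (2 ℕ.^ (2 ℕ.* e ℕ.+ 1)) * x ^ (2 ℕ.^ (2 ℕ.* e ℕ.+ 1))  ≈⟨ *-cong (^order x) (^order x) ⟩
    x * x                                      ∎
    where
    exponent : ∀ e → e ℕ.+ 1 ℕ.+ (e ℕ.+ 1) ≡ ℕ.suc (2 ℕ.* e ℕ.+ 1)
    exponent = ℕ-solve 1 (λ e → (e ⊕ ℕ-con 1) ⊕ (e ⊕ ℕ-con 1) , ℕ-con 1 ⊕ (ℕ-con 2 ⊗ e ⊕ ℕ-con 1)) ≡.refl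
      where open ℕSolver.+-*-Solver using () renaming (solve to ℕ-solve; con to ℕ-con; _:+_ to _⊕_; _:*_ to _⊗_)

  -- Since φ ∘ φ is squaring, φ ∘ sqrt inverts φ. It supplies the parameters `k` and `a` of the
  -- normal form.
  φ-root : ∀ c → ∃[ k ] φ k ≈ c
  φ-root c = φ (sqrt c) , trans (φφ (sqrt c)) (sqrt-square c)

  F : Carrier → Carrier → Carrier
  F s t = s ^ (σ ℕ.+ 2) + t ^ σ + s * t

  F≈ : ∀ s t → F s t ≈ φ s * (s * s) + φ t + s * t
  F≈ s t = +-congʳ (+-congʳ (trans (^-homo-* s σ 2) (*-congˡ (*-congˡ (*-identityʳ s)))))

  F-cong : ∀ {s s′ t t′} → s ≈ s′ → t ≈ t′ → F s t ≈ F s′ t′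
  F-cong s≈ t≈ = +-cong (+-cong (^-congˡ (σ ℕ.+ 2) s≈) (φ-cong t≈)) (*-cong s≈ t≈)

  -- The summand φ a * s in the second argument is there to cancel the cross terms a² φ s and φ a
  -- s²; what remains besides F s t is affine in s and t, so the substitution is induced by a linear
  -- map of K⁴.
  F-translate : ∀ a b s t → F (s + a) (t + φ a * s + b) ≈ F s t + F a b + (b + φ a * a) * s + a * t
  F-translate a b s t = begin
    F (s + a) (t + φ a * s + b)  ≈⟨ F≈ _ _ ⟩
    φ (s + a) * ((s + a) * (s + a)) + φ (t + φ a * s + b) + (s + a) * (t + φ a * s + b)
      ≈⟨ +-congʳ (+-cong (*-congʳ (φ-+ s a)) (trans (φ-+ _ _) (+-congʳ (trans (φ-+ _ _) (+-congˡ (trans (φ-* _ _) (*-congʳ (φφ a)))))))) ⟩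
    (φ s + φ a) * ((s + a) * (s + a)) + (φ t + (a * a) * φ s + φ b) + (s + a) * (t + φ a * s + b)
      ≈⟨ solve 8 (λ s t a b φs φt φa φb →
           (φs :+ φa) :* ((s :+ a) :* (s :+ a)) :+ (φt :+ (a :* a) :* φs :+ φb) :+ (s :+ a) :* (t :+ φa :* s :+ b)
           := (φs :* (s :* s) :+ φt :+ s :* t) :+ (φa :* (a :* a) :+ φb :+ a :* b) :+ (b :+ φa :* a) :* s :+ a :* t)
         refl s t a b (φ s) (φ t) (φ a) (φ b) ⟩
    (φ s * (s * s) + φ t + s * t) + (φ a * (a * a) + φ b + a * b) + (b + φ a * a) * s + a * t
      ≈⟨ +-congʳ (+-congʳ (+-cong (F≈ s t) (F≈ a b))) ⟨
    F s t + F a b + (b + φ a * a) * s + a * t ∎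

  -- The weights k of s and k φ k of t give all three terms of F the weight φ k k², because φ (φ k)
  -- = k².
  F-scale : ∀ k s t → F (k * s) (k * φ k * t) ≈ φ k * (k * k) * F s t
  F-scale k s t = begin
    F (k * s) (k * φ k * t)  ≈⟨ F≈ _ _ ⟩
    φ (k * s) * ((k * s) * (k * s)) + φ (k * φ k * t) + (k * s) * (k * φ k * t)
      ≈⟨ +-congʳ (+-cong (*-congʳ (φ-* k s)) (trans (φ-* _ _) (*-congʳ (trans (φ-* _ _) (*-congˡ (φφ k)))))) ⟩
    (φ k * φ s) * ((k * s) * (k * s)) + (φ k * (k * k)) * φ t + (k * s) * (k * φ k * t)
      ≈⟨ solve 6 (λ k s t φk φs φt →
           (φk :* φs) :* ((k :* s) :* (k :* s)) :+ (φk :* (k :* k)) :* φt :+ (k :* s) :* (k :* φk :* t)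
           := φk :* (k :* k) :* (φs :* (s :* s) :+ φt :+ s :* t)) refl k s t (φ k) (φ s) (φ t) ⟩
    φ k * (k * k) * (φ s * (s * s) + φ t + s * t)  ≈⟨ *-congˡ (F≈ s t) ⟨
    φ k * (k * k) * F s t ∎

  F-00 : F 0# 0# ≈ 0#
  F-00 = trans (F≈ 0# 0#) (trans (+-congʳ (+-congˡ φ-0)) (solve 1 (λ x → x :* (con false :* con false) :+ con false :+ con false :* con false := con false) refl (φ 0#)))

  φ-F : ∀ s t → φ (F s t) ≈ (s * s) * (φ s * φ s) + t * t + φ s * φ t
  φ-F s t = begin
    φ (F s t)  ≈⟨ φ-cong (F≈ s t) ⟩
    φ (φ s * (s * s) + φ t + s * t)  ≈⟨ trans (φ-+ _ _) (+-cong (φ-+ _ _) (φ-* s t)) ⟩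
    φ (φ s * (s * s)) + φ (φ t) + φ s * φ t
      ≈⟨ +-congʳ (+-cong (trans (φ-* _ _) (*-cong (φφ s) (φ-* s s))) (φφ t)) ⟩
    (s * s) * (φ s * φ s) + t * t + φ s * φ t ∎

  -- Divided by φ z z², this reads F (t / z) (s / z) = 1 / z: the ovoid is invariant under reversing
  -- the coordinates.
  F-swap-identity : ∀ s t → let z = F s t in φ z * z ≈ s * t * φ z + φ t * (t * t) + φ s * (z * z)
  F-swap-identity s t = begin
    φ z * z  ≈⟨ *-cong (φ-F s t) (F≈ s t) ⟩
    ((s * s) * (φ s * φ s) + t * t + φ s * φ t) * (φ s * (s * s) + φ t + s * t)
      ≈⟨ solve 4 (λ s t φs φt → let z = φs :* (s :* s) :+ φt :+ s :* t
                                    φz = (s :* s) :* (φs :* φs) :+ t :* t :+ φs :* φt in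
           φz :* z := s :* t :* φz :+ φt :* (t :* t) :+ φs :* (z :* z)) refl s t (φ s) (φ t) ⟩
    s * t * ((s * s) * (φ s * φ s) + t * t + φ s * φ t) + φ t * (t * t)
      + φ s * ((φ s * (s * s) + φ t + s * t) * (φ s * (s * s) + φ t + s * t))
      ≈⟨ +-cong (+-congʳ (*-congˡ (φ-F s t))) (*-congˡ (*-cong (F≈ s t) (F≈ s t))) ⟨
    s * t * φ z + φ t * (t * t) + φ s * (z * z) ∎
    where
    z : Carrier
    z = F s t

  product-square⇒≈0 : ∀ {x} → φ x * (x * x) ≈ 0# → x ≈ 0#
  product-square⇒≈0 {x} eq with x ≟ 0#
  ... | yes x≈0 = x≈0
  ... | no  x≉0 = ⊥-elim (*-≉0 (φ-≉0 x≉0) (*-≉0 x≉0 x≉0) eq)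

  -- At z = 0 the swap identity collapses to φ t t² = 0, and then F s 0 = φ s s². So `reverse` sends
  -- only the affine point (1,0,0,0) to infinity.
  F≈0⇒ : ∀ {s t} → F s t ≈ 0# → s ≈ 0# × t ≈ 0#
  F≈0⇒ {s} {t} z≈0 = s≈0 , t≈0
    where
    z : Carrier
    z = F s t
    t≈0 : t ≈ 0#
    t≈0 = product-square⇒≈0 (by₃ 1# (φ z + φ s * z) (s * t)
      (solve 6 (λ s t φs φt z φz → φt :* (t :* t) :+ con false :=
         con true :* (φz :* z :+ (s :* t :* φz :+ φt :* (t :* t) :+ φs :* (z :* z)))
           :+ (φz :+ φs :* z) :* (z :+ con false) :+ (s :* t) :* (φz :+ con false)) refl s t (φ s) (φ t) z (φ z))
      (F-swap-identity s t) z≈0 (trans (φ-cong z≈0) φ-0))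
    s≈0 : s ≈ 0#
    s≈0 = product-square⇒≈0 (begin
      φ s * (s * s)                   ≈⟨ solve 2 (λ x s → x := x :+ con false :+ s :* con false) refl _ s ⟩
      φ s * (s * s) + 0# + s * 0#     ≈⟨ +-congʳ (+-congˡ φ-0) ⟨
      φ s * (s * s) + φ 0# + s * 0#   ≈⟨ F≈ s 0# ⟨
      F s 0#                          ≈⟨ F-cong refl t≈0 ⟨
      F s t                           ≈⟨ z≈0 ⟩
      0#                              ∎)

  F-swap : ∀ {s t i} → F s t * i ≈ 1# → F (t * i) (s * i) ≈ i
  F-swap {s} {t} {i} zi≈1 = sym (begin
    i ≈⟨ by₃ (i * i * φ i) (φ s * φ i * (1# + z * i) + i) (s * t * (i * i) + z * i * i)
           (solve 8 (λ s t i φs φt φi z φz →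
              i :+ ((φt :* φi) :* ((t :* i) :* (t :* i)) :+ φs :* φi :+ (t :* i) :* (s :* i))
              := (i :* i :* φi) :* (φz :* z :+ (s :* t :* φz :+ φt :* (t :* t) :+ φs :* (z :* z)))
              :+ (φs :* φi :* (con true :+ z :* i) :+ i) :* (z :* i :+ con true)
              :+ (s :* t :* (i :* i) :+ z :* i :* i) :* (φz :* φi :+ con true)) refl s t i (φ s) (φ t) (φ i) z (φ z))
           (F-swap-identity s t) zi≈1 (trans (sym (φ-* _ _)) (trans (φ-cong zi≈1) φ-1)) ⟩
    (φ t * φ i) * ((t * i) * (t * i)) + φ s * φ i + (t * i) * (s * i)
      ≈⟨ +-congʳ (+-cong (*-congʳ (φ-* t i)) (φ-* s i)) ⟨
    φ (t * i) * ((t * i) * (t * i)) + φ (s * i) + (t * i) * (s * i)  ≈⟨ F≈ _ _ ⟨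
    F (t * i) (s * i) ∎)
    where
    z : Carrier
    z = F s t

  p∞ : Vec 4
  p∞ = 0# ∷ 0# ∷ 0# ∷ 1# ∷ []

  -- The predicate of `standardTitsOvoid`, on vectors in place of points, so that no proof of being
  -- nonzero has to be carried along.
  Tits : Vec 4 → Set
  Tits v = v ∝ p∞ ⊎ ∃[ s ] ∃[ t ] v ∝ (1# ∷ s ∷ t ∷ F s t ∷ [])

  Tits-resp : ∀ {v w} → v ∝ w → Tits w → Tits v
  Tits-resp {v} {w} v∝w (inj₁ w∝) = inj₁ (∝.trans {4} {v} {w} {p∞} v∝w w∝)
  Tits-resp {v} {w} v∝w (inj₂ (s , t , w∝)) = inj₂ (s , t , ∝.trans {4} {v} {w} {1# ∷ s ∷ t ∷ F s t ∷ []} v∝w w∝)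

  Tits-affine : ∀ {v} → v 0F ≈ 1# → v 3F ≈ F (v 1F) (v 2F) → Tits v
  Tits-affine {v} v₀≈1 v₃≈ = inj₂ (v 1F , v 2F , ∝-refl λ { 0F → v₀≈1 ; 1F → refl ; 2F → refl ; 3F → v₃≈ })

  Tits-affine⁻¹ : ∀ {v} → v 0F ≈ 1# → Tits v → v 3F ≈ F (v 1F) (v 2F)
  Tits-affine⁻¹ {v} v₀≈1 (inj₁ (c , c≉0 , eq)) = ⊥-elim (1≉0 (trans (sym v₀≈1) (trans (eq 0F) (zeroʳ c))))
  Tits-affine⁻¹ {v} v₀≈1 (inj₂ (s , t , c , c≉0 , eq)) =
    trans (eq 3F) (trans (c·≈ (F s t)) (F-cong (sym (trans (eq 1F) (c·≈ s))) (sym (trans (eq 2F) (c·≈ t)))))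
    where
    c·≈ : ∀ x → c * x ≈ x
    c·≈ x = trans (*-congʳ (trans (sym (*-identityʳ c)) (trans (sym (eq 0F)) v₀≈1))) (*-identityˡ x)

  record IsSymmetry (I : LinearIso 4) : Set where
    open LinearIso I
    field
      preserves : ∀ {v} → Tits v → Tits (to v)
      reflects  : ∀ {v} → Tits (to v) → Tits v

  preserving : ∀ {g : Vec 4 → Vec 4} → IsLinear g → Tits (g p∞) →
               (∀ s t → Tits (g (1# ∷ s ∷ t ∷ F s t ∷ []))) → ∀ {v} → Tits v → Tits (g v)
  preserving {g} G at∞ finite (inj₁ v∝)           = Tits-resp (linear-∝ G v∝) at∞
  preserving {g} G at∞ finite (inj₂ (s , t , v∝)) = Tits-resp (linear-∝ G v∝) (finite s t)

  isSymmetry : (I : LinearIso 4) → (∀ {v} → Tits v → Tits (LinearIso.to I v)) →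
               (∀ {v} → Tits v → Tits (LinearIso.from I v)) → IsSymmetry I
  isSymmetry I to-preserves from-preserves = record
    { preserves = to-preserves
    ; reflects  = λ {v} p → Tits-resp (∝-refl (≋-sym (LinearIso.from∘to I v))) (from-preserves p)
    }

  ∘-isSymmetry : ∀ {I J} → IsSymmetry I → IsSymmetry J → IsSymmetry (I ∘ₗ J)
  ∘-isSymmetry P Q = record
    { preserves = λ p → IsSymmetry.preserves P (IsSymmetry.preserves Q p)
    ; reflects  = λ p → IsSymmetry.reflects Q (IsSymmetry.reflects P p)
    }

  -- An element of the Sylow 2-subgroup of the Suzuki group that fixes `p∞`; it maps (1,0,0,0) to
  -- (1, a, b, F a b). The entries are the coefficients in `F-translate`.
  translate : Carrier → Carrier → Vec 4 → Vec 4
  translate a b v = v 0F ∷ v 1F + a * v 0F ∷ v 2F + φ a * v 1F + b * v 0F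
                  ∷ v 3F + F a b * v 0F + (b + φ a * a) * v 1F + a * v 2F ∷ []

  translate-isLinear : ∀ a b → IsLinear (translate a b)
  translate-isLinear a b = record
    { ≋-cong = λ p → λ
      { 0F → p 0F
      ; 1F → +-cong (p 1F) (*-congˡ (p 0F))
      ; 2F → +-cong (+-cong (p 2F) (*-congˡ (p 1F))) (*-congˡ (p 0F))
      ; 3F → +-cong (+-cong (+-cong (p 3F) (*-congˡ (p 0F))) (*-congˡ (p 1F))) (*-congˡ (p 2F)) }
    ; +-homo = λ v w → λ
      { 0F → refl
      ; 1F → solve 5 (λ a x y x′ y′ → (x :+ x′) :+ a :* (y :+ y′) := (x :+ a :* y) :+ (x′ :+ a :* y′))
               refl a (v 1F) (v 0F) (w 1F) (w 0F)
      ; 2F → solve 8 (λ a b x y z x′ y′ z′ → (x :+ x′) :+ a :* (y :+ y′) :+ b :* (z :+ z′)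
               := (x :+ a :* y :+ b :* z) :+ (x′ :+ a :* y′ :+ b :* z′))
               refl (φ a) b (v 2F) (v 1F) (v 0F) (w 2F) (w 1F) (w 0F)
      ; 3F → sum₄ (F a b) (b + φ a * a) a (v 3F) (v 0F) (v 1F) (v 2F) (w 3F) (w 0F) (w 1F) (w 2F) }
    ; ·-homo = λ c v → λ
      { 0F → refl
      ; 1F → solve 4 (λ a c x y → c :* x :+ a :* (c :* y) := c :* (x :+ a :* y)) refl a c (v 1F) (v 0F)
      ; 2F → solve 6 (λ a b c x y z → c :* x :+ a :* (c :* y) :+ b :* (c :* z) := c :* (x :+ a :* y :+ b :* z))
               refl (φ a) b c (v 2F) (v 1F) (v 0F)
      ; 3F → solve 8 (λ a b d c x y z w → c :* x :+ a :* (c :* y) :+ b :* (c :* z) :+ d :* (c :* w)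
                 := c :* (x :+ a :* y :+ b :* z :+ d :* w))
               refl (F a b) (b + φ a * a) a c (v 3F) (v 0F) (v 1F) (v 2F) }
    }
    where
    sum₄ : ∀ a b d x y z w x′ y′ z′ w′ → (x + x′) + a * (y + y′) + b * (z + z′) + d * (w + w′)
           ≈ (x + a * y + b * z + d * w) + (x′ + a * y′ + b * z′ + d * w′)
    sum₄ = solve 11 (λ a b d x y z w x′ y′ z′ w′ → (x :+ x′) :+ a :* (y :+ y′) :+ b :* (z :+ z′) :+ d :* (w :+ w′)
           := (x :+ a :* y :+ b :* z :+ d :* w) :+ (x′ :+ a :* y′ :+ b :* z′ :+ d :* w′)) refl

  translate-preserves : ∀ a b {v} → Tits v → Tits (translate a b v)
  translate-preserves a b = preserving (translate-isLinear a b)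
    (inj₁ (∝-refl λ
      { 0F → refl
      ; 1F → solve 1 (λ a → con false :+ a :* con false := con false) refl a
      ; 2F → solve 2 (λ a b → con false :+ a :* con false :+ b :* con false := con false) refl (φ a) b
      ; 3F → solve 3 (λ a b d → con true :+ a :* con false :+ b :* con false :+ d :* con false := con true)
               refl (F a b) (b + φ a * a) a }))
    (λ s t → Tits-affine refl (begin
      F s t + F a b * 1# + (b + φ a * a) * s + a * t  ≈⟨ +-congʳ (+-congʳ (+-congˡ (*-identityʳ _))) ⟩
      F s t + F a b + (b + φ a * a) * s + a * t       ≈⟨ F-translate a b s t ⟨
      F (s + a) (t + φ a * s + b)
        ≈⟨ F-cong (+-congˡ (*-identityʳ a)) (+-congˡ (*-identityʳ b)) ⟨
      F (s + a * 1#) (t + φ a * s + b * 1#) ∎))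

  -- The inverse of `translate a b` has parameters a and b + φ a * a; its corner entry has to be the
  -- same F a b for the last coordinate to cancel.
  F-translate-inverse : ∀ a b → F a (b + φ a * a) ≈ F a b
  F-translate-inverse a b = begin
    F a (b + φ a * a)  ≈⟨ F≈ _ _ ⟩
    φ a * (a * a) + φ (b + φ a * a) + a * (b + φ a * a)
      ≈⟨ +-congʳ (+-congˡ (trans (φ-+ _ _) (+-congˡ (trans (φ-* _ _) (*-congʳ (φφ a)))))) ⟩
    φ a * (a * a) + (φ b + a * a * φ a) + a * (b + φ a * a)
      ≈⟨ solve 4 (λ a b φa φb → φa :* (a :* a) :+ (φb :+ a :* a :* φa) :+ a :* (b :+ φa :* a)
           := φa :* (a :* a) :+ φb :+ a :* b) refl a b (φ a) (φ b) ⟩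
    φ a * (a * a) + φ b + a * b  ≈⟨ F≈ a b ⟨
    F a b ∎

  translate-inverse : ∀ a b v → translate a (b + φ a * a) (translate a b v) ≋ v
  translate-inverse a b v = λ
    { 0F → refl
    ; 1F → solve 3 (λ a x y → (x :+ a :* y) :+ a :* y := x) refl a (v 1F) (v 0F)
    ; 2F → solve 6 (λ a φa b x y z → (x :+ φa :* y :+ b :* z) :+ φa :* (y :+ a :* z) :+ (b :+ φa :* a) :* z := x)
             refl a (φ a) b (v 2F) (v 1F) (v 0F)
    ; 3F → trans (+-congʳ (+-congʳ (+-congˡ (*-congʳ (F-translate-inverse a b)))))
             (solve 8 (λ a φa b f x y z w → (x :+ f :* y :+ (b :+ φa :* a) :* z :+ a :* w) :+ f :* y
                :+ ((b :+ φa :* a) :+ φa :* a) :* (z :+ a :* y) :+ a :* (w :+ φa :* z :+ b :* y) := x)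
             refl a (φ a) b (F a b) (v 3F) (v 0F) (v 1F) (v 2F))
    }

  translation : Carrier → Carrier → LinearIso 4
  translation a b = record
    { to = translate a b ; from = translate a b⁻
    ; to-isLinear = translate-isLinear a b ; from-isLinear = translate-isLinear a b⁻
    ; from∘to = translate-inverse a b
    ; to∘from = λ v → ≋-trans (≋-sym (translate-congʳ (translate a b⁻ v))) (translate-inverse a b⁻ v)
    }
    where
    b⁻ : Carrier
    b⁻ = b + φ a * a
    b⁻⁻≈b : b⁻ + φ a * a ≈ b
    b⁻⁻≈b = solve 2 (λ b x → (b :+ x) :+ x := b) refl b (φ a * a)
    translate-congʳ : ∀ v → translate a (b⁻ + φ a * a) v ≋ translate a b v
    translate-congʳ v = λ
      { 0F → refl
      ; 1F → refl
      ; 2F → +-congˡ (*-congʳ b⁻⁻≈b)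
      ; 3F → +-congʳ (+-cong (+-congˡ (*-congʳ (F-cong refl b⁻⁻≈b))) (*-congʳ (+-congʳ b⁻⁻≈b)))
      }

  translation-isSymmetry : ∀ a b → IsSymmetry (translation a b)
  translation-isSymmetry a b = isSymmetry (translation a b)
    (translate-preserves a b) (translate-preserves a (b + φ a * a))

  -- The involution exchanging `p∞` and (1,0,0,0), which together with the stabiliser of `p∞` makes
  -- the symmetries transitive.
  reverse : Vec 4 → Vec 4
  reverse v = v 3F ∷ v 2F ∷ v 1F ∷ v 0F ∷ []

  reverse-isLinear : IsLinear reverse
  reverse-isLinear = record
    { ≋-cong = λ p → λ { 0F → p 3F ; 1F → p 2F ; 2F → p 1F ; 3F → p 0F }
    ; +-homo = λ v w → λ { 0F → refl ; 1F → refl ; 2F → refl ; 3F → refl }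
    ; ·-homo = λ c v → λ { 0F → refl ; 1F → refl ; 2F → refl ; 3F → refl }
    }

  reverse-preserves : ∀ {v} → Tits v → Tits (reverse v)
  reverse-preserves = preserving reverse-isLinear (Tits-affine refl (sym F-00)) finite
    where
    finite : ∀ s t → Tits (F s t ∷ t ∷ s ∷ 1# ∷ [])
    finite s t with F s t ≟ 0#
    ... | yes z≈0 = inj₁ (∝-refl λ { 0F → z≈0 ; 1F → proj₂ (F≈0⇒ z≈0) ; 2F → proj₁ (F≈0⇒ z≈0) ; 3F → refl })
    ... | no  z≉0 = inj₂ (t * inv z≉0 , s * inv z≉0 , F s t , z≉0 , λ
      { 0F → sym (*-identityʳ _)
      ; 1F → sym (cancel t)
      ; 2F → sym (cancel s)
      ; 3F → sym (trans (*-congˡ (F-swap (*-inv z≉0))) (*-inv z≉0)) })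
      where
      cancel : ∀ x → F s t * (x * inv z≉0) ≈ x
      cancel x = trans (*-congˡ (*-comm x _)) (*-inv∙ z≉0 x)

  reversal : LinearIso 4
  reversal = record
    { to = reverse ; from = reverse ; to-isLinear = reverse-isLinear ; from-isLinear = reverse-isLinear
    ; from∘to = reverse² ; to∘from = reverse² }
    where
    reverse² : ∀ v → reverse (reverse v) ≋ v
    reverse² v = λ { 0F → refl ; 1F → refl ; 2F → refl ; 3F → refl }

  reversal-isSymmetry : IsSymmetry reversal
  reversal-isSymmetry = isSymmetry reversal reverse-preserves reverse-preserves

  -- The diagonal torus, fixing both `p∞` and (1,0,0,0).
  scale : Carrier → Vec 4 → Vec 4
  scale k v = v 0F ∷ k * v 1F ∷ k * φ k * v 2F ∷ φ k * (k * k) * v 3F ∷ []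

  scale-isLinear : ∀ k → IsLinear (scale k)
  scale-isLinear k = record
    { ≋-cong = λ p → λ { 0F → p 0F ; 1F → *-congˡ (p 1F) ; 2F → *-congˡ (p 2F) ; 3F → *-congˡ (p 3F) }
    ; +-homo = λ v w → λ { 0F → refl ; 1F → distribˡ _ _ _ ; 2F → distribˡ _ _ _ ; 3F → distribˡ _ _ _ }
    ; ·-homo = λ c v → λ { 0F → refl ; 1F → exchange _ _ _ ; 2F → exchange _ _ _ ; 3F → exchange _ _ _ }
    }
    where
    exchange : ∀ a c x → a * (c * x) ≈ c * (a * x)
    exchange = solve 3 (λ a c x → a :* (c :* x) := c :* (a :* x)) refl

  scale-preserves : ∀ {k} → k ≉ 0# → ∀ {v} → Tits v → Tits (scale k v)
  scale-preserves {k} k≉0 = preserving (scale-isLinear k)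
    (inj₁ (φ k * (k * k) , *-≉0 (φ-≉0 k≉0) (*-≉0 k≉0 k≉0) , λ
      { 0F → sym (zeroʳ _)
      ; 1F → trans (zeroʳ _) (sym (zeroʳ _))
      ; 2F → trans (zeroʳ _) (sym (zeroʳ _))
      ; 3F → refl }))
    (λ s t → Tits-affine refl (sym (F-scale k s t)))

  scale-inverse : ∀ {k l} → k * l ≈ 1# → ∀ v → scale l (scale k v) ≋ v
  scale-inverse {k} {l} kl≈1 v = λ
    { 0F → refl
    ; 1F → trans (solve 3 (λ k l x → l :* (k :* x) := (k :* l) :* x) refl k l (v 1F)) (trans (*-congʳ kl≈1) (*-identityˡ _))
    ; 2F → by₂ (φ k * φ l * v 2F) (v 2F)
             (solve 5 (λ k l φk φl x → l :* φl :* (k :* φk :* x) :+ x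
                := (φk :* φl :* x) :* (k :* l :+ con true) :+ x :* (φk :* φl :+ con true)) refl k l (φ k) (φ l) (v 2F))
             kl≈1 φkφl≈1
    ; 3F → by₂ (φ k * φ l * v 3F * (k * l + 1#)) (v 3F)
             (solve 5 (λ k l φk φl x → φl :* (l :* l) :* (φk :* (k :* k) :* x) :+ x
                := (φk :* φl :* x :* (k :* l :+ con true)) :* (k :* l :+ con true) :+ x :* (φk :* φl :+ con true)) refl k l (φ k) (φ l) (v 3F))
             kl≈1 φkφl≈1
    }
    where
    φkφl≈1 : φ k * φ l ≈ 1#
    φkφl≈1 = trans (sym (φ-* k l)) (trans (φ-cong kl≈1) φ-1)

  module _ {k} (k≉0 : k ≉ 0#) where

    scaling : LinearIso 4
    scaling = record
      { to = scale k ; from = scale (inv k≉0)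
      ; to-isLinear = scale-isLinear k ; from-isLinear = scale-isLinear (inv k≉0)
      ; from∘to = scale-inverse (*-inv k≉0) ; to∘from = scale-inverse (inv-* k≉0) }

    scaling-isSymmetry : IsSymmetry scaling
    scaling-isSymmetry = isSymmetry scaling (scale-preserves k≉0) (scale-preserves (inv≉0 k≉0))

  -- A translation brings an affine point to (1,0,0,0), and the reversal takes it from there to
  -- `p∞`.
  Tits-transitive : ∀ {p} → Tits p → Σ[ I ∈ LinearIso 4 ] IsSymmetry I × LinearIso.to I p ∝ p∞
  Tits-transitive (inj₁ p∝) = identityₗ , record { preserves = λ t → t ; reflects = λ t → t } , p∝
  Tits-transitive {p} (inj₂ (s , t , p∝)) = reversal ∘ₗ translation s b ,
      ∘-isSymmetry reversal-isSymmetry (translation-isSymmetry s b) ,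
      ∝-resp {u = reverse (translate s b p)} (linear-∝ (∘-isLinear reverse-isLinear (translate-isLinear s b)) p∝) λ
        { 0F → begin
            F s t + F s b * 1# + (b + φ s * s) * s + s * t
              ≈⟨ +-congʳ (+-congʳ (+-congˡ (*-congʳ (F-translate-inverse s t)))) ⟩
            F s t + F s t * 1# + ((t + φ s * s) + φ s * s) * s + s * t
              ≈⟨ solve 4 (λ f t x s → f :+ f :* con true :+ ((t :+ x) :+ x) :* s :+ s :* t := con false) refl (F s t) t (φ s * s) s ⟩
            0# ∎
        ; 1F → solve 3 (λ t x s → t :+ x :* s :+ (t :+ x :* s) :* con true := con false) refl t (φ s) s
        ; 2F → solve 1 (λ s → s :+ s :* con true := con false) refl s
        ; 3F → refl }
    where
    b : Carrier
    -- Chosen so that the third coordinate t + φ s s + b of the translated point vanishes.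
    b = t + φ s * s

-- Subspaces: lines through two points, vectors outside a hyperplane.

module Spans {q : ℕ} (K : FiniteField q) where
  open FiniteField K hiding (zero)
  open FieldProperties K
  open Projective K
  open LinearAlgebra K

  private variable n : ℕ

  -- The cone provides a line only with some basis ℓ. The coordinates of u and v in it form an
  -- invertible 2 × 2 matrix `M`, through which any point of the line is rewritten in terms of u and
  -- v.
  two-points-span : ∀ {ℓ : Vector (Vec n) 2} {u v x : Vec n} a b c →
    u ≋ combination a ℓ → v ≋ combination b ℓ → x ≋ combination c ℓ →
    LinearlyIndependent (u ∷ v ∷ []) → ∃[ y ] x ≋ combination y (u ∷ v ∷ [])
  two-points-span {n} {ℓ} {u} {v} {x} a b c u≋ v≋ x≋ independent = proj₁ spanned , (begin
      x                                        ≈⟨ x≋ ⟩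
      combination c ℓ                          ≈⟨ combination-cong ℓ (proj₂ spanned) ⟨
      combination (combination (proj₁ spanned) M) ℓ  ≈⟨ transfer (proj₁ spanned) ⟩
      combination (proj₁ spanned) (u ∷ v ∷ [])  ∎)
    where
    open import Relation.Binary.Reasoning.Setoid (≋-setoid n)
    M : Vector (Vec 2) 2
    M = a ∷ b ∷ []
    transfer : ∀ y → combination (combination y M) ℓ ≋ combination y (u ∷ v ∷ [])
    transfer y = ≋-trans (IsLinear.combination-homo (combination-isLinear ℓ) y M)
      (combination-congʳ y {λ j → combination (M j) ℓ} {u ∷ v ∷ []} λ { 0F → ≋-sym u≋ ; 1F → ≋-sym v≋ })
    M-independent : LinearlyIndependent M
    M-independent y My≋0 = independent y (≋-trans (≋-sym (transfer y)) (combination-0 ℓ My≋0))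
    spanned : ∃[ y ] combination y M ≋ c
    spanned = basis-spans {b = M} M-independent c

  abstract
    -- Were everything in the span, q⁵ vectors would be determined by q⁴ coefficient tuples.
    complement : 1 ℕ.< q → (b : Flat 3 4) → ∃[ w ] ¬ (w ∈span b)
    complement 1<q (b , independent) = cases
      (search (vectors-finite order 5) {P = λ w → ¬ (∃[ a ] w ≋ combination a b)}
        (λ { v≋w v∉ (a , eq) → v∉ (a , ≋-trans v≋w eq) }) (λ w → ¬? (∈span? w)))
      where
      ∈span? : ∀ w → Dec (∃[ a ] w ≋ combination a b)
      ∈span? w = search (vectors-finite order 4)
        (λ a≋a′ eq → ≋-trans eq (combination-cong b a≋a′))
        (λ a → finite⇒decidable (vectors-finite order 5) w (combination a b))
      cases : Dec (∃[ w ] ¬ (∃[ a ] w ≋ combination a b)) → ∃[ w ] ¬ (∃[ a ] w ≋ combination a b)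
      cases (yes found) = found
      cases (no ¬found) = contradiction
        (injective⇒≤ (vectors-finite order 5) (vectors-finite order 4) (λ w → proj₁ (all w))
          (λ {v} {w} eq → ≋-trans (proj₂ (all v)) (≋-trans (combination-cong b eq) (≋-sym (proj₂ (all w))))))
        (ℕ.<⇒≱ (ℕ.^-monoʳ-< q 1<q {4} {5} ℕ.≤-refl))
        where
        all : ∀ w → ∃[ a ] w ≋ combination a b
        all w = decide (∈span? w)
          where
          decide : Dec (∃[ a ] w ≋ combination a b) → ∃[ a ] w ≋ combination a b
          decide (yes w∈) = w∈
          decide (no w∉) = ⊥-elim (¬found (w , w∉))

-- Ovoidal cones as preimages under projection from the vertex.

module _ (e : ℕ) (K : FiniteField (2 ℕ.^ (2 ℕ.* e ℕ.+ 1))) where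
  open FiniteField K hiding (zero)
  open FieldProperties K
  open Projective K
  open LinearAlgebra K
  open Spans K
  open TitsOvoid e K

  -- Forgets the base hyperplane and keeps the quotient of K⁵ by the vertex, in coordinates where
  -- the base is the standard ovoid. Symmetries of the ovoid then act by composition with π. The
  -- alternative π X = 0 stands for the vertex.
  record ConeProjection (C : Pred (Point 4) 0ℓ) (V : Vec 5) : Set where
    field
      π             : Vec 5 → Vec 4
      π-isLinear    : IsLinear π
      lift          : Vec 4 → Vec 5
      lift-isLinear : IsLinear lift
      π-lift        : ∀ z → π (lift z) ≋ z
      π-vertex      : π V ≋ 0ᵥ
      π-kernel      : ∀ X → π X ≋ 0ᵥ → ∃[ k ] X ≋ k · V
      cone⇒         : ∀ X → X ∈ C → π (proj₁ X) ≋ 0ᵥ ⊎ Tits (π (proj₁ X))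
      ⇒cone         : ∀ X → π (proj₁ X) ≋ 0ᵥ ⊎ Tits (π (proj₁ X)) → X ∈ C

  transform : ∀ {C V} (I : LinearIso 4) → IsSymmetry I → ConeProjection C V → ConeProjection C V
  transform I symmetry P = record
    { π = I.to ∘ π
    ; π-isLinear = ∘-isLinear I.to-isLinear π-isLinear
    ; lift = lift ∘ I.from
    ; lift-isLinear = ∘-isLinear lift-isLinear I.from-isLinear
    ; π-lift = λ z → ≋-trans (IsLinear.≋-cong I.to-isLinear (π-lift (I.from z))) (I.to∘from z)
    ; π-vertex = IsLinear.0-homo I.to-isLinear π-vertex
    ; π-kernel = λ X eq → π-kernel X (to-kernel eq)
    ; cone⇒ = λ X X∈C → to (cone⇒ X X∈C)
    ; ⇒cone = λ X p → ⇒cone X (from p)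
    }
    where
    module I = LinearIso I
    open ConeProjection P
    open IsSymmetry symmetry
    to-kernel : ∀ {z} → I.to z ≋ 0ᵥ → z ≋ 0ᵥ
    to-kernel {z} eq = ≋-trans (≋-sym (I.from∘to z)) (IsLinear.0-homo I.from-isLinear eq)
    to : ∀ {z} → z ≋ 0ᵥ ⊎ Tits z → I.to z ≋ 0ᵥ ⊎ Tits (I.to z)
    to (inj₁ eq) = inj₁ (IsLinear.0-homo I.to-isLinear eq)
    to (inj₂ t)  = inj₂ (preserves t)
    from : ∀ {z} → I.to z ≋ 0ᵥ ⊎ Tits (I.to z) → z ≋ 0ᵥ ⊎ Tits z
    from (inj₁ eq) = inj₁ (to-kernel eq)
    from (inj₂ t)  = inj₂ (reflects t)

  Tits⇒≉0 : ∀ {v} → Tits v → ¬ (v ≋ 0ᵥ)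
  Tits⇒≉0 (inj₁ (c , c≉0 , eq)) v≋0 = c≉0 (trans (sym (*-identityʳ c)) (trans (sym (eq 3F)) (v≋0 3F)))
  Tits⇒≉0 (inj₂ (s , t , c , c≉0 , eq)) v≋0 = c≉0 (trans (sym (*-identityʳ c)) (trans (sym (eq 0F)) (v≋0 0F)))

  module _ (V : Point 4) (H : Flat 3 4) (V∉H : V ∉ ⟪ H ⟫) (O : Pred (Point 3) 0ℓ) (g : GL 4)
           (O≐ : O ≐ image (projectivity g) (standardTitsOvoid K e)) where
    private
      v₀ : Vec 5
      v₀ = proj₁ V
      h : Vector (Vec 5) 4
      h = proj₁ H
      G : LinearIso 4
      G = toLinearIso g
      module G = LinearIso G
      open Coordinates {b = v₀ ∷ h} (independent-∷ {b = h} {v = v₀} (proj₂ H) V∉H)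
      C : Pred (Point 4) 0ℓ
      C = cone K V (image (embed H) O)

      -- Coordinates with respect to V and H, without the V-coordinate, moved back by the
      -- projectivity that defines the ovoid.
      π : Vec 5 → Vec 4
      π X = G.from (coords X ∘ suc)

      tail-isLinear : IsLinear {5} {4} (_∘ suc)
      tail-isLinear = record { ≋-cong = λ p i → p (suc i) ; +-homo = λ _ _ → ≋-refl ; ·-homo = λ _ _ → ≋-refl }

      π-isLinear : IsLinear π
      π-isLinear = ∘-isLinear G.from-isLinear (∘-isLinear tail-isLinear coords-isLinear)
      module π = IsLinear π-isLinear

      π-combination : ∀ {X} x y → combination (x ∷ y) (v₀ ∷ h) ≋ X → π X ≋ G.from y
      π-combination x y eq = IsLinear.≋-cong G.from-isLinear λ i → coords-unique {x ∷ y} eq (suc i)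

      cons-isLinear : IsLinear {4} {5} (0# ∷_)
      cons-isLinear = record
        { ≋-cong = λ p → λ { zero → refl ; (suc i) → p i }
        ; +-homo = λ v w → λ { zero → sym (+-identityʳ 0#) ; (suc i) → refl }
        ; ·-homo = λ c v → λ { zero → sym (zeroʳ c) ; (suc i) → refl } }

      lift : Vec 4 → Vec 5
      lift z = combination (0# ∷ G.to z) (v₀ ∷ h)

      lift-isLinear : IsLinear lift
      lift-isLinear = ∘-isLinear (combination-isLinear (v₀ ∷ h)) (∘-isLinear cons-isLinear G.to-isLinear)

      π-vertex : π v₀ ≋ 0ᵥ
      π-vertex = ≋-trans (π-combination 1# 0ᵥ (λ i → trans (+-cong (*-identityˡ _) (combination-0 h ≋-refl i)) (+-identityʳ _)))
        (IsLinear.0-homo G.from-isLinear ≋-refl)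

      decompose : ∀ X → X ≋ coords X zero · v₀ +ᵥ combination (G.to (π X)) h
      decompose X i = trans (sym (combination-coords X i)) (+-congˡ (combination-cong h (≋-sym (G.to∘from (coords X ∘ suc))) i))

      π-kernel : ∀ X → π X ≋ 0ᵥ → ∃[ k ] X ≋ k · v₀
      π-kernel X eq = coords X zero , λ i → trans (decompose X i)
        (trans (+-congˡ (combination-0 h (IsLinear.0-homo G.to-isLinear eq) i)) (+-identityʳ _))

      π-H : ∀ P Q R → P ∝ combination Q h → Q ∝ G.to R → π P ∝ R
      π-H P Q R P∝ Q∝ = ∝.trans {_} {π P} {π (combination Q h)} {R} (linear-∝ π-isLinear P∝)
        (∝.trans {_} {π (combination Q h)} {G.from Q} {R}
          (∝-refl (π-combination 0# Q λ i → trans (+-congʳ (zeroˡ _)) (+-identityˡ _)))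
          (∝-resp {u = G.from Q} (linear-∝ G.from-isLinear Q∝) (G.from∘to R)))

      V,P-independent : ∀ P Q → ¬ (P ≋ 0ᵥ) → P ∝ combination Q h → LinearlyIndependent (v₀ ∷ P ∷ [])
      V,P-independent P Q P≉0 P∝ = independent-pair (proj₂ V) P≉0 λ V∝P → V∉
        (∝.trans {_} {v₀} {P} {combination Q h} V∝P P∝)
        where
        V∉ : ¬ (v₀ ∝ combination Q h)
        V∉ (c , _ , eq) = V∉H (c · Q , λ i → trans (eq i) (sym (combination-· c Q h i)))

      cone⇒ : ∀ X → X ∈ C → π (proj₁ X) ≋ 0ᵥ ⊎ Tits (π (proj₁ X))
      cone⇒ (X , X≉0) ((P , P≉0) , ((Q , Q≉0) , Q∈O , P∝) , ℓ , (a , V≋) , (b , P≋) , (c , X≋)) =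
        cases (y 1F ≟ 0#) (proj₁ O≐ Q∈O)
        where
        spanned : ∃[ y ] X ≋ combination y (v₀ ∷ P ∷ [])
        spanned = two-points-span {ℓ = proj₁ ℓ} {u = v₀} {v = P} {x = X} a b c V≋ P≋ X≋ (V,P-independent P Q P≉0 P∝)
        y : Vec 2
        y = proj₁ spanned
        πX : π X ≋ y 1F · π P
        πX i = trans (π.≋-cong (proj₂ spanned) i) (trans (π.combination-homo y (v₀ ∷ P ∷ []) i)
          (trans (+-cong (trans (*-congˡ (π-vertex i)) (zeroʳ _)) (+-identityʳ _)) (+-identityˡ _)))
        cases : Dec (y 1F ≈ 0#) → (Q , Q≉0) ∈ image (projectivity g) (standardTitsOvoid K e) →
                π X ≋ 0ᵥ ⊎ Tits (π X)
        cases (yes y≈0) _ = inj₁ λ i → trans (πX i) (trans (*-congʳ y≈0) (zeroˡ _))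
        cases (no y≉0) ((R , _) , R∈ , Q∝) =
          inj₂ (Tits-resp {w = R} (∝.trans {_} {π X} {π P} {R} (y 1F , y≉0 , πX) (π-H P Q R P∝ Q∝)) R∈)

      join : ∀ (X : Point 4) R x y → Tits R → proj₁ X ≋ x · v₀ +ᵥ y · combination (G.to R) h → X ∈ C
      join X R x y R∈ X≋ = P , (Q , proj₂ O≐ ((R , Tits⇒≉0 R∈) , R∈ , ∝-refl {v = proj₁ Q} ≋-refl) , ∝-refl {v = proj₁ P} ≋-refl)
        , (v₀ ∷ proj₁ P ∷ [] , V,P-independent (proj₁ P) (proj₁ Q) (proj₂ P) (∝-refl ≋-refl))
        , (1# ∷ 0# ∷ [] , λ i → sym (trans (+-cong (*-identityˡ _) (trans (+-identityʳ _) (zeroˡ _))) (+-identityʳ _)))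
        , (0# ∷ 1# ∷ [] , λ i → sym (trans (+-cong (zeroˡ _) (trans (+-identityʳ _) (*-identityˡ _))) (+-identityˡ _)))
        , (x ∷ y ∷ [] , λ i → trans (X≋ i) (+-congˡ (sym (+-identityʳ _))))
        where
        Q : Point 3
        Q = projectivity g (R , Tits⇒≉0 R∈)
        P : Point 4
        P = embed H Q

      ⇒cone : ∀ X → π (proj₁ X) ≋ 0ᵥ ⊎ Tits (π (proj₁ X)) → X ∈ C
      -- The vertex lies on every generator; the one over `p∞` serves.
      ⇒cone X (inj₁ eq) = join X p∞ (proj₁ (π-kernel (proj₁ X) eq)) 0# (inj₁ (∝-refl ≋-refl))
        λ i → trans (proj₂ (π-kernel (proj₁ X) eq) i) (sym (trans (+-congˡ (zeroˡ _)) (+-identityʳ _)))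
      ⇒cone X (inj₂ t) = join X (π (proj₁ X)) (coords (proj₁ X) zero) 1# t
        λ i → trans (decompose (proj₁ X) i) (+-congˡ (sym (*-identityˡ _)))

    coneProjection : ConeProjection (cone K V (image (embed H) O)) (proj₁ V)
    coneProjection = record
      { π = π ; π-isLinear = π-isLinear ; lift = lift ; lift-isLinear = lift-isLinear
      ; π-lift = λ z → ≋-trans (π-combination 0# (G.to z) ≋-refl) (G.from∘to z)
      ; π-vertex = π-vertex ; π-kernel = π-kernel ; cone⇒ = cone⇒ ; ⇒cone = ⇒cone }

-- Normal form of a cone relative to a Desarguesian spread.

module NormalForms (e : ℕ) (K : FiniteField (2 ℕ.^ (2 ℕ.* e ℕ.+ 1)))
  (L : FiniteField ((2 ℕ.^ (2 ℕ.* e ℕ.+ 1)) ℕ.^ 2)) (ι : FieldEmbedding K L) where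

  open QuadraticExtension e K L ι

  module K where
    open FiniteField K public
    open FieldProperties K public
    open Char2 K (order-2^n⇒1+1≈0 (2 ℕ.* e ℕ.+ 1) K) public
    open Solver public using (solve; _:=_; _:+_; _:*_; con)
    open Projective K public
    open LinearAlgebra K public
    open Spans K public
    open TitsOvoid e K public

  module L where
    open FiniteField L public
    open FieldProperties L public
    open Char2 L L-1+1≈0 public
    open Solver public using (solve; _:=_; _:+_; _:*_; con)
    open Projective L public
    open LinearAlgebra L public

  module Desarguesian {Σ∞ : K.Flat 3 4} {S : Pred (K.Line 4) 0ℓ} (D : IsDesarguesian ι Σ∞ S) where
    open IsDesarguesian D public renaming (cong to f-cong; homo-+ to f-+; homo-· to f-·; injective to f-injective)

    f-0 : ∀ {x} → x L.≋ L.0ᵥ → f x K.≋ K.0ᵥ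
    f-0 {x} x≋0 = K.≋-trans (f-cong {y = ⟦ K.0# ⟧ L.· x} (λ i → L.trans (x≋0 i) (L.sym (L.trans (L.*-congʳ ⟦⟧-0) (L.zeroˡ _)))))
      (K.≋-trans (f-· K.0# x) (λ i → K.zeroˡ _))

    f≋0⇒ : ∀ {x} → f x K.≋ K.0ᵥ → x L.≋ L.0ᵥ
    f≋0⇒ fx≋0 = f-injective (K.≋-trans fx≋0 (K.≋-sym (f-0 L.≋-refl)))

    f∈Σ∞ : ∀ x → f x K.∈span Σ∞
    f∈Σ∞ x = Equivalence.from (onto (f x)) (x , K.≋-refl)

    Σ∞⇒f : ∀ {X} → X K.∈span Σ∞ → ∃[ x ] f x K.≋ X
    Σ∞⇒f {X} = Equivalence.to (onto X)

    -- An `L`-linear bijection of L² permutes the points of PG(1,L), so the spread keeps its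
    -- description after f is precomposed with it.
    change-basis : ∀ {u v} → L.LinearlyIndependent (u ∷ v ∷ []) → IsDesarguesian ι Σ∞ S
    change-basis {u} {v} independent = record
      { f = f ∘ h
      ; cong = λ p → f-cong (H.≋-cong p)
      ; homo-+ = λ x y → K.≋-trans (f-cong (H.+-homo x y)) (f-+ _ _)
      ; homo-· = λ c x → K.≋-trans (f-cong (H.·-homo ⟦ c ⟧ x)) (f-· c _)
      ; injective = λ eq → L.combination-injective {b = u ∷ v ∷ []} independent (f-injective eq)
      ; onto = λ X → mk⇔
          (λ X∈ → let (x , eq) = Equivalence.to (onto X) X∈ in I.from x , K.≋-trans (f-cong (I.to∘from x)) eq)
          (λ { (y , eq) → Equivalence.from (onto X) (h y , eq) })
      ; lines = λ m → mk⇔ (λ m∈S → to m (Equivalence.to (lines m) m∈S)) (from m)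
      }
      where
      h : L.Vec 2 → L.Vec 2
      h y = L.combination y (u ∷ v ∷ [])
      I : L.LinearIso 2
      I = L.basisIso {b = u ∷ v ∷ []} independent
      module I = L.LinearIso I
      module H = L.IsLinear I.to-isLinear
      to : ∀ m → ∃[ Q ] K.⟪ m ⟫ ≐ reduce ι f Q → ∃[ Q ] K.⟪ m ⟫ ≐ reduce ι (f ∘ h) Q
      to m ((x , x≉0) , ⊆ , ⊇) = (I.from x , λ y≋0 → x≉0 (L.≋-trans (L.≋-sym (I.to∘from x)) (H.0-homo y≋0))) ,
        (λ {X} X∈ → let (c , eq) = ⊆ {X} X∈ in c , K.≋-trans eq (K.≋-sym (same c))) ,
        (λ { {X} (c , eq) → ⊇ {X} (c , K.≋-trans eq (same c)) })
        where
        same : ∀ c → f (h (c L.· I.from x)) K.≋ f (c L.· x)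
        same c = f-cong (L.≋-trans (H.·-homo c (I.from x)) (L.·-cong L.refl (I.to∘from x)))
      from : ∀ m → ∃[ Q ] K.⟪ m ⟫ ≐ reduce ι (f ∘ h) Q → m ∈ S
      from m ((y , y≉0) , ⊆ , ⊇) = Equivalence.from (lines m)
        ((h y , λ hy≋0 → y≉0 (independent y hy≋0)) ,
         (λ {X} X∈ → let (c , eq) = ⊆ {X} X∈ in c , K.≋-trans eq (f-cong (H.·-homo c y))) ,
         (λ { {X} (c , eq) → ⊇ {X} (c , K.≋-trans eq (K.≋-sym (f-cong (H.·-homo c y)))) }))

    -- Along an `L`-direction u each coordinate of π ∘ f is a `K`-linear form on `L`, which opens
    -- the way to `functional≈Im`.
    component-functional : ∀ {π : K.Vec 5 → K.Vec 4} → K.IsLinear π → ∀ u i → IsFunctional (λ z → π (f (z L.· u)) i)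
    component-functional {π} P u i = record
      { h-cong = λ z≈w → P.≋-cong (f-cong (L.·-cong z≈w L.≋-refl)) i
      ; h-+ = λ z w → K.trans (P.≋-cong (K.≋-trans (f-cong (λ j → L.distribʳ _ _ _)) (f-+ _ _)) i) (P.+-homo _ _ i)
      ; h-· = λ k z → K.trans (P.≋-cong (K.≋-trans (f-cong (λ j → L.*-assoc _ _ _)) (f-· k _)) i) (P.·-homo _ _ i)
      }
      where
      module P = K.IsLinear P

  e₂ : L.Point 1
  e₂ = (L.0# ∷ L.1# ∷ []) , λ eq → L.1≉0 (eq 1F)

  -- The vector `w` lies over the ovoid point (1,0,0,0) and serves as origin of the affine plane.
  -- With `π-f` it gives w + f x the projection (1, Im x₀, Re x₀, Im x₁), so lying on the cone
  -- becomes the equation of a graph.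
  record NormalForm (Σ∞ : K.Flat 3 4) (S : Pred (K.Line 4) 0ℓ) (C : Pred (K.Point 4) 0ℓ) : Set where
    field
      desarguesian : IsDesarguesian ι Σ∞ S
    open Desarguesian desarguesian public
    field
      π          : K.Vec 5 → K.Vec 4
      π-isLinear : K.IsLinear π
      Σ∞⇒        : ∀ {X} → X K.∈span Σ∞ → π X 0F K.≈ K.0#
      ⇒Σ∞        : ∀ {X} → π X 0F K.≈ K.0# → X K.∈span Σ∞
      cone⇒      : ∀ X → X ∈ C → π (proj₁ X) K.≋ K.0ᵥ ⊎ K.Tits (π (proj₁ X))
      ⇒cone      : ∀ X → π (proj₁ X) K.≋ K.0ᵥ ⊎ K.Tits (π (proj₁ X)) → X ∈ C
      π-f        : ∀ x → π (f x) K.≋ (K.0# ∷ Im (x 0F) ∷ Re (x 0F) ∷ Im (x 1F) ∷ [])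
      w          : K.Vec 5
      π-w        : π w K.≋ (K.1# ∷ K.0# ∷ K.0# ∷ K.0# ∷ [])
      at-Σ∞      : C ∩ K.⟪ Σ∞ ⟫ ≐ reduce ι f e₂

  1<q : 1 ℕ.< 2 ℕ.^ (2 ℕ.* e ℕ.+ 1)
  1<q = ℕ.^-monoʳ-< 2 ℕ.≤-refl {0} {2 ℕ.* e ℕ.+ 1} (ℕ.m≤n+m 1 (2 ℕ.* e))

  module Normalisation
    (Σ∞ : K.Flat 3 4) (S : Pred (K.Line 4) 0ℓ) (D : IsDesarguesian ι Σ∞ S)
    (C : Pred (K.Point 4) 0ℓ) (V : K.Point 4) (P₀ : ConeProjection e K C (proj₁ V))
    (m : K.Line 4) (m∈S : m ∈ S) (C∩Σ∞≐m : C ∩ K.⟪ Σ∞ ⟫ ≐ K.⟪ m ⟫) where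

    open Desarguesian D

    private
      b : Vector (K.Vec 5) 4
      b = proj₁ Σ∞
      w₀ : K.Vec 5
      w₀ = proj₁ (K.complement 1<q Σ∞)
      independent : K.LinearlyIndependent (w₀ ∷ b)
      independent = K.independent-∷ {b = b} {v = w₀} (proj₂ Σ∞) (proj₂ (K.complement 1<q Σ∞))
      open K.Coordinates {b = w₀ ∷ b} independent

    -- A linear form with kernel Σ∞.
    ht : K.Vec 5 → K.Carrier
    ht X = coords X zero

    ht-cong : ∀ {X Y} → X K.≋ Y → ht X K.≈ ht Y
    ht-cong eq = K.IsLinear.≋-cong coords-isLinear eq zero

    ht-+ : ∀ X Y → ht (X K.+ᵥ Y) K.≈ ht X K.+ ht Y
    ht-+ X Y = K.IsLinear.+-homo coords-isLinear X Y zero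

    ht-· : ∀ c X → ht (c K.· X) K.≈ c K.* ht X
    ht-· c X = K.IsLinear.·-homo coords-isLinear c X zero

    ht≈0⇒ : ∀ {X} → ht X K.≈ K.0# → X K.∈span Σ∞
    ht≈0⇒ {X} eq = coords X ∘ suc , λ i → K.trans (K.sym (combination-coords X i))
      (K.trans (K.+-congʳ (K.trans (K.*-congʳ eq) (K.zeroˡ _))) (K.+-identityˡ _))

    ⇒ht≈0 : ∀ {X} → X K.∈span Σ∞ → ht X K.≈ K.0#
    ⇒ht≈0 {X} (a , eq) = coords-unique {K.0# ∷ a} {X} (λ i → K.trans (K.trans (K.+-congʳ (K.zeroˡ _)) (K.+-identityˡ _)) (K.sym (eq i))) zero

    ht-f : ∀ x → ht (f x) K.≈ K.0#
    ht-f x = ⇒ht≈0 (f∈Σ∞ x)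

    ht-w₀ : ht w₀ K.≈ K.1#
    ht-w₀ = coords-unique {K.1# ∷ K.0ᵥ} {w₀} (λ i → K.trans (K.+-cong (K.*-identityˡ _) (K.combination-0 b K.≋-refl i)) (K.+-identityʳ _)) zero

    private
      m-reduced : ∃[ Q ] K.⟪ m ⟫ ≐ reduce ι f Q
      m-reduced = Equivalence.to (lines m) m∈S
      x : L.Vec 2
      x = proj₁ (proj₁ m-reduced)
      module P₀ = ConeProjection P₀
      module π₀ = K.IsLinear P₀.π-isLinear
      V₀ : K.Vec 5
      V₀ = proj₁ V

    C∩Σ∞⇒m : ∀ X → X ∈ C → ht (proj₁ X) K.≈ K.0# → ∃[ c ] proj₁ X K.≋ f (c L.· x)
    C∩Σ∞⇒m X X∈C hX≈0 = proj₁ (proj₂ m-reduced) {X} (proj₁ C∩Σ∞≐m {X} (X∈C , ht≈0⇒ hX≈0))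

    m⇒C : ∀ X c → proj₁ X K.≋ f (c L.· x) → X ∈ C
    m⇒C X c eq = proj₁ (proj₂ C∩Σ∞≐m {X} (proj₂ (proj₂ m-reduced) {X} (c , eq)))

    -- Otherwise C would meet Σ∞ in a copy of the ovoid, but the line m contains
    -- with the points (0,0,0,1) and (1,0,0,0) also (1,0,0,1).
    ht-V≈0 : ht V₀ K.≈ K.0#
    ht-V≈0 = cases (ht V₀ K.≟ K.0#)
      where
      cases : Dec (ht V₀ K.≈ K.0#) → ht V₀ K.≈ K.0#
      cases (yes eq) = eq
      cases (no hV≉0) = ⊥-elim (impossible (P₀.cone⇒ XY XY∈C))
        where
        o : K.Vec 4
        o = K.1# ∷ K.0# ∷ K.0# ∷ K.0# ∷ []
        -- A lift of z, moved along the vertex into Σ∞ without changing its projection; this is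
        -- possible because V is off Σ∞.
        adjust : K.Vec 4 → K.Vec 5
        adjust z = P₀.lift z K.+ᵥ (ht (P₀.lift z) K.* K.inv hV≉0) K.· V₀
        ht-adjust : ∀ z → ht (adjust z) K.≈ K.0#
        ht-adjust z = K.trans (ht-+ (P₀.lift z) _) (K.trans (K.+-congˡ (K.trans (ht-· (ht (P₀.lift z) K.* K.inv hV≉0) V₀) (K.trans (K.*-assoc _ _ _)
          (K.trans (K.*-congˡ (K.inv-* hV≉0)) (K.*-identityʳ _))))) (K.x+x≈0 _))
        π-adjust : ∀ z → P₀.π (adjust z) K.≋ z
        π-adjust z i = K.trans (π₀.+-homo (P₀.lift z) _ i) (K.trans (K.+-cong (P₀.π-lift z i)
          (K.trans (π₀.·-homo (ht (P₀.lift z) K.* K.inv hV≉0) V₀ i) (K.trans (K.*-congˡ (P₀.π-vertex i)) (K.zeroʳ _)))) (K.+-identityʳ _))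
        point : ∀ z → ¬ (z K.≋ K.0ᵥ) → K.Point 4
        point z z≉0 = adjust z , λ eq → z≉0 (K.≋-trans (K.≋-sym (π-adjust z)) (π₀.0-homo eq))
        adjust∈m : ∀ z → K.Tits z → ∃[ c ] adjust z K.≋ f (c L.· x)
        adjust∈m z t = C∩Σ∞⇒m Z (P₀.⇒cone Z (inj₂ (K.Tits-resp (K.∝-refl (π-adjust z)) t))) (ht-adjust z)
          where
          Z : K.Point 4
          Z = point z (Tits⇒≉0 e K t)
        X∈m : ∃[ c ] adjust K.p∞ K.≋ f (c L.· x)
        X∈m = adjust∈m K.p∞ (inj₁ (K.∝-refl K.≋-refl))
        Y∈m : ∃[ c ] adjust o K.≋ f (c L.· x)
        Y∈m = adjust∈m o (K.Tits-affine K.refl (K.sym K.F-00))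
        π-XY : P₀.π (adjust K.p∞ K.+ᵥ adjust o) K.≋ (K.p∞ K.+ᵥ o)
        π-XY = K.≋-trans (π₀.+-homo (adjust K.p∞) (adjust o)) (K.+ᵥ-cong (π-adjust K.p∞) (π-adjust o))
        XY≉0 : ¬ (P₀.π (adjust K.p∞ K.+ᵥ adjust o) K.≋ K.0ᵥ)
        XY≉0 eq = K.1≉0 (K.trans (K.sym (K.+-identityˡ K.1#)) (K.trans (K.sym (π-XY 0F)) (eq 0F)))
        XY : K.Point 4
        XY = adjust K.p∞ K.+ᵥ adjust o , λ eq → XY≉0 (π₀.0-homo eq)
        XY∈C : XY ∈ C
        XY∈C = m⇒C XY (proj₁ X∈m L.+ proj₁ Y∈m) (K.≋-trans (K.+ᵥ-cong (proj₂ X∈m) (proj₂ Y∈m))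
          (K.≋-trans (K.≋-sym (f-+ _ _)) (f-cong (λ i → L.sym (L.distribʳ _ _ _)))))
        impossible : P₀.π (proj₁ XY) K.≋ K.0ᵥ ⊎ K.Tits (P₀.π (proj₁ XY)) → ⊥
        impossible (inj₁ eq) = XY≉0 eq
        impossible (inj₂ t) = K.1≉0 (K.trans (K.sym (K.+-identityʳ K.1#)) (K.trans (K.Tits-affine⁻¹ {K.p∞ K.+ᵥ o} (K.+-identityˡ K.1#)
          (K.Tits-resp (K.∝-refl (K.≋-sym π-XY)) t))
          (K.trans (K.F-cong (K.+-identityˡ K.0#) (K.+-identityˡ K.0#)) K.F-00)))

    private
      V∈m : ∃[ c ] V₀ K.≋ f (c L.· x)
      V∈m = C∩Σ∞⇒m V (P₀.⇒cone V (inj₁ P₀.π-vertex)) ht-V≈0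
      c₀ : L.Carrier
      c₀ = proj₁ V∈m

    -- Represents the vertex itself, not merely the spread line through it: f v = V, and C ∩ Σ∞
    -- consists of the points f (l v).
    v : L.Vec 2
    v = c₀ L.· x

    V≋fv : V₀ K.≋ f v
    V≋fv = proj₂ V∈m

    v≉0 : ¬ (v L.≋ L.0ᵥ)
    v≉0 v≋0 = proj₂ V (K.≋-trans V≋fv (f-0 v≋0))

    c₀≉0 : c₀ L.≉ L.0#
    c₀≉0 c₀≈0 = v≉0 (λ i → L.trans (L.*-congʳ c₀≈0) (L.zeroˡ _))

    C∩Σ∞⇒Lv : ∀ X → X ∈ C → ht (proj₁ X) K.≈ K.0# → ∃[ l ] proj₁ X K.≋ f (l L.· v)
    C∩Σ∞⇒Lv X X∈C hX = let (c , eq) = C∩Σ∞⇒m X X∈C hX in c L.* L.inv c₀≉0 , K.≋-trans eq (f-cong λ i →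
      L.sym (L.trans (L.*-assoc _ _ _) (L.*-congˡ (L.inv-*∙ c₀≉0 (x i)))))

    Lv⇒C : ∀ X l → proj₁ X K.≋ f (l L.· v) → X ∈ C
    Lv⇒C X l eq = m⇒C X (l L.* c₀) (K.≋-trans eq (f-cong λ i → L.sym (L.*-assoc _ _ _)))

    ·v≋0⇒ : ∀ {l} → (l L.· v) L.≋ L.0ᵥ → l L.≈ L.0#
    ·v≋0⇒ {l} eq = cases (l L.≟ L.0#)
      where
      cases : Dec (l L.≈ L.0#) → l L.≈ L.0#
      cases (yes l≈0) = l≈0
      cases (no l≉0) = ⊥-elim (v≉0 λ i → L.*-zero⇒ l≉0 (eq i))

    1·v : (L.1# L.· v) L.≋ v
    1·v i = L.*-identityˡ _

    -- With the vertex it spans the spread line C ∩ Σ∞, so its projection is the ovoid point below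
    -- that line.
    fωv : K.Point 4
    fωv = f (ω L.· v) , λ eq → ω∉K (K.0# , L.trans ⟦⟧-0 (L.sym (·v≋0⇒ (f≋0⇒ eq))))

    module _ (P : ConeProjection e K C V₀) where
      open ConeProjection P

      π-fωv≉0 : ¬ (π (f (ω L.· v)) K.≋ K.0ᵥ)
      π-fωv≉0 eq = ω∉K (proj₁ ker , L.sym (L.+≈0⇒≈ (·v≋0⇒ (λ i → L.trans (L.distribʳ _ _ _) (L.≈⇒+≈0 (ωv≋ i))))))
        where
        ker : ∃[ k ] f (ω L.· v) K.≋ k K.· V₀
        ker = π-kernel _ eq
        ωv≋ : (ω L.· v) L.≋ (⟦ proj₁ ker ⟧ L.· v)
        ωv≋ = f-injective (K.≋-trans (proj₂ ker) (K.≋-trans (K.·-cong K.refl V≋fv) (K.≋-sym (f-· (proj₁ ker) v))))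

      π-f1v : π (f (L.1# L.· v)) K.≋ K.0ᵥ
      π-f1v = K.≋-trans (K.IsLinear.≋-cong π-isLinear (K.≋-trans (f-cong 1·v) (K.≋-sym V≋fv))) π-vertex

      -- The real part of z contributes a multiple of the vertex, which π kills.
      π-fzv : ∀ z → π (f (z L.· v)) K.≋ (Im z K.· π (f (ω L.· v)))
      π-fzv z i = K.trans (IsFunctional.expand (component-functional π-isLinear v i) z)
        (K.trans (K.+-congʳ (K.trans (K.*-congˡ (π-f1v i)) (K.zeroʳ _))) (K.+-identityˡ _))

    private
      abstract
        moved : Σ[ I ∈ K.LinearIso 4 ] K.IsSymmetry I × K.LinearIso.to I (P₀.π (proj₁ fωv)) K.∝ K.p∞
        moved = K.Tits-transitive (tits (P₀.cone⇒ fωv (Lv⇒C fωv ω K.≋-refl)))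
          where
          tits : P₀.π (proj₁ fωv) K.≋ K.0ᵥ ⊎ K.Tits (P₀.π (proj₁ fωv)) → K.Tits (P₀.π (proj₁ fωv))
          tits (inj₁ eq) = ⊥-elim (π-fωv≉0 P₀ eq)
          tits (inj₂ t) = t

      P₁ : ConeProjection e K C V₀
      P₁ = transform e K (proj₁ moved) (proj₁ (proj₂ moved)) P₀
      module P₁ = ConeProjection P₁
      module π₁ = K.IsLinear P₁.π-isLinear

      π₁-fωv : P₁.π (f (ω L.· v)) K.∝ K.p∞
      π₁-fωv = proj₂ (proj₂ moved)
      c₁ : K.Carrier
      c₁ = proj₁ π₁-fωv

      π₁-fωv-0 : ∀ i → K.p∞ i K.≈ K.0# → P₁.π (f (ω L.· v)) i K.≈ K.0#
      π₁-fωv-0 i eq = K.trans (proj₂ (proj₂ π₁-fωv) i) (K.trans (K.*-congˡ eq) (K.zeroʳ _))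

      -- The form that ht induces on the quotient by the vertex.
      μ : K.Vec 4 → K.Carrier
      μ z = ht (P₁.lift z)

      μ-cong : ∀ {y z} → y K.≋ z → μ y K.≈ μ z
      μ-cong eq = ht-cong (K.IsLinear.≋-cong P₁.lift-isLinear eq)

      -- X and `lift (π X)` differ by a multiple of the vertex, where `ht` vanishes.
      ht≈μπ : ∀ X → ht X K.≈ μ (P₁.π X)
      ht≈μπ X = K.+≈0⇒≈ (K.trans (K.sym (ht-+ _ _)) (K.trans (ht-cong (proj₂ ker))
        (K.trans (ht-· _ _) (K.trans (K.*-congˡ ht-V≈0) (K.zeroʳ _)))))
        where
        ker : ∃[ k ] X K.+ᵥ P₁.lift (P₁.π X) K.≋ k K.· V₀
        ker = P₁.π-kernel (X K.+ᵥ P₁.lift (P₁.π X)) (λ i →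
          K.trans (π₁.+-homo X (P₁.lift (P₁.π X)) i)
            (K.trans (K.+-congˡ (P₁.π-lift (P₁.π X) i)) (K.x+x≈0 (P₁.π X i))))

      e₄ : Fin 4 → K.Vec 4
      e₄ = K.unit

      μ-expand : ∀ z → μ z K.≈ z 0F K.* μ (e₄ 0F) K.+ (z 1F K.* μ (e₄ 1F) K.+ (z 2F K.* μ (e₄ 2F) K.+ (z 3F K.* μ (e₄ 3F) K.+ K.0#)))
      μ-expand z = K.trans (μ-cong (K.≋-sym (K.combination-unit z)))
        (K.IsLinear.combination-homo (K.∘-isLinear coords-isLinear P₁.lift-isLinear) z e₄ zero)

      μ₃≈0 : μ (e₄ 3F) K.≈ K.0#
      μ₃≈0 = K.*-zero⇒ (proj₁ (proj₂ π₁-fωv)) (begin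
        c₁ K.* μ (e₄ 3F)             ≈⟨ μ-· ⟨
        μ (c₁ K.· e₄ 3F)             ≈⟨ μ-cong (K.≋-trans (proj₂ (proj₂ π₁-fωv)) (K.·-cong K.refl p∞≋)) ⟨
        μ (P₁.π (f (ω L.· v)))       ≈⟨ ht≈μπ _ ⟨
        ht (f (ω L.· v))             ≈⟨ ht-f _ ⟩
        K.0#                         ∎)
        where
        open import Relation.Binary.Reasoning.Setoid K.setoid
        p∞≋ : K.p∞ K.≋ e₄ 3F
        p∞≋ = λ { 0F → K.refl ; 1F → K.refl ; 2F → K.refl ; 3F → K.refl }
        μ-· : μ (c₁ K.· e₄ 3F) K.≈ c₁ K.* μ (e₄ 3F)
        μ-· = K.IsLinear.·-homo (K.∘-isLinear coords-isLinear P₁.lift-isLinear) c₁ (e₄ 3F) zero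

      -- The plane at infinity is tangent to the ovoid, so it contains no affine point of it.
      no-affine : ∀ s t → ¬ (μ (K.1# ∷ s ∷ t ∷ K.F s t ∷ []) K.≈ K.0#)
      no-affine s t eq = K.1≉0 (begin
        K.1#                             ≈⟨ P₁.π-lift z 0F ⟨
        P₁.π (P₁.lift z) 0F              ≈⟨ π₁.≋-cong (proj₂ Lv) 0F ⟩
        P₁.π (f (proj₁ Lv L.· v)) 0F     ≈⟨ π-fzv P₁ (proj₁ Lv) 0F ⟩
        Im (proj₁ Lv) K.* P₁.π (f (ω L.· v)) 0F  ≈⟨ K.*-congˡ (π₁-fωv-0 0F K.refl) ⟩
        Im (proj₁ Lv) K.* K.0#           ≈⟨ K.zeroʳ _ ⟩
        K.0#                             ∎)
        where
        open import Relation.Binary.Reasoning.Setoid K.setoid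
        z : K.Vec 4
        z = K.1# ∷ s ∷ t ∷ K.F s t ∷ []
        X : K.Point 4
        X = P₁.lift z , λ eq → K.1≉0 (K.trans (K.sym (P₁.π-lift z 0F)) (π₁.0-homo eq 0F))
        Lv : ∃[ l ] P₁.lift z K.≋ f (l L.· v)
        Lv = C∩Σ∞⇒Lv X (P₁.⇒cone X (inj₂ (K.Tits-resp (K.∝-refl (P₁.π-lift z)) (K.Tits-affine K.refl K.refl)))) eq

      -- If not, s = μ₀ / μ₁ makes the affine ovoid point with parameters (s , 0) a zero of μ, its
      -- last coordinate having coefficient 0; this contradicts `no-affine`.
      μ₁≈0 : μ (e₄ 1F) K.≈ K.0#
      μ₁≈0 = cases (μ (e₄ 1F) K.≟ K.0#)
        where
        cases : Dec (μ (e₄ 1F) K.≈ K.0#) → μ (e₄ 1F) K.≈ K.0#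
        cases (yes eq) = eq
        cases (no neq) = ⊥-elim (no-affine s K.0# (K.trans (μ-expand _) (K.by₂ (K.1#) (K.F s K.0#)
            (solve 6 (λ m₀ m₁ m₂ m₃ s F → (con true :* m₀ :+ (s :* m₁ :+ (con false :* m₂ :+ (F :* m₃ :+ con false)))) :+ con false
              := con true :* (s :* m₁ :+ m₀) :+ F :* (m₃ :+ con false)) K.refl (μ (e₄ 0F)) (μ (e₄ 1F)) (μ (e₄ 2F)) (μ (e₄ 3F)) s (K.F s K.0#))
            (K.trans (K.*-comm _ _) (K.*-inv∙ neq _)) μ₃≈0)))
          where
          open K using (solve; _:=_; _:+_; _:*_; con)
          s : K.Carrier
          s = K.inv neq K.* μ (e₄ 0F)

      μ₂≈0 : μ (e₄ 2F) K.≈ K.0#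
      μ₂≈0 = cases (μ (e₄ 2F) K.≟ K.0#)
        where
        cases : Dec (μ (e₄ 2F) K.≈ K.0#) → μ (e₄ 2F) K.≈ K.0#
        cases (yes eq) = eq
        cases (no neq) = ⊥-elim (no-affine K.0# t (K.trans (μ-expand _) (K.by₂ (K.1#) (K.F K.0# t)
            (solve 6 (λ m₀ m₁ m₂ m₃ t F → (con true :* m₀ :+ (con false :* m₁ :+ (t :* m₂ :+ (F :* m₃ :+ con false)))) :+ con false
              := con true :* (t :* m₂ :+ m₀) :+ F :* (m₃ :+ con false)) K.refl (μ (e₄ 0F)) (μ (e₄ 1F)) (μ (e₄ 2F)) (μ (e₄ 3F)) t (K.F K.0# t))
            (K.trans (K.*-comm _ _) (K.*-inv∙ neq _)) μ₃≈0)))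
          where
          open K using (solve; _:=_; _:+_; _:*_; con)
          t : K.Carrier
          t = K.inv neq K.* μ (e₄ 0F)

      ht≈ : ∀ X → ht X K.≈ P₁.π X 0F K.* μ (e₄ 0F)
      ht≈ X = K.trans (ht≈μπ X) (K.trans (μ-expand (P₁.π X)) (K.by₃ (P₁.π X 1F) (P₁.π X 2F) (P₁.π X 3F)
        (solve 8 (λ m₀ m₁ m₂ m₃ x y z w → (x :* m₀ :+ (y :* m₁ :+ (z :* m₂ :+ (w :* m₃ :+ con false)))) :+ x :* m₀
           := y :* (m₁ :+ con false) :+ z :* (m₂ :+ con false) :+ w :* (m₃ :+ con false))
           K.refl (μ (e₄ 0F)) (μ (e₄ 1F)) (μ (e₄ 2F)) (μ (e₄ 3F)) (P₁.π X 0F) (P₁.π X 1F) (P₁.π X 2F) (P₁.π X 3F))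
        μ₁≈0 μ₂≈0 μ₃≈0))
        where
        open K using (solve; _:=_; _:+_; _:*_; con)

      μ₀≉0 : μ (e₄ 0F) K.≉ K.0#
      μ₀≉0 eq = K.1≉0 (K.trans (K.sym ht-w₀) (K.trans (ht≈ w₀) (K.trans (K.*-congˡ eq) (K.zeroʳ _))))

      Σ∞⇒π₁≈0 : ∀ {X} → X K.∈span Σ∞ → P₁.π X 0F K.≈ K.0#
      Σ∞⇒π₁≈0 {X} X∈ = K.*-zero⇒ μ₀≉0 (K.trans (K.*-comm _ _) (K.trans (K.sym (ht≈ X)) (⇒ht≈0 X∈)))

      π₁≈0⇒Σ∞ : ∀ {X} → P₁.π X 0F K.≈ K.0# → X K.∈span Σ∞
      π₁≈0⇒Σ∞ {X} eq = ht≈0⇒ (K.trans (ht≈ X) (K.trans (K.*-congʳ eq) (K.zeroˡ _)))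

      Σ∞⇒π₁f : ∀ z → z 0F K.≈ K.0# → ∃[ y ] P₁.π (f y) K.≋ z
      Σ∞⇒π₁f z z₀≈0 = proj₁ fy , K.≋-trans (π₁.≋-cong (proj₂ fy)) (P₁.π-lift z)
        where
        fy : ∃[ y ] f y K.≋ P₁.lift z
        fy = Σ∞⇒f (π₁≈0⇒Σ∞ (K.trans (P₁.π-lift z 0F) z₀≈0))

      abstract
        complement : ∃[ u ] L.LinearlyIndependent (u ∷ v ∷ [])
        complement = cases (v 0F L.≟ L.0#)
          where
          cases : Dec (v 0F L.≈ L.0#) → ∃[ u ] L.LinearlyIndependent (u ∷ v ∷ [])
          cases (yes v₀≈0) = u , L.independent-pair {v = u} {w = v} (λ eq → L.1≉0 (eq 0F)) v≉0
              λ { (c , _ , eq) → L.1≉0 (L.trans (eq 0F) (L.trans (L.*-congˡ v₀≈0) (L.zeroʳ c))) }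
            where
            u : L.Vec 2
            u = L.1# ∷ L.0# ∷ []
          cases (no v₀≉0) = u , L.independent-pair {v = u} {w = v} (λ eq → L.1≉0 (eq 1F)) v≉0
              λ { (c , c≉0 , eq) → L.*-≉0 c≉0 v₀≉0 (L.sym (eq 0F)) }
            where
            u : L.Vec 2
            u = L.0# ∷ L.1# ∷ []

      u : L.Vec 2
      u = proj₁ complement

      spanned : ∀ y → ∃[ z ] ∃[ z′ ] y L.≋ (z L.· u) L.+ᵥ (z′ L.· v)
      spanned y = let (a , eq) = L.basis-spans {b = u ∷ v ∷ []} (proj₂ complement) y in
        a 0F , a 1F , λ i → L.trans (L.sym (eq i)) (L.+-congˡ (L.+-identityʳ _))

      π₁f-spanned : ∀ y z z′ → y L.≋ (z L.· u) L.+ᵥ (z′ L.· v) → ∀ i → K.p∞ i K.≈ K.0# →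
                    P₁.π (f y) i K.≈ P₁.π (f (z L.· u)) i
      π₁f-spanned y z z′ eq i p∞i≈0 = begin
        P₁.π (f y) i
          ≈⟨ π₁.≋-cong (K.≋-trans (f-cong eq) (f-+ (z L.· u) (z′ L.· v))) i ⟩
        P₁.π (f (z L.· u) K.+ᵥ f (z′ L.· v)) i
          ≈⟨ π₁.+-homo (f (z L.· u)) (f (z′ L.· v)) i ⟩
        P₁.π (f (z L.· u)) i K.+ P₁.π (f (z′ L.· v)) i
          ≈⟨ K.+-congˡ (K.trans (π-fzv P₁ z′ i) (K.trans (K.*-congˡ (π₁-fωv-0 i p∞i≈0)) (K.zeroʳ (Im z′)))) ⟩
        P₁.π (f (z L.· u)) i K.+ K.0#   ≈⟨ K.+-identityʳ _ ⟩
        P₁.π (f (z L.· u)) i            ∎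
        where
        open import Relation.Binary.Reasoning.Setoid K.setoid

      component₁ : ∃[ d ] ∀ z → P₁.π (f (z L.· u)) 1F K.≈ Im (d L.* z)
      component₁ = functional≈Im (component-functional P₁.π-isLinear u 1F)

      d : L.Carrier
      d = proj₁ component₁

      -- The direction v affects only the last coordinate, so with d = 0 the vector (0,1,0,0) would
      -- have no preimage in L².
      d≉0 : d L.≉ L.0#
      d≉0 d≈0 = K.1≉0 (begin
        K.1#                        ≈⟨ proj₂ preimage 1F ⟨
        P₁.π (f y) 1F               ≈⟨ π₁f-spanned y z z′ (proj₂ (proj₂ (spanned y))) 1F K.refl ⟩
        P₁.π (f (z L.· u)) 1F       ≈⟨ proj₂ component₁ z ⟩
        Im (d L.* z)                ≈⟨ Im-cong (L.trans (L.*-congʳ d≈0) (L.trans (L.zeroˡ z) (L.sym ⟦⟧-0))) ⟩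
        Im ⟦ K.0# ⟧                 ≈⟨ Im-⟦⟧ K.0# ⟩
        K.0#                        ∎)
        where
        open import Relation.Binary.Reasoning.Setoid K.setoid
        preimage : ∃[ y ] P₁.π (f y) K.≋ (K.0# ∷ K.1# ∷ K.0# ∷ K.0# ∷ [])
        preimage = Σ∞⇒π₁f (K.0# ∷ K.1# ∷ K.0# ∷ K.0# ∷ []) K.refl
        y : L.Vec 2
        y = proj₁ preimage
        z z′ : L.Carrier
        z = proj₁ (spanned y)
        z′ = proj₁ (proj₂ (spanned y))

      -- Absorbs `d` into the basis vector, turning coordinate 1 into Im.
      u₁ : L.Vec 2
      u₁ = L.inv d≉0 L.· u

      π₁fu₁-1 : ∀ z → P₁.π (f (z L.· u₁)) 1F K.≈ Im z
      π₁fu₁-1 z = K.trans (π₁.≋-cong (f-cong (λ i → L.sym (L.*-assoc z (L.inv d≉0) (u i)))) 1F)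
        (K.trans (proj₂ component₁ (z L.* L.inv d≉0)) (Im-cong (L.trans (L.*-congˡ (L.*-comm z _)) (L.*-inv∙ d≉0 z))))

      r n : K.Carrier
      r = P₁.π (f (L.1# L.· u₁)) 2F
      n = P₁.π (f (ω L.· u₁)) 2F

      π₁fu₁-2 : ∀ z → P₁.π (f (z L.· u₁)) 2F K.≈ Re z K.* r K.+ Im z K.* n
      π₁fu₁-2 z = IsFunctional.expand (component-functional P₁.π-isLinear u₁ 2F) z

      -- A preimage of (0,0,1,0) has u₁-coefficient t with Im t = 0, so its coordinate 2 is Re t r,
      -- which has to be 1.
      r≉0 : r K.≉ K.0#
      r≉0 r≈0 = K.1≉0 (begin
        K.1#                              ≈⟨ π₁f≈ 2F K.refl ⟩
        P₁.π (f (t L.· u₁)) 2F            ≈⟨ π₁fu₁-2 t ⟩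
        Re t K.* r K.+ Im t K.* n
          ≈⟨ K.+-cong (K.*-congˡ r≈0) (K.*-congʳ (K.trans (K.sym (π₁fu₁-1 t)) (K.sym (π₁f≈ 1F K.refl)))) ⟩
        Re t K.* K.0# K.+ K.0# K.* n      ≈⟨ K.+-cong (K.zeroʳ _) (K.zeroˡ _) ⟩
        K.0# K.+ K.0#                     ≈⟨ K.+-identityˡ _ ⟩
        K.0#                              ∎)
        where
        open import Relation.Binary.Reasoning.Setoid K.setoid
        p : K.Vec 4
        p = K.0# ∷ K.0# ∷ K.1# ∷ K.0# ∷ []
        preimage : ∃[ y ] P₁.π (f y) K.≋ p
        preimage = Σ∞⇒π₁f p K.refl
        y : L.Vec 2
        y = proj₁ preimage
        z z′ t : L.Carrier
        z = proj₁ (spanned y)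
        z′ = proj₁ (proj₂ (spanned y))
        t = z L.* d
        π₁f≈ : ∀ i → K.p∞ i K.≈ K.0# → p i K.≈ P₁.π (f (t L.· u₁)) i
        π₁f≈ i eq = K.trans (K.sym (proj₂ preimage i)) (K.trans (π₁f-spanned y z z′ (proj₂ (proj₂ (spanned y))) i eq)
          (π₁.≋-cong (f-cong λ j → L.sym (L.trans (L.*-assoc z d _) (L.*-congˡ (L.*-inv∙ d≉0 (u j))))) i))

      -- After the dilation by k, the translation by a, and division of u₁ by k, coordinate 2 is φ k
      -- r Re z + (φ k n + φ a) Im z, while coordinate 1 remains Im z. The parameters solve φ k r =
      -- 1 and φ a = φ k n.
      k a : K.Carrier
      k = proj₁ (K.φ-root (K.inv r≉0))
      φkr≈1 : K.φ k K.* r K.≈ K.1#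
      φkr≈1 = K.trans (K.*-congʳ (proj₂ (K.φ-root (K.inv r≉0)))) (K.inv-* r≉0)
      k≉0 : k K.≉ K.0#
      k≉0 k≈0 = K.1≉0 (K.trans (K.sym φkr≈1) (K.trans (K.*-congʳ (K.trans (K.φ-cong k≈0) K.φ-0)) (K.zeroˡ r)))
      a = proj₁ (K.φ-root (K.φ k K.* n))
      φa≈φkn : K.φ a K.≈ K.φ k K.* n
      φa≈φkn = proj₂ (K.φ-root (K.φ k K.* n))

      P₂ : ConeProjection e K C V₀
      P₂ = transform e K (K.translation a K.0#) (K.translation-isSymmetry a K.0#)
             (transform e K (K.scaling k≉0) (K.scaling-isSymmetry k≉0) P₁)
      module P₂ = ConeProjection P₂
      module π₂ = K.IsLinear P₂.π-isLinear

      u₂ : L.Vec 2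
      u₂ = ⟦ K.inv k≉0 ⟧ L.· u₁

      π₁fu₂ : ∀ z → P₁.π (f (z L.· u₂)) K.≋ (K.inv k≉0 K.· P₁.π (f (z L.· u₁)))
      π₁fu₂ z = K.≋-trans (π₁.≋-cong (K.≋-trans (f-cong {y = ⟦ K.inv k≉0 ⟧ L.· (z L.· u₁)}
          (λ i → L.solve 3 (λ z k u → z L.:* (k L.:* u) L.:= k L.:* (z L.:* u)) L.refl z ⟦ K.inv k≉0 ⟧ (u₁ i)))
          (f-· (K.inv k≉0) (z L.· u₁))))
        (π₁.·-homo (K.inv k≉0) (f (z L.· u₁)))

      π₁f-0 : ∀ x → P₁.π (f x) 0F K.≈ K.0#
      π₁f-0 x = Σ∞⇒π₁≈0 (f∈Σ∞ x)

      π₁fu₂-1 : ∀ z → k K.* P₁.π (f (z L.· u₂)) 1F K.≈ Im z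
      π₁fu₂-1 z = K.trans (K.*-congˡ (π₁fu₂ z 1F)) (K.trans (K.*-inv∙ k≉0 _) (π₁fu₁-1 z))

      π₂fu₂-1 : ∀ z → P₂.π (f (z L.· u₂)) 1F K.≈ Im z
      π₂fu₂-1 z = K.trans (K.+-cong (π₁fu₂-1 z) (K.trans (K.*-congˡ (π₁f-0 (z L.· u₂))) (K.zeroʳ a))) (K.+-identityʳ _)

      π₂fu₂-2 : ∀ z → P₂.π (f (z L.· u₂)) 2F K.≈ Re z
      π₂fu₂-2 z = begin
        k K.* K.φ k K.* π₁fzu₂ 2F K.+ K.φ a K.* (k K.* π₁fzu₂ 1F) K.+ K.0# K.* π₁fzu₂ 0F
          ≈⟨ K.+-cong (K.+-cong middle (K.*-cong φa≈φkn (π₁fu₂-1 z))) (K.zeroˡ _) ⟩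
        K.φ k K.* (Re z K.* r K.+ Im z K.* n) K.+ (K.φ k K.* n) K.* Im z K.+ K.0#
          ≈⟨ K.by₁ (Re z) (solve 5 (λ φk r n x y → (φk :* (x :* r :+ y :* n) :+ (φk :* n) :* y :+ con false) :+ x
               := x :* (φk :* r :+ con true)) K.refl (K.φ k) r n (Re z) (Im z)) φkr≈1 ⟩
        Re z ∎
        where
        open import Relation.Binary.Reasoning.Setoid K.setoid
        open K using (solve; _:=_; _:+_; _:*_; con)
        π₁fzu₂ : K.Vec 4
        π₁fzu₂ = P₁.π (f (z L.· u₂))
        middle : k K.* K.φ k K.* π₁fzu₂ 2F K.≈ K.φ k K.* (Re z K.* r K.+ Im z K.* n)
        middle = K.trans (K.*-cong (K.*-comm k (K.φ k)) (π₁fu₂ z 2F)) (K.trans (K.*-assoc (K.φ k) k _)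
          (K.*-congˡ (K.trans (K.*-inv∙ k≉0 _) (π₁fu₁-2 z))))

      -- The dilation and the translation that lead to `P₂` both fix `p∞`, so f (ω v) still lies
      -- over it.
      π₂fωv-0 : ∀ i → K.p∞ i K.≈ K.0# → P₂.π (f (ω L.· v)) i K.≈ K.0#
      π₂fωv-0 0F _ = π₁f-0 (ω L.· v)
      π₂fωv-0 1F _ = K.trans (K.+-cong (K.*-congˡ (π₁-fωv-0 1F K.refl)) (K.*-congˡ (π₁-fωv-0 0F K.refl)))
        (K.solve 2 (λ k a → k K.:* K.con false K.:+ a K.:* K.con false K.:= K.con false) K.refl k a)
      π₂fωv-0 2F _ = K.trans (K.+-cong (K.+-cong (K.*-congˡ (π₁-fωv-0 2F K.refl))
          (K.*-congˡ (K.*-congˡ (π₁-fωv-0 1F K.refl)))) (K.zeroˡ _))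
        (K.solve 3 (λ l k a → l K.:* K.con false K.:+ a K.:* (k K.:* K.con false) K.:+ K.con false K.:= K.con false)
          K.refl (k K.* K.φ k) k (K.φ a))
      π₂fωv-0 3F 1≈0 = ⊥-elim (K.1≉0 1≈0)

      c : K.Carrier
      c = P₂.π (f (ω L.· v)) 3F

      c≉0 : c K.≉ K.0#
      c≉0 c≈0 = π-fωv≉0 P₂ λ
        { 0F → π₂fωv-0 0F K.refl ; 1F → π₂fωv-0 1F K.refl ; 2F → π₂fωv-0 2F K.refl ; 3F → c≈0 }

    -- The factor comes from `K`, so it commutes with Im and normalises the last coordinate of f (z
    -- v₁) to Im z.
    v₁ : L.Vec 2
    v₁ = ⟦ K.inv c≉0 ⟧ L.· v

    private
      π₂fv₁ : ∀ z → P₂.π (f (z L.· v₁)) K.≋ (K.0# ∷ K.0# ∷ K.0# ∷ Im z ∷ [])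
      π₂fv₁ z = K.≋-trans (π₂.≋-cong (f-cong λ i → L.sym (L.*-assoc z ⟦ K.inv c≉0 ⟧ (v i))))
        (K.≋-trans (π-fzv P₂ (z L.* ⟦ K.inv c≉0 ⟧)) (λ { 0F → vanish 0F K.refl ; 1F → vanish 1F K.refl ; 2F → vanish 2F K.refl ; 3F →
          K.trans (K.*-congʳ (K.trans (Im-cong (L.*-comm z _)) (Im-· (K.inv c≉0) z)))
            (K.trans (K.*-congʳ (K.*-comm _ _)) (K.trans (K.*-assoc _ _ _) (K.trans (K.*-congˡ (K.inv-* c≉0)) (K.*-identityʳ _)))) }))
        where
        vanish : ∀ i → K.p∞ i K.≈ K.0# → Im (z L.* ⟦ K.inv c≉0 ⟧) K.* P₂.π (f (ω L.· v)) i K.≈ K.0#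
        vanish i eq = K.trans (K.*-congˡ (π₂fωv-0 i eq)) (K.zeroʳ _)

      component₃ : ∃[ d ] ∀ z → P₂.π (f (z L.· u₂)) 3F K.≈ Im (d L.* z)
      component₃ = functional≈Im (component-functional P₂.π-isLinear u₂ 3F)

      d₃ : L.Carrier
      d₃ = proj₁ component₃

    -- The last coordinate along u₂ is Im (d₃ z), the same as along d₃ v₁; adding the two clears it
    -- in characteristic 2.
    u₃ : L.Vec 2
    u₃ = u₂ L.+ᵥ (d₃ L.· v₁)

    private
      π₂fu₃ : ∀ z → P₂.π (f (z L.· u₃)) K.≋ (K.0# ∷ Im z ∷ Re z ∷ K.0# ∷ [])
      π₂fu₃ z = K.≋-trans sum λ
        { 0F → K.trans (K.+-cong (π₁f-0 (z L.· u₂)) (π₂fv₁ _ 0F)) (K.+-identityˡ _)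
        ; 1F → K.trans (K.+-cong (π₂fu₂-1 z) (π₂fv₁ _ 1F)) (K.+-identityʳ _)
        ; 2F → K.trans (K.+-cong (π₂fu₂-2 z) (π₂fv₁ _ 2F)) (K.+-identityʳ _)
        ; 3F → K.trans (K.+-cong (proj₂ component₃ z) (K.trans (π₂fv₁ _ 3F) (Im-cong (L.*-comm z d₃)))) (K.x+x≈0 _) }
        where
        sum : P₂.π (f (z L.· u₃)) K.≋ (P₂.π (f (z L.· u₂)) K.+ᵥ P₂.π (f ((z L.* d₃) L.· v₁)))
        sum = K.≋-trans (π₂.≋-cong (K.≋-trans (f-cong {y = (z L.· u₂) L.+ᵥ ((z L.* d₃) L.· v₁)}
            (λ i → L.trans (L.distribˡ z _ _) (L.+-congˡ (L.sym (L.*-assoc z d₃ (v₁ i))))))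
            (f-+ (z L.· u₂) ((z L.* d₃) L.· v₁)))) (π₂.+-homo (f (z L.· u₂)) (f ((z L.* d₃) L.· v₁)))

      h : L.Vec 2 → L.Vec 2
      h y = L.combination y (u₃ ∷ v₁ ∷ [])

      π₂fh : ∀ y → P₂.π (f (h y)) K.≋ (K.0# ∷ Im (y 0F) ∷ Re (y 0F) ∷ Im (y 1F) ∷ [])
      π₂fh y = K.≋-trans sum λ
        { 0F → K.trans (K.+-cong (π₂fu₃ (y 0F) 0F) (π₂fv₁ (y 1F) 0F)) (K.+-identityʳ _)
        ; 1F → K.trans (K.+-cong (π₂fu₃ (y 0F) 1F) (π₂fv₁ (y 1F) 1F)) (K.+-identityʳ _)
        ; 2F → K.trans (K.+-cong (π₂fu₃ (y 0F) 2F) (π₂fv₁ (y 1F) 2F)) (K.+-identityʳ _)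
        ; 3F → K.trans (K.+-cong (π₂fu₃ (y 0F) 3F) (π₂fv₁ (y 1F) 3F)) (K.+-identityˡ _) }
        where
        sum : P₂.π (f (h y)) K.≋ (P₂.π (f (y 0F L.· u₃)) K.+ᵥ P₂.π (f (y 1F L.· v₁)))
        sum = K.≋-trans (π₂.≋-cong (K.≋-trans (f-cong {y = (y 0F L.· u₃) L.+ᵥ (y 1F L.· v₁)}
            (λ i → L.+-congˡ (L.+-identityʳ _)))
            (f-+ (y 0F L.· u₃) (y 1F L.· v₁)))) (π₂.+-homo (f (y 0F L.· u₃)) (f (y 1F L.· v₁)))

      Re-Im≈0⇒ : ∀ {z} → Re z K.≈ K.0# → Im z K.≈ K.0# → z L.≈ L.0#
      Re-Im≈0⇒ {z} Re≈0 Im≈0 = L.trans (L.sym (Re+Imω z)) (L.trans (L.+-cong (L.trans (⟦⟧-cong Re≈0) ⟦⟧-0)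
        (L.trans (L.*-congʳ (L.trans (⟦⟧-cong Im≈0) ⟦⟧-0)) (L.zeroˡ ω))) (L.+-identityʳ _))

      ·v₁≋0⇒ : ∀ {l} → (l L.· v₁) L.≋ L.0ᵥ → l L.≈ L.0#
      ·v₁≋0⇒ {l} eq = L.*-zero⇒ c⁻¹≉0 (L.trans (L.*-comm _ l)
          (·v≋0⇒ (λ i → L.trans (L.*-assoc l _ _) (eq i))))
        where
        c⁻¹≉0 : ⟦ K.inv c≉0 ⟧ L.≉ L.0#
        c⁻¹≉0 eq = K.inv≉0 c≉0 (⟦⟧-injective (L.trans eq (L.sym ⟦⟧-0)))

      u₃v₁-independent : L.LinearlyIndependent (u₃ ∷ v₁ ∷ [])
      u₃v₁-independent y eq = λ { 0F → y₀≈0 ; 1F → ·v₁≋0⇒ y₁v₁≋0 }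
        where
        π₂fh≈0 : P₂.π (f (h y)) K.≋ K.0ᵥ
        π₂fh≈0 = π₂.0-homo (f-0 eq)
        y₀≈0 : y 0F L.≈ L.0#
        y₀≈0 = Re-Im≈0⇒ (K.trans (K.sym (π₂fh y 2F)) (π₂fh≈0 2F)) (K.trans (K.sym (π₂fh y 1F)) (π₂fh≈0 1F))
        y₁v₁≋0 : (y 1F L.· v₁) L.≋ L.0ᵥ
        y₁v₁≋0 i = L.trans (L.sym (L.trans (L.+-cong (L.trans (L.*-congʳ y₀≈0) (L.zeroˡ _)) (L.+-identityʳ _)) (L.+-identityˡ _))) (eq i)

      h-e₂ : ∀ l → h (l L.· proj₁ e₂) L.≋ (l L.· v₁)
      h-e₂ l i = L.trans (L.+-cong (L.trans (L.*-congʳ (L.zeroʳ l)) (L.zeroˡ _)) (L.trans (L.+-identityʳ _) (L.*-congʳ (L.*-identityʳ l)))) (L.+-identityˡ _)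

    normalForm : NormalForm Σ∞ S C
    normalForm = record
      { desarguesian = change-basis u₃v₁-independent
      ; π = P₂.π
      ; π-isLinear = P₂.π-isLinear
      ; Σ∞⇒ = Σ∞⇒π₁≈0
      ; ⇒Σ∞ = π₁≈0⇒Σ∞
      ; cone⇒ = P₂.cone⇒
      ; ⇒cone = P₂.⇒cone
      ; π-f = π₂fh
      ; w = P₂.lift (K.1# ∷ K.0# ∷ K.0# ∷ K.0# ∷ [])
      ; π-w = P₂.π-lift (K.1# ∷ K.0# ∷ K.0# ∷ K.0# ∷ [])
      ; at-Σ∞ = (λ {X} (X∈C , X∈Σ∞) → let (l , eq) = C∩Σ∞⇒Lv X X∈C (⇒ht≈0 X∈Σ∞) in
                   l L.* ⟦ c ⟧ , K.≋-trans eq (f-cong λ i → L.sym (L.trans (h-e₂ (l L.* ⟦ c ⟧) i) (cancel l i))))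
              , (λ {X} (l , eq) → Lv⇒C X (l L.* ⟦ K.inv c≉0 ⟧) (K.≋-trans eq (f-cong λ i → L.trans (h-e₂ l i) (L.sym (L.*-assoc _ _ _))))
                   , Equivalence.from (onto (proj₁ X)) (h (l L.· proj₁ e₂) , K.≋-sym eq))
      }
      where
      cancel : ∀ l i → (l L.* ⟦ c ⟧) L.* v₁ i L.≈ l L.* v i
      cancel l i = L.trans (L.*-assoc l ⟦ c ⟧ (v₁ i)) (L.*-congˡ (L.trans (L.sym (L.*-assoc ⟦ c ⟧ ⟦ K.inv c≉0 ⟧ (v i)))
        (L.trans (L.*-congʳ (L.trans (L.sym (⟦⟧-* c (K.inv c≉0))) (L.trans (⟦⟧-cong (K.*-inv c≉0)) ⟦⟧-1))) (L.*-identityˡ (v i)))))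

-- Collinearity in the plane through determinants.

module Collinearity {q : ℕ} (L : FiniteField q) (1+1≈0 : Characteristic2 L) where
  open FiniteField L hiding (zero)
  open FieldProperties L
  open Char2 L 1+1≈0
  open Solver using (solve; _:=_; _:+_; _:*_; con)
  open Projective L
  open LinearAlgebra L

  Collinear : Vec 3 → Vec 3 → Vec 3 → Set
  Collinear u v z = Σ[ ℓ ∈ Vector (Vec 3) 2 ]
    (∃[ a ] u ≋ combination a ℓ) × (∃[ a ] v ≋ combination a ℓ) × (∃[ a ] z ≋ combination a ℓ)

  -- The 3 × 3 determinant, whose signs disappear in characteristic 2.
  det : Vec 3 → Vec 3 → Vec 3 → Carrier
  det u v z = u 0F * (v 1F * z 2F + v 2F * z 1F) + u 1F * (v 0F * z 2F + v 2F * z 0F) + u 2F * (v 0F * z 1F + v 1F * z 0F)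

  det-cong : ∀ {u u′ v v′ z z′} → u ≋ u′ → v ≋ v′ → z ≋ z′ → det u v z ≈ det u′ v′ z′
  det-cong u v z = +-cong (+-cong (*-cong (u 0F) (+-cong (*-cong (v 1F) (z 2F)) (*-cong (v 2F) (z 1F))))
      (*-cong (u 1F) (+-cong (*-cong (v 0F) (z 2F)) (*-cong (v 2F) (z 0F)))))
    (*-cong (u 2F) (+-cong (*-cong (v 0F) (z 1F)) (*-cong (v 1F) (z 0F))))

  collinear⇒det≈0 : ∀ {u v z} → Collinear u v z → det u v z ≈ 0#
  collinear⇒det≈0 (ℓ , (a , u≋) , (b , v≋) , (c , z≋)) = trans (det-cong u≋ v≋ z≋)
    (solve 12 (λ a₀ a₁ b₀ b₁ c₀ c₁ x₀ x₁ x₂ y₀ y₁ y₂ →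
       let u₀ = a₀ :* x₀ :+ (a₁ :* y₀ :+ con false) ; u₁ = a₀ :* x₁ :+ (a₁ :* y₁ :+ con false) ; u₂ = a₀ :* x₂ :+ (a₁ :* y₂ :+ con false)
           v₀ = b₀ :* x₀ :+ (b₁ :* y₀ :+ con false) ; v₁ = b₀ :* x₁ :+ (b₁ :* y₁ :+ con false) ; v₂ = b₀ :* x₂ :+ (b₁ :* y₂ :+ con false)
           z₀ = c₀ :* x₀ :+ (c₁ :* y₀ :+ con false) ; z₁ = c₀ :* x₁ :+ (c₁ :* y₁ :+ con false) ; z₂ = c₀ :* x₂ :+ (c₁ :* y₂ :+ con false)
       in u₀ :* (v₁ :* z₂ :+ v₂ :* z₁) :+ u₁ :* (v₀ :* z₂ :+ v₂ :* z₀) :+ u₂ :* (v₀ :* z₁ :+ v₁ :* z₀) := con false)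
     refl (a 0F) (a 1F) (b 0F) (b 1F) (c 0F) (c 1F) (ℓ 0F 0F) (ℓ 0F 1F) (ℓ 0F 2F) (ℓ 1F 0F) (ℓ 1F 1F) (ℓ 1F 2F))

  private
    span-linear-∝ : ∀ {g : Vec 3 → Vec 3} → IsLinear g → ∀ {ℓ : Vector (Vec 3) 2} {u u′} → u′ ∝ g u →
                    ∃[ a ] u ≋ combination a ℓ → ∃[ a ] u′ ≋ combination a (g ∘ ℓ)
    span-linear-∝ {g} G {ℓ} {u} (c , _ , u′≋) (a , u≋) = c · a , ≋-trans u′≋ (≋-trans (·-cong refl (≋-trans (≋-cong u≋) (combination-homo a ℓ)))
        (≋-sym (combination-· c a (g ∘ ℓ))))
      where
      open IsLinear G

  collinear-map : ∀ {g : Vec 3 → Vec 3} → IsLinear g → ∀ {u v z u′ v′ z′} → u′ ∝ g u → v′ ∝ g v → z′ ∝ g z →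
                  Collinear u v z → Collinear u′ v′ z′
  collinear-map {g} G p q r (ℓ , a , b , c) = g ∘ ℓ , span-linear-∝ G {ℓ = ℓ} p a , span-linear-∝ G {ℓ = ℓ} q b , span-linear-∝ G {ℓ = ℓ} r c

-- Coordinates for the isomorphism of the two planes.

module Coordinatisation (e : ℕ) (K : FiniteField (2 ℕ.^ (2 ℕ.* e ℕ.+ 1)))
  (L : FiniteField ((2 ℕ.^ (2 ℕ.* e ℕ.+ 1)) ℕ.^ 2)) (ι : FieldEmbedding K L) where

  open QuadraticExtension e K L ι
  open NormalForms e K L ι

  module Model {Σ∞ : K.Flat 3 4} {S : Pred (K.Line 4) 0ℓ} {C : Pred (K.Point 4) 0ℓ}
    (N : NormalForm Σ∞ S C) (model : AndréBruckBose.plane K Σ∞ S ≅ PG2 L) where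

    open NormalForm N
    open AndréBruckBose K Σ∞ S
    open Collinearity L L-1+1≈0

    private
      module π = K.IsLinear π-isLinear
      module plane = IncidenceStructure plane
      module points = Setoid plane.points
      module onPoints = Inverse (_≅_.onPoints model)
      module onLines = Inverse (_≅_.onLines model)

    πf₀ : ∀ x → π (f x) 0F K.≈ K.0#
    πf₀ x = Σ∞⇒ (f∈Σ∞ x)

    affine : L.Vec 2 → K.Vec 5
    affine x = w K.+ᵥ f x

    π-affine₀ : ∀ x → π (affine x) 0F K.≈ K.1#
    π-affine₀ x = K.trans (π.+-homo w (f x) 0F) (K.trans (K.+-cong (π-w 0F) (πf₀ x)) (K.+-identityʳ _))

    affine∉Σ∞ : ∀ x → ¬ (affine x K.∈span Σ∞)
    affine∉Σ∞ x x∈ = K.1≉0 (K.trans (K.sym (π-affine₀ x)) (Σ∞⇒ x∈))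

    affine≉0 : ∀ x → ¬ (affine x K.≋ K.0ᵥ)
    affine≉0 x eq = K.1≉0 (K.trans (K.sym (π-affine₀ x)) (π.0-homo eq 0F))

    P : L.Vec 2 → AffinePoint
    P x = (affine x , affine≉0 x) , affine∉Σ∞ x

    ⟦_,_⟧ω : K.Carrier → K.Carrier → L.Carrier
    ⟦ a , b ⟧ω = ⟦ a ⟧ L.+ ⟦ b ⟧ L.* ω

    -- As 1 , ω is a `K`-basis of `L`, the vectors f d and f (ω d) span the spread line of direction
    -- d.
    combination-f : ∀ a d → K.combination a (f d ∷ f (ω L.· d) ∷ []) K.≋ f (⟦ a 0F , a 1F ⟧ω L.· d)
    combination-f a d i = K.trans (K.+-congˡ (K.+-identityʳ _)) (K.sym (K.trans
      (f-cong {y = (⟦ a 0F ⟧ L.· d) L.+ᵥ (⟦ a 1F ⟧ L.· (ω L.· d))} (λ j → L.trans (L.distribʳ (d j) _ _) (L.+-congˡ (L.*-assoc _ _ _))) i)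
      (K.trans (f-+ (⟦ a 0F ⟧ L.· d) (⟦ a 1F ⟧ L.· (ω L.· d)) i)
        (K.+-cong (f-· (a 0F) d i) (f-· (a 1F) (ω L.· d) i)))))

    module Direction (d : L.Vec 2) (d≉0 : ¬ (d L.≋ L.0ᵥ)) where

      ·d≋0⇒ : ∀ {l} → (l L.· d) L.≋ L.0ᵥ → l L.≈ L.0#
      ·d≋0⇒ {l} eq = cases (l L.≟ L.0#)
        where
        cases : Dec (l L.≈ L.0#) → l L.≈ L.0#
        cases (yes l≈0) = l≈0
        cases (no l≉0) = ⊥-elim (d≉0 λ i → L.*-zero⇒ l≉0 (eq i))

      basis : Vector (K.Vec 5) 2
      basis = f d ∷ f (ω L.· d) ∷ []

      independent : K.LinearlyIndependent basis
      independent a eq = λ { 0F → proj₁ zeros ; 1F → proj₂ zeros }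
        where
        zeros : a 0F K.≈ K.0# × a 1F K.≈ K.0#
        zeros = ∉K-independent ω∉K (L.trans (·d≋0⇒ (f≋0⇒ (K.≋-trans (K.≋-sym (combination-f a d)) eq)))
          (L.sym (L.trans (L.+-cong ⟦⟧-0 (L.trans (L.*-congʳ ⟦⟧-0) (L.zeroˡ ω))) (L.+-identityˡ _))))

      line : K.Line 4
      line = basis , independent

      line≐ : K.⟪ line ⟫ ≐ reduce ι f (d , d≉0)
      line≐ = (λ (a , eq) → ⟦ a 0F , a 1F ⟧ω , K.≋-trans eq (combination-f a d))
            , (λ (c , eq) → Re c ∷ Im c ∷ [] , K.≋-trans eq (K.≋-trans (f-cong λ i → L.*-congʳ (L.sym (Re+Imω c)))
                 (K.≋-sym (combination-f (Re c ∷ Im c ∷ []) d))))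

      line∈S : line ∈ S
      line∈S = Equivalence.from (lines line) ((d , d≉0) , line≐)

      D : SpreadLine
      D = line , line∈S

      module Through (x : L.Vec 2) where

        affine∉line : ¬ (∃[ a ] affine x K.≋ K.combination a basis)
        affine∉line (a , eq) = affine∉Σ∞ x (Equivalence.from (onto (affine x))
          (⟦ a 0F , a 1F ⟧ω L.· d , K.≋-sym (K.≋-trans eq (combination-f a d))))

        -- Spans the plane of PG(4,K) that represents the affine line x + L d of L².
        planeBasis : Vector (K.Vec 5) 3
        planeBasis = affine x ∷ basis

        flat : K.Plane 4
        flat = planeBasis , K.independent-∷ {b = basis} independent affine∉line

        combination-plane : ∀ a → K.combination a planeBasis K.≋ (a 0F K.· affine x) K.+ᵥ f (⟦ a 1F , a 2F ⟧ω L.· d)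
        combination-plane a i = K.+-congˡ (combination-f (a ∘ suc) d i)

        isAffinePlane : IsAffinePlane flat
        isAffinePlane = (λ ⊆Σ∞ → affine∉Σ∞ x (⊆Σ∞ {affine x , affine≉0 x} affine∈)) , line , line∈S , (λ {X} → meet {X}) , (λ {X} → join {X})
          where
          affine∈ : affine x K.∈span flat
          affine∈ = K.1# ∷ K.0ᵥ , λ i → K.sym (K.trans (K.+-cong (K.*-identityˡ _) (K.combination-0 basis K.≋-refl i)) (K.+-identityʳ _))
          meet : K.⟪ flat ⟫ ∩ K.⟪ Σ∞ ⟫ ⊆ K.⟪ line ⟫
          meet {X , _} ((a , eq) , X∈Σ∞) = a ∘ suc , λ i → K.trans (eq i)
            (K.trans (K.+-congʳ (K.trans (K.*-congʳ a₀≈0) (K.zeroˡ _))) (K.+-identityˡ _))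
            where
            a₀≈0 : a 0F K.≈ K.0#
            a₀≈0 = K.trans (K.sym (K.trans (π.≋-cong (K.≋-trans eq (combination-plane a)) 0F)
              (K.trans (π.+-homo (a 0F K.· affine x) (f (⟦ a 1F , a 2F ⟧ω L.· d)) 0F)
                (K.trans (K.+-cong (K.trans (π.·-homo (a 0F) (affine x) 0F) (K.*-congˡ (π-affine₀ x))) (πf₀ _))
                  (K.trans (K.+-identityʳ _) (K.*-identityʳ _)))))) (Σ∞⇒ X∈Σ∞)
          join : K.⟪ line ⟫ ⊆ K.⟪ flat ⟫ ∩ K.⟪ Σ∞ ⟫
          join {X , _} (a , eq) = (K.0# ∷ a , λ i → K.trans (eq i) (K.sym (K.trans (K.+-congʳ (K.zeroˡ _)) (K.+-identityˡ _)))) ,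
            Equivalence.from (onto X) (⟦ a 0F , a 1F ⟧ω L.· d , K.≋-sym (K.≋-trans eq (combination-f a d)))

        affinePlane : AffinePlane
        affinePlane = flat , isAffinePlane

        P∈ : ∀ y l → y L.≋ (x L.+ᵥ (l L.· d)) → affine y K.∈span flat
        P∈ y l y≋ = K.1# ∷ Re l ∷ Im l ∷ [] , λ i → K.sym (K.trans (combination-plane (K.1# ∷ Re l ∷ Im l ∷ []) i)
          (K.trans (K.+-cong (K.*-identityˡ _) (f-cong (λ j → L.*-congʳ (Re+Imω l)) i))
          (K.trans (K.+-assoc _ _ _) (K.+-congˡ (K.trans (K.sym (f-+ x (l L.· d) i)) (f-cong (λ j → L.sym (y≋ j)) i))))))

        D⊆ : K.⟪ line ⟫ ⊆ K.⟪ flat ⟫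
        D⊆ {X} (a , eq) = K.0# ∷ a , λ i → K.trans (eq i) (K.sym (K.trans (K.+-congʳ (K.zeroˡ _)) (K.+-identityˡ _)))

    span-+ : ∀ {k} (F : K.Flat k 4) {X Y} → X K.∈span F → Y K.∈span F → (X K.+ᵥ Y) K.∈span F
    span-+ F (a , X≋) (b , Y≋) = a K.+ᵥ b , K.≋-trans (K.+ᵥ-cong X≋ Y≋) (K.≋-sym (K.combination-+ a b (proj₁ F)))

    -- The plane meets Σ∞ in a single spread line, so both y and z are `L`-multiples of one vector
    -- q. The product form also covers zero vectors.
    parallel : ∀ {F} → IsAffinePlane F → ∀ y z → f y K.∈span F → f z K.∈span F → y 0F L.* z 1F L.≈ y 1F L.* z 0F
    parallel {F} (_ , m , m∈S , F∩Σ∞⊆m , _) y z fy∈ fz∈ = cases (vec-0? (f y)) (vec-0? (f z))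
      where
      Q : ∃[ Q ] K.⟪ m ⟫ ≐ reduce ι f Q
      Q = Equivalence.to (lines m) m∈S
      q : L.Vec 2
      q = proj₁ (proj₁ Q)
      multiple : ∀ y → f y K.∈span F → Dec (f y K.≋ K.0ᵥ) → ∃[ c ] y L.≋ (c L.· q)
      multiple y _ (yes fy≋0) = L.0# , λ i → L.trans (f≋0⇒ fy≋0 i) (L.sym (L.zeroˡ _))
      multiple y fy∈ (no fy≉0) = let (c , eq) = proj₁ (proj₂ Q) {f y , fy≉0} (F∩Σ∞⊆m {f y , fy≉0} (fy∈ , f∈Σ∞ y)) in
        c , f-injective eq
      vec-0? : ∀ X → Dec (X K.≋ K.0ᵥ)
      vec-0? X = finite⇒decidable (vectors-finite K.order 5) X K.0ᵥ
      cases : Dec (f y K.≋ K.0ᵥ) → Dec (f z K.≋ K.0ᵥ) → y 0F L.* z 1F L.≈ y 1F L.* z 0F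
      cases dy dz = let (c , y≋) = multiple y fy∈ dy ; (c′ , z≋) = multiple z fz∈ dz in
        L.trans (L.*-cong (y≋ 0F) (z≋ 1F)) (L.trans
          (L.solve 4 (λ c c′ p r → (c L.:* p) L.:* (c′ L.:* r) L.:= (c L.:* r) L.:* (c′ L.:* p)) L.refl c c′ (q 0F) (q 1F))
          (L.sym (L.*-cong (y≋ 1F) (z≋ 0F))))

    private
      e₁ e₂ᵥ 𝟙 𝟘 : L.Vec 2
      e₁ = L.1# ∷ L.0# ∷ []
      e₂ᵥ = proj₁ e₂
      𝟙 = L.1# ∷ L.1# ∷ []
      𝟘 = L.0# ∷ L.0# ∷ []

    slope : L.Carrier → L.Vec 2
    slope m = L.1# ∷ m ∷ []

    slope≉0 : ∀ m → ¬ (slope m L.≋ L.0ᵥ)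
    slope≉0 m eq = L.1≉0 (eq 0F)

    module Slope (m : L.Carrier) = Direction (slope m) (slope≉0 m)
    module Vertical = Direction e₂ᵥ (proj₂ e₂)
    module Horizontal = Slope L.0#

    image-vector : AffinePoint ⊎ SpreadLine → L.Vec 3
    image-vector A = proj₁ (onPoints.to A)

    image≉0 : ∀ A → ¬ (image-vector A L.≋ L.0ᵥ)
    image≉0 A = proj₂ (onPoints.to A)

    image-injective : ∀ A B → image-vector A L.∝ image-vector B → A points.≈ B
    image-injective A B eq = points.trans (points.sym (onPoints.inverseʳ {A} {onPoints.to A} (L.∝-refl L.≋-refl)))
      (onPoints.inverseʳ {B} {onPoints.to A} eq)

    images-collinear : ∀ ℓ A B Z → A plane.I ℓ → B plane.I ℓ → Z plane.I ℓ →
                       Collinear (image-vector A) (image-vector B) (image-vector Z)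
    images-collinear ℓ A B Z A∈ B∈ Z∈ = proj₁ (onLines.to ℓ) ,
      Equivalence.to (_≅_.incidence model A ℓ) A∈ ,
      Equivalence.to (_≅_.incidence model B ℓ) B∈ ,
      Equivalence.to (_≅_.incidence model Z ℓ) Z∈

    -- The line through two images is itself the image of a line, so dependences in PG(2,L) can be
    -- pulled back. This is how the images of the frame inherit general position.
    reflect : ∀ A B Z → L.LinearlyIndependent (image-vector A ∷ image-vector B ∷ []) →
              (∃[ a ] image-vector Z L.≋ L.combination a (image-vector A ∷ image-vector B ∷ [])) →
              ∃[ ℓ ] A plane.I ℓ × B plane.I ℓ × Z plane.I ℓ
    reflect A B Z independent Z∈ = ℓ ,
        on A (L.1# ∷ L.0# ∷ [] , λ i → L.sym (L.trans (L.+-cong (L.*-identityˡ _) (L.trans (L.+-identityʳ _) (L.zeroˡ _))) (L.+-identityʳ _))) ,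
        on B (L.0# ∷ L.1# ∷ [] , λ i → L.sym (L.trans (L.+-cong (L.zeroˡ _) (L.trans (L.+-identityʳ _) (L.*-identityˡ _))) (L.+-identityˡ _))) ,
        on Z Z∈
      where
      ℓ′ : L.Line 2
      ℓ′ = (image-vector A ∷ image-vector B ∷ []) , independent
      ℓ : Setoid.Carrier plane.lines
      ℓ = onLines.from ℓ′
      on : ∀ X → image-vector X L.∈span ℓ′ → X plane.I ℓ
      on X X∈ = Equivalence.from (_≅_.incidence model X ℓ)
        (proj₂ (onLines.inverseˡ {ℓ′} {ℓ} (Setoid.refl plane.lines {ℓ})) {onPoints.to X} X∈)

    line∋fd : ∀ d d≉0 → f d K.∈span Direction.line d d≉0
    line∋fd d d≉0 = proj₂ (Direction.line≐ d d≉0) {f d , λ eq → d≉0 (f≋0⇒ eq)} (L.1# , f-cong λ i → L.sym (L.*-identityˡ _))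

    private
      P𝟘 P𝟙 D₁ D₂ : AffinePoint ⊎ SpreadLine
      P𝟘 = inj₁ (P 𝟘)
      P𝟙 = inj₁ (P 𝟙)
      D₁ = inj₂ Horizontal.D
      D₂ = inj₂ Vertical.D

    triangle : ∀ ℓ x → D₁ plane.I ℓ → D₂ plane.I ℓ → ¬ (inj₁ (P x) plane.I ℓ)
    triangle (inj₁ tt) x _ _ ()
    triangle (inj₂ (F , isAffine)) x D₁⊆ D₂⊆ _ = L.1≉0 (L.trans (L.sym (L.*-identityˡ L.1#))
      (L.trans (parallel {F} isAffine e₁ e₂ᵥ (D₁⊆ {f e₁ , λ eq → slope≉0 L.0# (f≋0⇒ eq)} (line∋fd e₁ (slope≉0 L.0#)))
                                             (D₂⊆ {f e₂ᵥ , λ eq → proj₂ e₂ (f≋0⇒ eq)} (line∋fd e₂ᵥ (proj₂ e₂))))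
        (L.zeroˡ L.0#)))

    secant : ∀ ℓ x y d d≉0 → inj₁ (P x) plane.I ℓ → inj₁ (P y) plane.I ℓ → inj₂ (Direction.D d d≉0) plane.I ℓ →
             (x 0F L.+ y 0F) L.* d 1F L.≈ (x 1F L.+ y 1F) L.* d 0F
    secant (inj₁ tt) x y d d≉0 ()
    secant (inj₂ (F , isAffine)) x y d d≉0 Px∈ Py∈ D⊆ = parallel {F} isAffine (x L.+ᵥ y) d
      (let (a , eq) = span-+ F Px∈ Py∈ in a , λ i → K.trans (sum i) (eq i))
      (D⊆ {f d , λ eq → d≉0 (f≋0⇒ eq)} (line∋fd d d≉0))
      where
      -- The two copies of the origin `w` cancel in characteristic 2, so the sum of two affine
      -- points of the plane is a point at infinity or zero.
      sum : f (x L.+ᵥ y) K.≋ affine x K.+ᵥ affine y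
      sum i = K.trans (f-+ x y i) (K.solve 3 (λ w x y → x K.:+ y K.:= (w K.:+ x) K.:+ (w K.:+ y)) K.refl (w i) (f x i) (f y i))

    private
      A₀ A₁ A₂ E : L.Vec 3
      A₀ = image-vector P𝟘
      A₁ = image-vector D₁
      A₂ = image-vector D₂
      E = image-vector P𝟙

      A₁A₂-independent : L.LinearlyIndependent (A₁ ∷ A₂ ∷ [])
      A₁A₂-independent = L.independent-pair {v = A₁} {w = A₂} (image≉0 D₁) (image≉0 D₂) λ eq → distinct (image-injective D₁ D₂ eq)
        where
        distinct : ¬ (D₁ points.≈ D₂)
        distinct (inj₂ (⊆ , _)) = let (c , eq) = proj₁ Vertical.line≐ {pt} (⊆ {pt} (line∋fd e₁ (slope≉0 L.0#))) in
          L.1≉0 (L.trans (f-injective eq 0F) (L.zeroʳ c))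
          where
          pt : K.Point 4
          pt = f e₁ , λ eq → slope≉0 L.0# (f≋0⇒ eq)

      affine-infinite-independent : ∀ A B → L.LinearlyIndependent (image-vector (inj₁ A) ∷ image-vector (inj₂ B) ∷ [])
      affine-infinite-independent A B = L.independent-pair {v = image-vector (inj₁ A)} {w = image-vector (inj₂ B)}
          (image≉0 (inj₁ A)) (image≉0 (inj₂ B)) λ eq → distinct (image-injective (inj₁ A) (inj₂ B) eq)
        where
        distinct : ¬ (inj₁ A points.≈ inj₂ B)
        distinct ()

      affine∉A₁A₂ : ∀ x → ¬ (∃[ a ] image-vector (inj₁ (P x)) L.≋ L.combination a (A₁ ∷ A₂ ∷ []))
      affine∉A₁A₂ x x∈ = let (ℓ , D₁∈ , D₂∈ , x∈ℓ) = reflect D₁ D₂ (inj₁ (P x)) A₁A₂-independent x∈ in triangle ℓ x D₁∈ D₂∈ x∈ℓ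

      A : Vector (L.Vec 3) 3
      A = A₀ ∷ A₁ ∷ A₂ ∷ []

      A-independent : L.LinearlyIndependent A
      A-independent = L.independent-∷ {b = A₁ ∷ A₂ ∷ []} {v = A₀} A₁A₂-independent (affine∉A₁A₂ 𝟘)

      abstract
        E-coordinates : ∃[ ε ] L.combination ε A L.≋ E
        E-coordinates = L.basis-spans {b = A} A-independent E

      ε : L.Vec 3
      ε = proj₁ E-coordinates

      E≋ : L.combination ε A L.≋ E
      E≋ = proj₂ E-coordinates

      -- A vanishing coordinate would put the image of the unit point on a side of the image
      -- triangle, and `reflect` would carry this back to the unit point and a side of the original
      -- triangle.
      ε₀≉0 : ε 0F L.≉ L.0#
      ε₀≉0 eq = affine∉A₁A₂ 𝟙 (ε ∘ suc , λ i → L.trans (L.sym (E≋ i))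
        (L.trans (L.+-congʳ (L.trans (L.*-congʳ eq) (L.zeroˡ _))) (L.+-identityˡ _)))

      ε₁≉0 : ε 1F L.≉ L.0#
      ε₁≉0 eq = let (ℓ , P∈ , D∈ , Q∈) = reflect P𝟘 D₂ P𝟙 (affine-infinite-independent (P 𝟘) Vertical.D)
                      (ε 0F ∷ ε 2F ∷ [] , λ i → L.trans (L.sym (E≋ i)) (L.+-congˡ
                        (L.trans (L.+-congʳ (L.trans (L.*-congʳ eq) (L.zeroˡ _))) (L.+-identityˡ _)))) in
        L.1≉0 (L.trans (L.solve 0 (L.con true L.:= (L.con false L.:+ L.con true) L.:* L.con true) L.refl)
          (L.trans (secant ℓ 𝟘 𝟙 e₂ᵥ (proj₂ e₂) P∈ Q∈ D∈) (L.zeroʳ _)))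

      ε₂≉0 : ε 2F L.≉ L.0#
      ε₂≉0 eq = let (ℓ , P∈ , D∈ , Q∈) = reflect P𝟘 D₁ P𝟙 (affine-infinite-independent (P 𝟘) Horizontal.D)
                      (ε 0F ∷ ε 1F ∷ [] , λ i → L.trans (L.sym (E≋ i)) (L.+-congˡ (L.+-congˡ
                        (L.trans (L.+-congʳ (L.trans (L.*-congʳ eq) (L.zeroˡ _))) (L.+-identityˡ _))))) in
        L.1≉0 (L.trans (L.solve 0 (L.con true L.:= (L.con false L.:+ L.con true) L.:* L.con true) L.refl)
          (L.trans (L.sym (secant ℓ 𝟘 𝟙 e₁ (slope≉0 L.0#) P∈ Q∈ D∈)) (L.zeroʳ _)))

      -- Rescaled so that the unit point receives the coordinates (1,1,1); with the triangle alone a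
      -- diagonal matrix would remain free.
      B : Vector (L.Vec 3) 3
      B = (ε 0F L.· A₀) ∷ (ε 1F L.· A₁) ∷ (ε 2F L.· A₂) ∷ []

      scaled : L.Vec 3 → L.Vec 3
      scaled a = a 0F L.* ε 0F ∷ a 1F L.* ε 1F ∷ a 2F L.* ε 2F ∷ []

      combination-B : ∀ a → L.combination a B L.≋ L.combination (scaled a) A
      combination-B a i = L.+-cong (L.sym (L.*-assoc _ _ _)) (L.+-cong (L.sym (L.*-assoc _ _ _)) (L.+-congʳ (L.sym (L.*-assoc _ _ _))))

      B-independent : L.LinearlyIndependent B
      B-independent a eq = λ { 0F → cancel ε₀≉0 (zeros 0F) ; 1F → cancel ε₁≉0 (zeros 1F) ; 2F → cancel ε₂≉0 (zeros 2F) }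
        where
        zeros : scaled a L.≋ L.0ᵥ
        zeros = A-independent (scaled a) (L.≋-trans (L.≋-sym (combination-B a)) eq)
        cancel : ∀ {x y} → y L.≉ L.0# → x L.* y L.≈ L.0# → x L.≈ L.0#
        cancel y≉0 xy≈0 = L.*-zero⇒ y≉0 (L.trans (L.*-comm _ _) xy≈0)

    -- The coordinate frame given by the images of the origin, of the points at
    -- infinity of the axes, and of the unit point.
    G : L.LinearIso 3
    G = L.basisIso {b = B} B-independent

    private
      module G = L.LinearIso G
      module G-to = L.IsLinear G.to-isLinear

      G-columns : ∀ {i} → ε i L.≉ L.0# → (n : L.Vec 3) → L.combination (scaled n) A L.≋ (ε i L.· A i) → A i L.∝ G.to n
      G-columns {i} ε≉0 n eq = L.inv ε≉0 , L.inv≉0 ε≉0 , λ j → L.sym (L.trans (L.*-congˡ (L.trans (combination-B n j) (eq j))) (L.inv-*∙ ε≉0 (A i j)))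

      open L using (solve; _:=_; _:+_; _:*_; con)

      A₀∝ : A₀ L.∝ G.to (L.1# ∷ L.0# ∷ L.0# ∷ [])
      A₀∝ = G-columns {0F} ε₀≉0 (L.1# ∷ L.0# ∷ L.0# ∷ []) λ j → solve 6 (λ a b c x y z → (con true :* a) :* x :+ ((con false :* b) :* y :+ ((con false :* c) :* z :+ con false)) := a :* x)
        L.refl (ε 0F) (ε 1F) (ε 2F) (A₀ j) (A₁ j) (A₂ j)

      A₁∝ : A₁ L.∝ G.to (L.0# ∷ L.1# ∷ L.0# ∷ [])
      A₁∝ = G-columns {1F} ε₁≉0 (L.0# ∷ L.1# ∷ L.0# ∷ []) λ j → solve 6 (λ a b c x y z → (con false :* a) :* x :+ ((con true :* b) :* y :+ ((con false :* c) :* z :+ con false)) := b :* y)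
        L.refl (ε 0F) (ε 1F) (ε 2F) (A₀ j) (A₁ j) (A₂ j)

    A₂∝ : image-vector D₂ L.∝ G.to (L.0# ∷ L.0# ∷ L.1# ∷ [])
    A₂∝ = G-columns {2F} ε₂≉0 (L.0# ∷ L.0# ∷ L.1# ∷ []) λ j → solve 6 (λ a b c x y z → (con false :* a) :* x :+ ((con false :* b) :* y :+ ((con true :* c) :* z :+ con false)) := c :* z)
      L.refl (ε 0F) (ε 1F) (ε 2F) (A₀ j) (A₁ j) (A₂ j)

    private
      E∝ : E L.∝ G.to (L.1# ∷ L.1# ∷ L.1# ∷ [])
      E∝ = L.∝-refl λ j → L.trans (L.sym (E≋ j)) (L.sym (L.trans (combination-B (L.1# ∷ L.1# ∷ L.1# ∷ []) j)
        (L.combination-cong {a = scaled (L.1# ∷ L.1# ∷ L.1# ∷ [])} {a′ = ε} A (λ { 0F → L.*-identityˡ _ ; 1F → L.*-identityˡ _ ; 2F → L.*-identityˡ _ }) j)))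

      ψ : L.Vec 2 → L.Vec 3
      ψ x = G.from (image-vector (inj₁ (P x)))

      -- The zeros of the first coordinate form the line through the images of the two axis
      -- directions, the image of ℓ∞.
      ψ₀≉0 : ∀ x → ψ x 0F L.≉ L.0#
      ψ₀≉0 x eq = affine∉A₁A₂ x (scaled (ψ x) ∘ suc , λ i → L.trans (L.sym (G.to∘from (image-vector (inj₁ (P x))) i))
        (L.trans (combination-B (ψ x) i) (L.trans (L.+-congʳ (L.trans (L.*-congʳ (L.trans (L.*-congʳ eq) (L.zeroˡ _))) (L.zeroˡ _))) (L.+-identityˡ _))))

      abstract
        n : L.Vec 2 → L.Vec 3
        n x = L.inv (ψ₀≉0 x) L.· ψ x

        n₀ : ∀ x → n x 0F L.≈ L.1#
        n₀ x = L.inv-* (ψ₀≉0 x)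

        image∝n : ∀ x → image-vector (inj₁ (P x)) L.∝ G.to (n x)
        image∝n x = ψ x 0F , ψ₀≉0 x , λ i → L.trans (L.sym (G.to∘from (image-vector (inj₁ (P x))) i))
          (L.trans (G-to.≋-cong {ψ x} {ψ x 0F L.· n x} (λ j → L.sym (L.*-inv∙ (ψ₀≉0 x) (ψ x j))) i) (G-to.·-homo (ψ x 0F) (n x) i))

      from-∝ : ∀ {Z z} → Z L.∝ G.to z → z L.∝ G.from Z
      from-∝ {Z} {z} Z∝ = L.∝.sym {3} {G.from Z} {z} (L.∝-resp {u = G.from Z} (L.linear-∝ G.from-isLinear Z∝) (G.from∘to z))

      n-unique : ∀ x z → z 0F L.≈ L.1# → image-vector (inj₁ (P x)) L.∝ G.to z → n x L.≋ z
      n-unique x z z₀≈1 ∝z = go (L.∝.trans {3} {n x} {ψ x} {z} (from-∝ (image∝n x)) (L.∝.sym {3} {z} {ψ x} (from-∝ ∝z)))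
        where
        go : n x L.∝ z → n x L.≋ z
        go (c , _ , eq) i = L.trans (eq i) (L.trans (L.*-congʳ c≈1) (L.*-identityˡ _))
          where
          c≈1 : c L.≈ L.1#
          c≈1 = L.trans (L.sym (L.*-identityʳ c)) (L.trans (L.*-congˡ (L.sym z₀≈1)) (L.trans (L.sym (eq 0F)) (n₀ x)))

      n-cong : ∀ {x y} → x L.≋ y → n x L.≋ n y
      n-cong {x} {y} x≋y = n-unique x (n y) (n₀ y) (L.∝.trans {3} {image-vector (inj₁ (P x))} {image-vector (inj₁ (P y))} {G.to (n y)}
        (onPoints.to-cong {inj₁ (P x)} {inj₁ (P y)} (inj₁ (K.∝-refl λ i → K.+-congˡ (f-cong x≋y i)))) (image∝n y))

      n-𝟘 : n 𝟘 L.≋ (L.1# ∷ L.0# ∷ L.0# ∷ [])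
      n-𝟘 = n-unique 𝟘 (L.1# ∷ L.0# ∷ L.0# ∷ []) L.refl A₀∝

      n-𝟙 : n 𝟙 L.≋ (L.1# ∷ L.1# ∷ L.1# ∷ [])
      n-𝟙 = n-unique 𝟙 (L.1# ∷ L.1# ∷ L.1# ∷ []) L.refl E∝

      det≈0 : ∀ {A B Z a b z} ℓ → A plane.I ℓ → B plane.I ℓ → Z plane.I ℓ →
              image-vector A L.∝ G.to a → image-vector B L.∝ G.to b → image-vector Z L.∝ G.to z → det a b z L.≈ L.0#
      det≈0 {A} {B} {Z} {a} {b} {z} ℓ A∈ B∈ Z∈ A∝ B∝ Z∝ = collinear⇒det≈0 {a} {b} {z}
        (collinear-map G.from-isLinear (from-∝ A∝) (from-∝ B∝) (from-∝ Z∝) (images-collinear ℓ A B Z A∈ B∈ Z∈))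

      det-line : ∀ d d≉0 x y l → y L.≋ (x L.+ᵥ (l L.· d)) → ∀ z → image-vector (inj₂ (Direction.D d d≉0)) L.∝ G.to z →
                 det (n x) (n y) z L.≈ L.0#
      det-line d d≉0 x y l y≋ z Z∝ = det≈0 {inj₁ (P x)} {inj₁ (P y)} {inj₂ (Direction.D d d≉0)} {n x} {n y} {z}
          (inj₂ Line.affinePlane)
          (Line.P∈ x L.0# λ i → L.sym (L.trans (L.+-congˡ (L.zeroˡ _)) (L.+-identityʳ _)))
          (Line.P∈ y l y≋) (λ {X} → Line.D⊆ {X}) (image∝n x) (image∝n y) Z∝
        where
        module Line = Direction.Through d d≉0 x

    τ : L.Carrier → L.Carrier
    τ a = n (a ∷ L.0# ∷ []) 1F

    private
      ρ : L.Carrier → L.Carrier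
      ρ b = n (L.0# ∷ b ∷ []) 2F

      det-n : ∀ x y z → det (n x) (n y) z L.≈
              (n y 1F L.* z 2F L.+ n y 2F L.* z 1F) L.+ n x 1F L.* (z 2F L.+ n y 2F L.* z 0F) L.+ n x 2F L.* (z 1F L.+ n y 1F L.* z 0F)
      det-n x y z = L.+-cong (L.+-cong
          (L.trans (L.*-congʳ (n₀ x)) (L.*-identityˡ _))
          (L.*-congˡ (L.+-congʳ (L.trans (L.*-congʳ (n₀ y)) (L.*-identityˡ _)))))
        (L.*-congˡ (L.+-congʳ (L.trans (L.*-congʳ (n₀ y)) (L.*-identityˡ _))))

      -- The vertical line through x is mapped to a line through (0,0,1), so it carries a constant
      -- first affine coordinate.
      n₁ : ∀ x → n x 1F L.≈ τ (x 0F)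
      n₁ x = L.by₁ L.1# (solve 4 (λ α β α′ β′ → α :+ α′ := con true :* (((α :* con true :+ β :* con false)
            :+ α′ :* (con true :+ β :* con false) :+ β′ :* (con false :+ α :* con false)) :+ con false))
          L.refl (n x 1F) (n x 2F) (n y 1F) (n y 2F))
        (L.trans (L.sym (det-n y x ∞)) (det-line e₂ᵥ (proj₂ e₂) y x (x 1F)
          (λ { 0F → L.sym (L.trans (L.+-congˡ (L.zeroʳ _)) (L.+-identityʳ _)) ; 1F → L.sym (L.trans (L.+-identityˡ _) (L.*-identityʳ _)) }) ∞ A₂∝))
        where
        y : L.Vec 2
        y = x 0F ∷ L.0# ∷ []
        ∞ : L.Vec 3
        ∞ = L.0# ∷ L.0# ∷ L.1# ∷ []

      n₂ : ∀ x → n x 2F L.≈ ρ (x 1F)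
      n₂ x = L.by₁ L.1# (solve 4 (λ α β α′ β′ → β :+ β′ := con true :* (((α :* con false :+ β :* con true)
            :+ α′ :* (con false :+ β :* con false) :+ β′ :* (con true :+ α :* con false)) :+ con false))
          L.refl (n x 1F) (n x 2F) (n y 1F) (n y 2F))
        (L.trans (L.sym (det-n y x ∞)) (det-line e₁ (slope≉0 L.0#) y x (x 0F)
          (λ { 0F → L.sym (L.trans (L.+-identityˡ _) (L.*-identityʳ _)) ; 1F → L.sym (L.trans (L.+-congˡ (L.zeroʳ _)) (L.+-identityʳ _)) }) ∞ A₁∝))
        where
        y : L.Vec 2
        y = L.0# ∷ x 1F ∷ []
        ∞ : L.Vec 3
        ∞ = L.0# ∷ L.1# ∷ L.0# ∷ []

      τ-cong : ∀ {a b} → a L.≈ b → τ a L.≈ τ b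
      τ-cong {a} {b} a≈b = n-cong {a ∷ L.0# ∷ []} {b ∷ L.0# ∷ []} (λ { 0F → a≈b ; 1F → L.refl }) 1F

      ρ-cong : ∀ {a b} → a L.≈ b → ρ a L.≈ ρ b
      ρ-cong {a} {b} a≈b = n-cong {L.0# ∷ a ∷ []} {L.0# ∷ b ∷ []} (λ { 0F → L.refl ; 1F → a≈b }) 2F

      τ-0 : τ L.0# L.≈ L.0#
      τ-0 = n-𝟘 1F

      ρ-0 : ρ L.0# L.≈ L.0#
      ρ-0 = n-𝟘 2F

      τ-1 : τ L.1# L.≈ L.1#
      τ-1 = L.trans (L.sym (n₁ 𝟙)) (n-𝟙 1F)

      ρ-1 : ρ L.1# L.≈ L.1#
      ρ-1 = L.trans (L.sym (n₂ 𝟙)) (n-𝟙 2F)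

      n≋ : ∀ x → n x L.≋ (L.1# ∷ τ (x 0F) ∷ ρ (x 1F) ∷ [])
      n≋ x = λ { 0F → n₀ x ; 1F → n₁ x ; 2F → n₂ x }

      -- The line y = m x + b is mapped to the line with slope ρ m through (0 , ρ b).
      ρ-affine : ∀ m x b → ρ (m L.* x L.+ b) L.≈ ρ m L.* τ x L.+ ρ b
      ρ-affine m x b = L.+≈0⇒≈ (L.*-zero⇒ δ₁≉0 (begin
        δ 1F L.* (ρ (m L.* x L.+ b) L.+ (ρ m L.* τ x L.+ ρ b))
          ≈⟨ L.by₂ (τ x) L.1# (solve 6 (λ δ₁ δ₂ y m x b → (δ₁ :* (y :+ (m :* x :+ b))) :+ con false
               := x :* (δ₂ :+ m :* δ₁) :+ con true :* ((x :* δ₂ :+ y :* δ₁ :+ b :* δ₁) :+ con false))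
               L.refl (δ 1F) (δ 2F) (ρ (m L.* x L.+ b)) (ρ m) (τ x) (ρ b)) δ₂≈ equation ⟩
        L.0# ∎))
        where
        open import Relation.Binary.Reasoning.Setoid L.setoid
        Dₘ : AffinePoint ⊎ SpreadLine
        Dₘ = inj₂ (Slope.D m)
        δ : L.Vec 3
        δ = G.from (image-vector Dₘ)
        Dₘ∝ : image-vector Dₘ L.∝ G.to δ
        Dₘ∝ = L.∝-refl (L.≋-sym (G.to∘from (image-vector Dₘ)))
        δ₀≈0 : δ 0F L.≈ L.0#
        δ₀≈0 = begin
          δ 0F ≈⟨ solve 3 (λ x y z → x := con false :* (con false :* z :+ con true :* y) :+ con true :* (con false :* z :+ con true :* x)
                   :+ con false :* (con false :* y :+ con false :* x)) L.refl (δ 0F) (δ 1F) (δ 2F) ⟩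
          det (L.0# ∷ L.1# ∷ L.0# ∷ []) (L.0# ∷ L.0# ∷ L.1# ∷ []) δ
            ≈⟨ det≈0 {D₁} {D₂} {Dₘ} {L.0# ∷ L.1# ∷ L.0# ∷ []} {L.0# ∷ L.0# ∷ L.1# ∷ []} {δ} (inj₁ tt) tt tt tt A₁∝ A₂∝ Dₘ∝ ⟩
          L.0# ∎
        line-equation : ∀ x y l → y L.≋ (x L.+ᵥ (l L.· slope m)) → ∀ {α β α′ β′} →
          n x L.≋ (L.1# ∷ α ∷ β ∷ []) → n y L.≋ (L.1# ∷ α′ ∷ β′ ∷ []) →
          (α L.+ α′) L.* δ 2F L.+ (β L.+ β′) L.* δ 1F L.≈ L.0#
        line-equation x y l y≋ {α} {β} {α′} {β′} nx ny = begin
          (α L.+ α′) L.* δ 2F L.+ (β L.+ β′) L.* δ 1F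
            ≈⟨ solve 6 (λ α β α′ β′ δ₁ δ₂ → (α :+ α′) :* δ₂ :+ (β :+ β′) :* δ₁
                 := con true :* (α′ :* δ₂ :+ β′ :* δ₁) :+ α :* (con true :* δ₂ :+ β′ :* con false) :+ β :* (con true :* δ₁ :+ α′ :* con false))
                 L.refl α β α′ β′ (δ 1F) (δ 2F) ⟩
          det (L.1# ∷ α ∷ β ∷ []) (L.1# ∷ α′ ∷ β′ ∷ []) (L.0# ∷ δ 1F ∷ δ 2F ∷ [])
            ≈⟨ det-cong {u = n x} {u′ = L.1# ∷ α ∷ β ∷ []} {v = n y} {v′ = L.1# ∷ α′ ∷ β′ ∷ []}
                 {z = δ} {z′ = L.0# ∷ δ 1F ∷ δ 2F ∷ []} nx ny (λ { 0F → δ₀≈0 ; 1F → L.refl ; 2F → L.refl }) ⟨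
          det (n x) (n y) δ
            ≈⟨ det-line (slope m) (slope≉0 m) x y l y≋ δ Dₘ∝ ⟩
          L.0# ∎
        δ₂≈ : δ 2F L.≈ ρ m L.* δ 1F
        δ₂≈ = L.by₁ L.1# (solve 3 (λ δ₁ δ₂ m → δ₂ :+ m :* δ₁
                := con true :* (((con false :+ con true) :* δ₂ :+ (con false :+ m) :* δ₁) :+ con false)) L.refl (δ 1F) (δ 2F) (ρ m))
          (line-equation 𝟘 (slope m) L.1# (λ { 0F → L.sym (L.trans (L.+-identityˡ _) (L.*-identityˡ _)) ; 1F → L.sym (L.trans (L.+-identityˡ _) (L.*-identityˡ _)) })
            n-𝟘 (L.≋-trans (n≋ (slope m)) λ { 0F → L.refl ; 1F → τ-1 ; 2F → L.refl }))
        equation : τ x L.* δ 2F L.+ ρ (m L.* x L.+ b) L.* δ 1F L.+ ρ b L.* δ 1F L.≈ L.0#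
        equation = L.by₁ L.1# (solve 5 (λ δ₁ δ₂ x y b → (x :* δ₂ :+ y :* δ₁ :+ b :* δ₁) :+ con false
                := con true :* (((con false :+ x) :* δ₂ :+ (b :+ y) :* δ₁) :+ con false)) L.refl (δ 1F) (δ 2F) (τ x) (ρ (m L.* x L.+ b)) (ρ b))
          (line-equation (L.0# ∷ b ∷ []) (x ∷ m L.* x L.+ b ∷ []) x
            (λ { 0F → L.sym (L.trans (L.+-identityˡ _) (L.*-identityʳ _)) ; 1F → L.trans (L.+-comm _ _) (L.+-congˡ (L.*-comm m x)) })
            (L.≋-trans (n≋ (L.0# ∷ b ∷ [])) λ { 0F → L.refl ; 1F → τ-0 ; 2F → L.refl })
            (n≋ (x ∷ m L.* x L.+ b ∷ [])))
        δ₁≉0 : δ 1F L.≉ L.0#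
        δ₁≉0 δ₁≈0 = image≉0 Dₘ (L.≋-trans (L.≋-sym (G.to∘from (image-vector Dₘ))) (G-to.0-homo {δ}
          λ { 0F → δ₀≈0 ; 1F → δ₁≈0 ; 2F → L.trans δ₂≈ (L.trans (L.*-congˡ δ₁≈0) (L.zeroʳ _)) }))

      -- The diagonal y = x joins the origin to the unit point, so its image again has slope 1.
      ρ≈τ : ∀ x → ρ x L.≈ τ x
      ρ≈τ x = begin
        ρ x                          ≈⟨ ρ-cong (solve 1 (λ x → x := con true :* x :+ con false) L.refl x) ⟩
        ρ (L.1# L.* x L.+ L.0#)      ≈⟨ ρ-affine L.1# x L.0# ⟩
        ρ L.1# L.* τ x L.+ ρ L.0#    ≈⟨ L.+-cong (L.*-congʳ ρ-1) ρ-0 ⟩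
        L.1# L.* τ x L.+ L.0#        ≈⟨ L.trans (L.+-identityʳ _) (L.*-identityˡ _) ⟩
        τ x                          ∎
        where
        open import Relation.Binary.Reasoning.Setoid L.setoid

      τ-affine : ∀ m x b → τ (m L.* x L.+ b) L.≈ τ m L.* τ x L.+ τ b
      τ-affine m x b = L.trans (L.sym (ρ≈τ _)) (L.trans (ρ-affine m x b) (L.+-cong (L.*-congʳ (ρ≈τ m)) (ρ≈τ b)))

    -- Lines of slope 1 give additivity, and lines through the origin give multiplicativity.
    τ-isEndomorphism : IsEndomorphism L τ
    τ-isEndomorphism = record
      { τ-cong = τ-cong
      ; τ-+ = λ x y → L.trans (τ-cong (L.+-congʳ (L.sym (L.*-identityˡ x)))) (L.trans (τ-affine L.1# x y)
                (L.+-congʳ (L.trans (L.*-congʳ τ-1) (L.*-identityˡ _))))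
      ; τ-* = λ x y → L.trans (τ-cong (L.sym (L.+-identityʳ _))) (L.trans (τ-affine x y L.0#)
                (L.trans (L.+-congˡ τ-0) (L.+-identityʳ _)))
      ; τ-1 = τ-1
      }

    image-affine : ∀ x → image-vector (inj₁ (P x)) L.∝ G.to (L.1# ∷ τ (x 0F) ∷ τ (x 1F) ∷ [])
    image-affine x = L.∝-resp {u = image-vector (inj₁ (P x))} (image∝n x) (G-to.≋-cong {n x} {L.1# ∷ τ (x 0F) ∷ τ (x 1F) ∷ []}
      λ { 0F → n₀ x ; 1F → n₁ x ; 2F → L.trans (n₂ x) (ρ≈τ (x 1F)) })

-- Comparison with the standard unital.

module Classification (e : ℕ) (K : FiniteField (2 ℕ.^ (2 ℕ.* e ℕ.+ 1)))
  (L : FiniteField ((2 ℕ.^ (2 ℕ.* e ℕ.+ 1)) ℕ.^ 2)) (ι : FieldEmbedding K L) where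

  open QuadraticExtension e K L ι
  open NormalForms e K L ι
  open Coordinatisation e K L ι

  OnUnital : L.Vec 2 → Set
  OnUnital x = Im (x 1F) K.≈ K.F (Im (x 0F)) (Re (x 0F))

  _∷1 : L.Vec 2 → L.Vec 3
  x ∷1 = L.1# ∷ x 0F ∷ x 1F ∷ []

  ∞ : L.Vec 3
  ∞ = L.0# ∷ L.0# ∷ L.1# ∷ []

  -- The image of the standard unital under the map ν of its affine points.
  Unital : (L.Vec 2 → L.Vec 2) → L.Vec 3 → Set
  Unital ν v = (∃[ x ] OnUnital x × v L.∝ (ν x ∷1)) ⊎ v L.∝ ∞

  Unital-resp : ∀ ν {v w} → v L.∝ w → Unital ν w → Unital ν v
  Unital-resp ν {v} {w} v∝w (inj₁ (x , x∈ , w∝)) = inj₁ (x , x∈ , L.∝.trans {3} {v} {w} {ν x ∷1} v∝w w∝)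
  Unital-resp ν {v} {w} v∝w (inj₂ w∝) = inj₂ (L.∝.trans {3} {v} {w} {∞} v∝w w∝)

  module _ (U : Pred (L.Point 2) 0ℓ) (B : IsBuekenhoutTitsUnital e ι U) where
    open IsBuekenhoutTitsUnital B
    open AndréBruckBose K Σ∞ S

    private
      g : K.GL 4
      g = proj₁ isTitsOvoid

      N : NormalForm Σ∞ S C
      N = Normalisation.normalForm Σ∞ S isDesarguesian C V
        (coneProjection e K V H V∉H O g (proj₂ isTitsOvoid))
        (proj₁ meetsInSpreadLine) (proj₁ (proj₂ meetsInSpreadLine)) (proj₂ (proj₂ meetsInSpreadLine))

    module FromNormalForm (N : NormalForm Σ∞ S C) where
      open NormalForm N
      open Model N model
      private
        module G = L.LinearIso G
        module π = K.IsLinear π-isLinear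
        module onPoints = Inverse (_≅_.onPoints model)
        module points = Setoid (IncidenceStructure.points plane)
      open IsUnital isUnital using (respects)

      π-affine : ∀ x → π (affine x) K.≋ (K.1# ∷ Im (x 0F) ∷ Re (x 0F) ∷ Im (x 1F) ∷ [])
      π-affine x = K.≋-trans (π.+-homo w (f x)) (K.≋-trans (K.+ᵥ-cong π-w (π-f x))
        λ { 0F → K.+-identityʳ _ ; 1F → K.+-identityˡ _ ; 2F → K.+-identityˡ _ ; 3F → K.+-identityˡ _ })

      C⇒OnUnital : ∀ x → proj₁ (P x) ∈ C → OnUnital x
      C⇒OnUnital x x∈C = cases (cone⇒ (proj₁ (P x)) x∈C)
        where
        cases : π (affine x) K.≋ K.0ᵥ ⊎ K.Tits (π (affine x)) → OnUnital x
        cases (inj₁ eq) = ⊥-elim (K.1≉0 (K.trans (K.sym (π-affine₀ x)) (eq 0F)))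
        cases (inj₂ t)  = K.Tits-affine⁻¹ {K.1# ∷ Im (x 0F) ∷ Re (x 0F) ∷ Im (x 1F) ∷ []} K.refl
          (K.Tits-resp (K.∝-refl (K.≋-sym (π-affine x))) t)

      OnUnital⇒C : ∀ x → OnUnital x → proj₁ (P x) ∈ C
      OnUnital⇒C x x∈ = ⇒cone (proj₁ (P x)) (inj₂ (K.Tits-resp {w = K.1# ∷ Im (x 0F) ∷ Re (x 0F) ∷ Im (x 1F) ∷ []}
        (K.∝-refl (π-affine x)) (K.Tits-affine K.refl x∈)))

      affine-point : ∀ (A : AffinePoint) → ∃[ x ] affine x K.∝ proj₁ (proj₁ A)
      affine-point ((X , X≉0) , X∉Σ∞) = x , K.∝.sym {5} {X} {affine x} (k , k≉0 , X≋)
        where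
        k : K.Carrier
        k = π X 0F
        k≉0 : k K.≉ K.0#
        k≉0 k≈0 = X∉Σ∞ (⇒Σ∞ k≈0)
        -- X and w have heights k and 1 over Σ∞, so X + k w lies in Σ∞, which is f (L²); division by
        -- k then gives the coordinates of X.
        fy : ∃[ y ] f y K.≋ (X K.+ᵥ k K.· w)
        fy = Σ∞⇒f (⇒Σ∞ (K.trans (π.+-homo X (k K.· w) 0F) (K.trans (K.+-congˡ
          (K.trans (π.·-homo k w 0F) (K.trans (K.*-congˡ (π-w 0F)) (K.*-identityʳ k)))) (K.x+x≈0 k))))
        x : L.Vec 2
        x = ⟦ K.inv k≉0 ⟧ L.· proj₁ fy
        X≋ : X K.≋ (k K.· affine x)
        X≋ i = K.sym (K.trans (K.distribˡ k (w i) (f x i)) (K.trans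
          (K.+-congˡ (K.trans (K.*-congˡ (f-· (K.inv k≉0) (proj₁ fy) i)) (K.trans (K.*-inv∙ k≉0 _) (proj₂ fy i))))
          (K.solve 2 (λ x y → y K.:+ (x K.:+ y) K.:= x) K.refl (X i) (k K.* w i))))

      ν : L.Vec 2 → L.Vec 2
      ν x = τ (x 0F) ∷ τ (x 1F) ∷ []

      G-from-∝ : ∀ {Q z} → Q L.∝ G.to z → G.from Q L.∝ z
      G-from-∝ {Q} {z} Q∝ = L.∝-resp {u = G.from Q} (L.linear-∝ G.from-isLinear Q∝) (G.from∘to z)

      G-to-∝ : ∀ {Q z} → G.from Q L.∝ z → Q L.∝ G.to z
      G-to-∝ {Q} {z} Q∝ = L.∝.trans {3} {Q} {G.to (G.from Q)} {G.to z}
        (L.∝-refl (L.≋-sym (G.to∘from Q))) (L.linear-∝ G.to-isLinear Q∝)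

      U⇒ : ∀ Q → Q ∈ U → Unital ν (G.from (proj₁ Q))
      U⇒ Q Q∈U = Unital-resp ν {w = G.from (image-vector A)} (L.linear-∝ G.from-isLinear (L.∝.sym {3} {image-vector A} {proj₁ Q} toA≈Q))
          (cases A (Equivalence.from (arises A) (respects {Q} {onPoints.to A} (L.∝.sym {3} {image-vector A} {proj₁ Q} toA≈Q) Q∈U)))
        where
        A : AffinePoint ⊎ SpreadLine
        A = onPoints.from Q
        toA≈Q : image-vector A L.∝ proj₁ Q
        toA≈Q = onPoints.inverseˡ {Q} {A} (points.refl {A})
        cases : ∀ A → A ∈ fromCone C → Unital ν (G.from (image-vector A))
        cases (inj₁ A) A∈C = inj₁ (x , x∈ , G-from-∝ (L.∝.trans {3} {image-vector (inj₁ A)} {image-vector (inj₁ (P x))} {G.to (ν x ∷1)}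
            (onPoints.to-cong {inj₁ A} {inj₁ (P x)} (inj₁ (K.∝.sym {5} {affine x} {proj₁ (proj₁ A)} (proj₂ (affine-point A)))))
            (image-affine x)))
          where
          x : L.Vec 2
          x = proj₁ (affine-point A)
          πx∝ : π (affine x) K.∝ π (proj₁ (proj₁ A))
          πx∝ = K.linear-∝ π-isLinear (proj₂ (affine-point A))
          transfer : π (proj₁ (proj₁ A)) K.≋ K.0ᵥ ⊎ K.Tits (π (proj₁ (proj₁ A))) → π (affine x) K.≋ K.0ᵥ ⊎ K.Tits (π (affine x))
          transfer (inj₁ eq) = inj₁ λ i → K.trans (proj₂ (proj₂ πx∝) i) (K.trans (K.*-congˡ (eq i)) (K.zeroʳ _))
          transfer (inj₂ t)  = inj₂ (K.Tits-resp πx∝ t)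
          x∈ : OnUnital x
          x∈ = C⇒OnUnital x (⇒cone (proj₁ (P x)) (transfer (cone⇒ (proj₁ A) A∈C)))
        cases (inj₂ (m , m∈S)) (⊆m , m⊆) = inj₂ (G-from-∝ (L.∝.trans {3} {image-vector (inj₂ (m , m∈S))} {image-vector (inj₂ Vertical.D)} {G.to ∞}
          (onPoints.to-cong {inj₂ (m , m∈S)} {inj₂ Vertical.D} (inj₂
            ((λ {X} X∈m → proj₂ Vertical.line≐ {X} (proj₁ at-Σ∞ {X} (m⊆ {X} X∈m)))
            , (λ {X} X∈ → ⊆m {X} (proj₂ at-Σ∞ {X} (proj₁ Vertical.line≐ {X} X∈))))))
          A₂∝))

      ⇒U : ∀ Q → Unital ν (G.from (proj₁ Q)) → Q ∈ U
      ⇒U Q (inj₁ (x , x∈ , eq)) = respects {onPoints.to (inj₁ (P x))} {Q}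
        (L.∝.trans {3} {image-vector (inj₁ (P x))} {G.to (ν x ∷1)} {proj₁ Q} (image-affine x)
          (L.∝.sym {3} {proj₁ Q} {G.to (ν x ∷1)} (G-to-∝ eq)))
        (Equivalence.to (arises (inj₁ (P x))) (OnUnital⇒C x x∈))
      ⇒U Q (inj₂ eq) = respects {onPoints.to (inj₂ Vertical.D)} {Q}
        (L.∝.trans {3} {image-vector (inj₂ Vertical.D)} {G.to ∞} {proj₁ Q} A₂∝
          (L.∝.sym {3} {proj₁ Q} {G.to ∞} (G-to-∝ eq)))
        (Equivalence.to (arises (inj₂ Vertical.D))
          ((λ {X} X∈ → proj₂ Vertical.line≐ {X} (proj₁ at-Σ∞ {X} X∈)) , (λ {X} X∈ → proj₂ at-Σ∞ {X} (proj₁ Vertical.line≐ {X} X∈))))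

    coordinates : Σ[ G ∈ L.LinearIso 3 ] Σ[ τ ∈ (L.Carrier → L.Carrier) ] IsEndomorphism L τ ×
                  (∀ Q → Q ∈ U ⇔ Unital (λ x → τ (x 0F) ∷ τ (x 1F) ∷ []) (L.LinearIso.from G (proj₁ Q)))
    coordinates = Model.G N model , Model.τ N model , Model.τ-isEndomorphism N model ,
      λ Q → mk⇔ (FromNormalForm.U⇒ N Q) (FromNormalForm.⇒U N Q)

  module Untwist {τ : L.Carrier → L.Carrier} (isEndomorphism : IsEndomorphism L τ) where
    open IsEndomorphism isEndomorphism
    open Endomorphism isEndomorphism

    twist : L.Vec 2 → L.Vec 2
    twist x = τ (x 0F) ∷ τ (x 1F) ∷ []

    -- `F` is built from sums, products and powers with all coefficients 1.
    κ-F : ∀ s t → κ (K.F s t) K.≈ K.F (κ s) (κ t)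
    κ-F s t = K.trans (κ-+ _ _) (K.+-cong (K.trans (κ-+ _ _) (K.+-cong (κ-^ s (K.σ ℕ.+ 2)) (κ-^ t K.σ))) (κ-* s t))

    κOnUnital : L.Vec 2 → Set
    κOnUnital x = κ (Im (x 1F)) K.≈ K.F (κ (Im (x 0F))) (κ (Re (x 0F)))

    OnUnital⇒κ : ∀ x → OnUnital x → κOnUnital x
    OnUnital⇒κ x x∈ = K.trans (κ-cong x∈) (κ-F _ _)

    κ⇒OnUnital : ∀ x → κOnUnital x → OnUnital x
    κ⇒OnUnital x x∈ = κ-injective (K.trans x∈ (K.sym (κ-F _ _)))

    Untwisting : Set
    Untwisting = Σ[ I ∈ L.LinearIso 3 ] (∀ v → Unital twist v ⇔ Unital (λ x → x) (L.LinearIso.to I v))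

    -- The linear map I need not undo τ. It is enough that I after the twist is a map ν of the
    -- affine plane that maps the standard unital onto itself.
    untwisting : (I : L.LinearIso 3) (ν : L.Vec 2 → L.Vec 2) →
                 (∀ x → L.LinearIso.to I (twist x ∷1) L.≋ (ν x ∷1)) → L.LinearIso.to I ∞ L.≋ ∞ →
                 (∀ x → OnUnital x ⇔ OnUnital (ν x)) → (∀ y → ∃[ x ] ν x L.≋ y) → Untwisting
    untwisting I ν I-affine I-∞ preserved surjective = I , λ v → mk⇔ (to v) (from v)
      where
      module I = L.LinearIso I
      to : ∀ v → Unital twist v → Unital (λ x → x) (I.to v)
      to v (inj₁ (x , x∈ , v∝)) = inj₁ (ν x , Equivalence.to (preserved x) x∈ ,
        L.∝-resp {u = I.to v} (L.linear-∝ I.to-isLinear v∝) (I-affine x))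
      to v (inj₂ v∝) = inj₂ (L.∝-resp {u = I.to v} (L.linear-∝ I.to-isLinear v∝) I-∞)
      back : ∀ v {y z} → I.to v L.∝ y → I.to z L.≋ y → v L.∝ z
      back v {y} {z} Iv∝ Iz≋ = L.∝.trans {3} {v} {I.from (I.to v)} {z} (L.∝-refl (L.≋-sym (I.from∘to v)))
        (L.∝-resp {u = I.from (I.to v)} (L.linear-∝ I.from-isLinear (L.∝-resp {u = I.to v} Iv∝ (L.≋-sym Iz≋))) (I.from∘to z))
      from : ∀ v → Unital (λ x → x) (I.to v) → Unital twist v
      from v (inj₁ (y , y∈ , Iv∝)) = inj₁ (x , Equivalence.from (preserved x) νx∈ ,
          back v Iv∝ (L.≋-trans (I-affine x) λ { 0F → L.refl ; 1F → νx≋y 0F ; 2F → νx≋y 1F }))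
        where
        x : L.Vec 2
        x = proj₁ (surjective y)
        νx≋y : ν x L.≋ y
        νx≋y = proj₂ (surjective y)
        νx∈ : OnUnital (ν x)
        νx∈ = K.trans (Im-cong (νx≋y 1F)) (K.trans y∈ (K.F-cong (Im-cong (L.sym (νx≋y 0F))) (Re-cong (L.sym (νx≋y 0F)))))
      from v (inj₂ Iv∝) = inj₂ (back v Iv∝ I-∞)

    untwist : Untwisting
    untwist = cases τω
      where
      cases : τ ω L.≈ ω ⊎ τ ω L.≈ ω L.+ L.1# → Untwisting
      -- Here Re and Im commute with τ, so the twist itself preserves the standard unital and no
      -- correction is necessary.
      cases (inj₁ τω≈ω) = untwisting identity twist (λ x → L.≋-refl) L.≋-refl
          (λ x → mk⇔ (λ x∈ → K.trans (Im-τ (x 1F)) (K.trans (OnUnital⇒κ x x∈) (K.F-cong (K.sym (Im-τ (x 0F))) (K.sym (Re-τ (x 0F))))))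
                     (λ x∈ → κ⇒OnUnital x (K.trans (K.sym (Im-τ (x 1F))) (K.trans x∈ (K.F-cong (Im-τ (x 0F)) (Re-τ (x 0F)))))))
          (λ y → proj₁ (τ-surjective (y 0F)) ∷ proj₁ (τ-surjective (y 1F)) ∷ [] ,
                 λ { 0F → proj₂ (τ-surjective (y 0F)) ; 1F → proj₂ (τ-surjective (y 1F)) })
        where
        identity : L.LinearIso 3
        identity = L.identityₗ
        τ-components : ∀ z → Re (τ z) K.≈ κ (Re z) × Im (τ z) K.≈ κ (Im z)
        τ-components z = components (L.trans (τ-expand z) (L.+-congˡ (L.*-congˡ τω≈ω)))
        Re-τ : ∀ z → Re (τ z) K.≈ κ (Re z)
        Re-τ z = proj₁ (τ-components z)
        Im-τ : ∀ z → Im (τ z) K.≈ κ (Im z)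
        Im-τ z = proj₂ (τ-components z)
      cases (inj₂ τω≈ω+1) = untwisting shear ν (λ x → λ { 0F → L.refl ; 1F → L.+-congˡ (L.*-identityʳ ω) ; 2F → L.+-congˡ (L.*-identityʳ ω) })
          (λ { 0F → L.refl
             ; 1F → L.solve 1 (λ w → L.con false L.:+ w L.:* L.con false L.:= L.con false) L.refl ω
             ; 2F → L.solve 1 (λ w → (L.con true L.:+ (L.con true L.:+ w) L.:* L.con false) L.:+ w L.:* L.con false L.:= L.con true) L.refl ω })
          (λ x → mk⇔ (to x) (from x)) surjective
        where
        -- Conjugating ω adds Im z to Re z, which the translation by s ↦ s + 1 of the ovoid undoes.
        ν : L.Vec 2 → L.Vec 2
        ν x = τ (x 0F) L.+ ω ∷ (τ (x 1F) L.+ (L.1# L.+ ω) L.* τ (x 0F)) L.+ ω ∷ []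
        shear : L.LinearIso 3
        shear = record
          { to = λ v → v 0F ∷ v 1F L.+ ω L.* v 0F ∷ (v 2F L.+ (L.1# L.+ ω) L.* v 1F) L.+ ω L.* v 0F ∷ []
          -- Undoing the shift by ω inside the term with coefficient 1 + ω contributes (1 + ω) ω =
          -- 1, so the constant ω becomes 1 + ω.
          ; from = λ v → v 0F ∷ v 1F L.+ ω L.* v 0F ∷ (v 2F L.+ (L.1# L.+ ω) L.* v 1F) L.+ (L.1# L.+ ω) L.* v 0F ∷ []
          ; to-isLinear = isLinear ω
          ; from-isLinear = isLinear (L.1# L.+ ω)
          ; from∘to = λ v → λ { 0F → L.refl ; 1F → cancel₁ (v 1F) (v 0F) ; 2F →
              L.by₁ (v 0F) (solve 4 (λ w a b c → (((c :+ (con true :+ w) :* b) :+ w :* a) :+ (con true :+ w) :* (b :+ w :* a)) :+ (con true :+ w) :* a :+ c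
                := a :* (w :* w :+ (w :+ con true))) L.refl ω (v 0F) (v 1F) (v 2F)) ω²≈ω+1 }
          ; to∘from = λ v → λ { 0F → L.refl ; 1F → cancel₁ (v 1F) (v 0F) ; 2F →
              L.by₁ (v 0F) (solve 4 (λ w a b c → (((c :+ (con true :+ w) :* b) :+ (con true :+ w) :* a) :+ (con true :+ w) :* (b :+ w :* a)) :+ w :* a :+ c
                := a :* (w :* w :+ (w :+ con true))) L.refl ω (v 0F) (v 1F) (v 2F)) ω²≈ω+1 }
          }
          where
          open L using (solve; _:=_; _:+_; _:*_; con)
          cancel₁ : ∀ b a → (b L.+ ω L.* a) L.+ ω L.* a L.≈ b
          cancel₁ b a = solve 3 (λ w a b → (b :+ w :* a) :+ w :* a := b) L.refl ω a b
          isLinear : ∀ c → L.IsLinear {3} {3} (λ v → v 0F ∷ v 1F L.+ ω L.* v 0F ∷ (v 2F L.+ (L.1# L.+ ω) L.* v 1F) L.+ c L.* v 0F ∷ [])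
          isLinear c = record
            { ≋-cong = λ p → λ { 0F → p 0F ; 1F → L.+-cong (p 1F) (L.*-congˡ (p 0F))
                ; 2F → L.+-cong (L.+-cong (p 2F) (L.*-congˡ (p 1F))) (L.*-congˡ (p 0F)) }
            ; +-homo = λ v w → λ { 0F → L.refl
                ; 1F → solve 5 (λ a x y x′ y′ → (x :+ x′) :+ a :* (y :+ y′) := (x :+ a :* y) :+ (x′ :+ a :* y′)) L.refl ω (v 1F) (v 0F) (w 1F) (w 0F)
                ; 2F → solve 8 (λ a b x y z x′ y′ z′ → ((x :+ x′) :+ a :* (y :+ y′)) :+ b :* (z :+ z′) := ((x :+ a :* y) :+ b :* z) :+ ((x′ :+ a :* y′) :+ b :* z′))
                    L.refl (L.1# L.+ ω) c (v 2F) (v 1F) (v 0F) (w 2F) (w 1F) (w 0F) }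
            ; ·-homo = λ k v → λ { 0F → L.refl
                ; 1F → solve 4 (λ a k x y → k :* x :+ a :* (k :* y) := k :* (x :+ a :* y)) L.refl ω k (v 1F) (v 0F)
                ; 2F → solve 6 (λ a b k x y z → (k :* x :+ a :* (k :* y)) :+ b :* (k :* z) := k :* ((x :+ a :* y) :+ b :* z))
                    L.refl (L.1# L.+ ω) c k (v 2F) (v 1F) (v 0F) }
            }
        τ-components : ∀ z → Re (τ z) K.≈ κ (Re z) K.+ κ (Im z) × Im (τ z) K.≈ κ (Im z)
        τ-components z = components (L.trans (τ-expand z) (L.trans (L.+-congˡ (L.*-congˡ τω≈ω+1))
          (L.trans (L.solve 3 (λ a b w → a L.:+ b L.:* (w L.:+ L.con true) L.:= (a L.:+ b) L.:+ b L.:* w) L.refl ⟦ κ (Re z) ⟧ ⟦ κ (Im z) ⟧ ω)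
            (L.+-congʳ (L.sym (⟦⟧-+ _ _))))))
        Re-τ : ∀ z → Re (τ z) K.≈ κ (Re z) K.+ κ (Im z)
        Re-τ z = proj₁ (τ-components z)
        Im-τ : ∀ z → Im (τ z) K.≈ κ (Im z)
        Im-τ z = proj₂ (τ-components z)
        open import Relation.Binary.Reasoning.Setoid K.setoid
        -- Accounts for the coefficient 1 + ω in ν: translating the ovoid by s ↦ s + 1 adds 1 + s +
        -- t to F s t, and s + t is the real part of the twisted first coordinate. The added ω
        -- provides the 1.
        Im-[1+ω]* : ∀ z → Im ((L.1# L.+ ω) L.* z) K.≈ Re z
        Im-[1+ω]* z = begin
          Im ((L.1# L.+ ω) L.* z)             ≈⟨ Im-cong (L.trans (L.distribʳ z L.1# ω) (L.+-congʳ (L.*-identityˡ z))) ⟩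
          Im (z L.+ ω L.* z)                  ≈⟨ Im-+ z (ω L.* z) ⟩
          Im z K.+ Im (ω L.* z)               ≈⟨ K.+-congˡ (proj₂ (Re-Im-* ω z)) ⟩
          Im z K.+ (Re ω K.* Im z K.+ Im ω K.* Re z K.+ Im ω K.* Im z)
            ≈⟨ K.+-congˡ (K.+-cong (K.+-cong (K.*-congʳ (proj₁ Re-Im-ω)) (K.*-congʳ (proj₂ Re-Im-ω))) (K.*-congʳ (proj₂ Re-Im-ω))) ⟩
          Im z K.+ (K.0# K.* Im z K.+ K.1# K.* Re z K.+ K.1# K.* Im z)
            ≈⟨ K.solve 2 (λ x y → y K.:+ (K.con false K.:* y K.:+ K.con true K.:* x K.:+ K.con true K.:* y) K.:= x) K.refl (Re z) (Im z) ⟩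
          Re z ∎
        module _ (x : L.Vec 2) where
          s t j : K.Carrier
          s = κ (Im (x 0F))
          t = κ (Re (x 0F))
          j = κ (Im (x 1F))
          Im-ν₁ : Im (ν x 1F) K.≈ (j K.+ (t K.+ s)) K.+ K.1#
          Im-ν₁ = K.trans (Im-+ _ ω) (K.+-cong (K.trans (Im-+ _ _) (K.+-cong (Im-τ (x 1F)) (K.trans (Im-[1+ω]* _) (Re-τ (x 0F))))) (proj₂ Re-Im-ω))
          F-ν₀ : K.F (Im (ν x 0F)) (Re (ν x 0F)) K.≈ ((K.F s t K.+ K.1#) K.+ s) K.+ t
          F-ν₀ = begin
            K.F (Im (ν x 0F)) (Re (ν x 0F))
              ≈⟨ K.F-cong (K.trans (Im-+ _ ω) (K.+-cong (Im-τ (x 0F)) (proj₂ Re-Im-ω)))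
                   (K.trans (Re-+ _ ω) (K.+-cong (K.trans (Re-τ (x 0F)) (K.+-congˡ (K.sym (K.trans (K.*-congʳ K.φ-1) (K.*-identityˡ s))))) (proj₁ Re-Im-ω))) ⟩
            K.F (s K.+ K.1#) (t K.+ K.φ K.1# K.* s K.+ K.0#)
              ≈⟨ K.F-translate K.1# K.0# s t ⟩
            K.F s t K.+ K.F K.1# K.0# K.+ (K.0# K.+ K.φ K.1# K.* K.1#) K.* s K.+ K.1# K.* t
              ≈⟨ K.+-cong (K.+-cong (K.+-congˡ F-10) (K.trans (K.*-congʳ (K.trans (K.+-identityˡ _) (K.trans (K.*-identityʳ _) K.φ-1))) (K.*-identityˡ s))) (K.*-identityˡ t) ⟩
            K.F s t K.+ K.1# K.+ s K.+ t ∎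
            where
            F-10 : K.F K.1# K.0# K.≈ K.1#
            F-10 = K.trans (K.F≈ K.1# K.0#) (K.trans (K.+-congʳ (K.+-cong (K.*-congʳ K.φ-1) K.φ-0))
              (K.solve 0 (K.con true K.:* (K.con true K.:* K.con true) K.:+ K.con false K.:+ K.con true K.:* K.con false K.:= K.con true) K.refl))
          to : OnUnital x → OnUnital (ν x)
          to x∈ = K.trans Im-ν₁ (K.trans (K.by₁ K.1# (K.solve 4 (λ s t j F → ((j K.:+ (t K.:+ s)) K.:+ K.con true) K.:+ (((F K.:+ K.con true) K.:+ s) K.:+ t)
            K.:= K.con true K.:* (j K.:+ F)) K.refl s t j (K.F s t)) (OnUnital⇒κ x x∈)) (K.sym F-ν₀))
          from : OnUnital (ν x) → OnUnital x
          from νx∈ = κ⇒OnUnital x (K.by₁ K.1# (K.solve 4 (λ s t j F → j K.:+ F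
            K.:= K.con true K.:* (((j K.:+ (t K.:+ s)) K.:+ K.con true) K.:+ (((F K.:+ K.con true) K.:+ s) K.:+ t))) K.refl s t j (K.F s t))
            (K.trans (K.sym Im-ν₁) (K.trans νx∈ F-ν₀)))
        surjective : ∀ y → ∃[ x ] ν x L.≋ y
        surjective y = proj₁ x₀ ∷ proj₁ x₁ ∷ [] ,
          λ { 0F → L.trans (L.+-congʳ (proj₂ x₀)) (L.solve 2 (λ y w → (y L.:+ w) L.:+ w L.:= y) L.refl (y 0F) ω)
            ; 1F → L.trans (L.+-congʳ (L.+-cong (proj₂ x₁) (L.*-congˡ (proj₂ x₀))))
                     (L.solve 3 (λ y z w → ((y L.:+ (L.con true L.:+ w) L.:* (z L.:+ w) L.:+ w) L.:+ (L.con true L.:+ w) L.:* (z L.:+ w)) L.:+ w L.:= y) L.refl (y 1F) (y 0F) ω) }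
          where
          x₀ : ∃[ x ] τ x L.≈ y 0F L.+ ω
          x₀ = τ-surjective _
          x₁ : ∃[ x ] τ x L.≈ y 1F L.+ (L.1# L.+ ω) L.* (y 0F L.+ ω) L.+ ω
          x₁ = τ-surjective _

  standardise : ∀ U → IsBuekenhoutTitsUnital e ι U →
                Σ[ J ∈ L.LinearIso 3 ] (∀ Q → Q ∈ U ⇔ Unital (λ x → x) (L.LinearIso.to J (proj₁ Q)))
  standardise U B = compose (coordinates U B)
    where
    compose : (Σ[ G ∈ L.LinearIso 3 ] Σ[ τ ∈ (L.Carrier → L.Carrier) ] IsEndomorphism L τ ×
                (∀ Q → Q ∈ U ⇔ Unital (λ x → τ (x 0F) ∷ τ (x 1F) ∷ []) (L.LinearIso.from G (proj₁ Q)))) →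
              Σ[ J ∈ L.LinearIso 3 ] (∀ Q → Q ∈ U ⇔ Unital (λ x → x) (L.LinearIso.to J (proj₁ Q)))
    compose (G , τ , isEndomorphism , U⇔) = (proj₁ I L.∘ₗ (G L.⁻¹ₗ)) , λ Q → mk⇔
        (λ Q∈ → Equivalence.to (proj₂ I _) (Equivalence.to (U⇔ Q) Q∈))
        (λ Q∈ → Equivalence.from (U⇔ Q) (Equivalence.from (proj₂ I _) Q∈))
      where
      I : Untwist.Untwisting isEndomorphism
      I = Untwist.untwist isEndomorphism

  -- Linear bijections J₁ and J₂ carry both unitals onto the same standard one, so J₂⁻¹ J₁ maps the
  -- first onto the second.
  equivalent : ∀ U₁ U₂ → IsBuekenhoutTitsUnital e ι U₁ → IsBuekenhoutTitsUnital e ι U₂ →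
               Σ[ g ∈ L.GL 3 ] (L.image (L.projectivity g) U₁ ≐ U₂)
  equivalent U₁ U₂ B₁ B₂ = g , (λ {Q} → ⊆ {Q}) , (λ {Q} → ⊇ {Q})
    where
    J₁ J₂ : L.LinearIso 3
    J₁ = proj₁ (standardise U₁ B₁)
    J₂ = proj₁ (standardise U₂ B₂)
    module J₁ = L.LinearIso J₁
    module J₂ = L.LinearIso J₂
    I : L.LinearIso 3
    I = (J₂ L.⁻¹ₗ) L.∘ₗ J₁
    module I = L.LinearIso I
    g : L.GL 3
    g = L.fromLinearIso I
    g≋ : ∀ v → L._*ᵥ_ (L.GL.matrix g) v L.≋ I.to v
    g≋ = L.matrixOf-*ᵥ I.to-isLinear
    U₁⇔ : ∀ Q → Q ∈ U₁ ⇔ Unital (λ x → x) (J₁.to (proj₁ Q))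
    U₁⇔ = proj₂ (standardise U₁ B₁)
    U₂⇔ : ∀ Q → Q ∈ U₂ ⇔ Unital (λ x → x) (J₂.to (proj₁ Q))
    U₂⇔ = proj₂ (standardise U₂ B₂)
    ⊆ : ∀ {Q} → Q ∈ L.image (L.projectivity g) U₁ → Q ∈ U₂
    ⊆ {Q , Q≉0} ((P , P≉0) , P∈ , Q∝) = Equivalence.from (U₂⇔ (Q , Q≉0)) (Unital-resp (λ x → x) {J₂.to Q} {J₁.to P}
      (L.∝-resp {u = J₂.to Q} (L.linear-∝ J₂.to-isLinear (L.∝-resp {u = Q} {w = I.to P} Q∝ (g≋ P))) (J₂.to∘from (J₁.to P)))
      (Equivalence.to (U₁⇔ (P , P≉0)) P∈))
    ⊇ : ∀ {Q} → Q ∈ U₂ → Q ∈ L.image (L.projectivity g) U₁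
    ⊇ {Q , Q≉0} Q∈ = (P , P≉0) , Equivalence.from (U₁⇔ (P , P≉0)) (Unital-resp (λ x → x) {J₁.to P} {J₂.to Q}
        (L.∝-refl (J₁.to∘from (J₂.to Q))) (Equivalence.to (U₂⇔ (Q , Q≉0)) Q∈)) ,
        L.∝-refl (L.≋-sym (L.≋-trans (g≋ P) (I.to∘from Q)))
      where
      P : L.Vec 3
      P = I.from Q
      P≉0 : ¬ (P L.≋ L.0ᵥ)
      P≉0 eq = Q≉0 (L.≋-trans (L.≋-sym (I.to∘from Q)) (L.IsLinear.0-homo I.to-isLinear eq))

open import Data.Nat.Base using (ℕ; _+_; _*_; _^_; _≤_)

theorem1 : (e : ℕ) → 1 ≤ e →
    (K : FiniteField (2 ^ (2 * e + 1))) →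
    (L : FiniteField ((2 ^ (2 * e + 1)) ^ 2)) →
    (ι : FieldEmbedding K L) →
    let open Projective L in
    (U₁ U₂ : Pred (Point 2) 0ℓ) →
    IsBuekenhoutTitsUnital e ι U₁ →
    IsBuekenhoutTitsUnital e ι U₂ →
    Σ[ g ∈ GL 3 ] (image (projectivity g) U₁ ≐ U₂)
theorem1 e _ K L ι = Classification.equivalent e K L ι
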